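{- Let $A$ be a formula of the theory $T_1$ that is provable in $T_1$. Then the propositional translations $[\![A]\!]^{\vec m}$, for all tuples $\vec m$ of natural numbers (giving lengths of the free variables of $A$), have uniform polynomial-size Frege proofs; that is, there is a polynomial $p$ such that for every $\vec m$ the formula $[\![A]\!]^{\vec m}$ has a Frege proof of size at most $p(\vec m)$, and these proofs are uniform in the sense that there is a specific function taking a theorem of $T_1$ (with its $T_1$-proof) and the lengths of its variables to a Frege proof of the translation.
   Context: **The theory $T_1$** (quantifier-free; objects are finite strings over $\{0,1\}$). *Terms and function symbols, each of rank $0$ or $1$:* variables are terms of rank $0$; $f(t_1,\dots,t_n)$ is a term whose rank is the maximum of the ranks of $f,t_1,\dots,t_n$. Function symbols of rank $0$: constants $\varepsilon,0,1$; unary $\mathrm{zero},\mathrm{one},\mathrm{lh},\mathrm{rh}$; binary $x\cdot y$ (also written $xy$), $y\triangleright x$, $x\triangleleft y$; and $\mathrm{cond}(x,y,z_0,z_1)$. If $t$ is a term with all variables among $x_1,\dots,x_n$, then $[\lambda x_1\dots x_n.t]$ is an $n$-ary symbol of the rank of $t$. If $h$ is $(n+1)$-ary, $\ell\mathrm{CRN}[h]$ and $r\mathrm{CRN}[h]$ are $(n+1)$-ary of the rank of $h$. If $g$ is $(n+2)$-ary, $h$ is $(n+4)$-ary of rank $0$ and $h_\ell,h_r$ are unary of rank $0$, then $\mathrm{TRN}[g,h,h_\ell,h_r]$ is $(n+2)$-ary of rank $1$. *Formulas* are Boolean combinations ($\lnot,\land,\lor,\to,\leftrightarrow$) of equations between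 terms. (Intended meaning: $\mathrm{zero}(x),\mathrm{one}(x)$ = strings of $0$'s / $1$'s of length $|x|$; $\mathrm{lh}(x)$, $\mathrm{rh}(x)$ = the $\lfloor|x|/2\rfloor$ leftmost / $\lceil|x|/2\rceil$ rightmost bits; $y\triangleright x$, $x\triangleleft y$ = $x$ with $|y|$ bits removed from the left / right.) *Axioms* ($i,j\in\{0,1\}$): a complete set of propositional axioms; equality axioms (reflexivity, symmetry, transitivity, congruence for all function symbols); $\varepsilon\ne0$, $0\neq1$, $1\ne\varepsilon$; $x\cdot\varepsilon=x$, $x\cdot(y i)=(x\cdot y)\cdot i$; $x\cdot y=\varepsilon\to x=\varepsilon\land y=\varepsilon$; $x\cdot y=i\to(x=\varepsilon\land y=i)\lor(x=i\land y=\varepsilon)$; $\varepsilon\triangleright x=x$, $(iy)\triangleright x=i\triangleright(y\triangleright x)$, $i\triangleright\varepsilon=\varepsilon$, $i\triangleright(jx)=x$, $y\triangleright x=\varepsilon\leftrightarrow x\triangleright(yi)\neq\varepsilon$; $x\triangleleft\varepsilon=x$, $x\triangleleft(yi)=(x\triangleleft y)\triangleleft i$, $\varepsilon\triangleleft i=\varepsilon$, $(xj)\triangleleft i=x$, $x\triangleleft y=\varepsilon\leftrightarrow(iy)\triangleleft x\ne\varepsilon$; $\mathrm{zero}(\varepsilon)=\varepsilon$, $\mathrm{zero}(xi)=\mathrm{zero}(x)\cdot0$; $\mathrm{one}(\varepsilon)=\varepsilon$, $\mathrm{one}(xi)=\mathrm{one}(x)\cdot1$; $\mathrm{cond}(\varepsilon,x,y,z)=x$,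 $\mathrm{cond}(w0,x,y,z)=\mathrm{zero}(z\triangleleft y)\cdot y$, $\mathrm{cond}(w1,x,y,z)=\mathrm{zero}(y\triangleleft z)\cdot z$; $\mathrm{lh}(x)\cdot\mathrm{rh}(x)=x$, $\mathrm{lh}(x)\triangleleft\mathrm{rh}(x)=\varepsilon$, $1\triangleright(\mathrm{lh}(x)\triangleright\mathrm{rh}(x))=\varepsilon$; writing $E(x;y,z)$ for $\mathrm{cond}(\mathrm{lh}(x)\triangleright\mathrm{rh}(x),y,z,z)$: $\mathrm{lh}(xi)=E(x;\mathrm{lh}(x),\mathrm{lh}(x)\cdot((\mathrm{rh}(x)\cdot i)\triangleleft\mathrm{rh}(x)))$, $\mathrm{rh}(xi)=E(x;\mathrm{rh}(x)\cdot i,1\triangleright(\mathrm{rh}(x)\cdot i))$, $\mathrm{lh}(ix)=E(x;(i\cdot\mathrm{lh}(x))\triangleleft1,i\cdot\mathrm{lh}(x))$, $\mathrm{rh}(ix)=E(x;(\mathrm{lh}(x)\triangleright(i\cdot\mathrm{lh}(x)))\cdot\mathrm{rh}(x),\mathrm{rh}(x))$; $[\lambda\vec x.t](\vec x)=t$; $\ell\mathrm{CRN}[h](\varepsilon,\vec y)=\varepsilon$, $\ell\mathrm{CRN}[h](ix,\vec y)=((h(ix,\vec y)\cdot0)\triangleleft h(ix,\vec y))\cdot\ell\mathrm{CRN}[h](x,\vec y)$; $r\mathrm{CRN}[h](\varepsilon,\vec y)=\varepsilon$, $r\mathrm{CRN}[h](xi,\vec y)=r\mathrm{CRN}[h](x,\vec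 y)\cdot(h(xi,\vec y)\triangleright(0\cdot h(xi,\vec y)))$; and for $f=\mathrm{TRN}[g,h,h_\ell,h_r]$: $f(x,z,\vec y)=\mathrm{cond}(x\triangleleft1,g(x,z,\vec y),t,t)$ with $t=h(x,z,\vec y,f(\mathrm{lh}(x),h_\ell(z),\vec y),f(\mathrm{rh}(x),h_r(z),\vec y))$. *Rules:* a complete set of propositional rules; substitution $A\vdash A[t/x]$; NIND: from $A[\varepsilon]$, $A[x]\to A[0x]$, $A[x]\to A[1x]$ infer $A$, and likewise with $x0,x1$ in place of $0x,1x$; TIND: from $A[\varepsilon,z]$, $A[0,z]$, $A[1,z]$, $A[\mathrm{lh}(x),h_\ell(z)]\land A[\mathrm{rh}(x),h_r(z)]\to A[x,z]$ infer $A$, for unary $h_\ell,h_r$ of rank $0$. **Length functions.** All $T_1$-terms are length-determined; $\mathrm{len}_t(\vec m)$ gives the length of $t$ from the lengths $\vec m$ of its variables: $\mathrm{len}_x(m)=m$; $\mathrm{len}_{f(t_1,\dots,t_k)}(\vec m)=\mathrm{len}_{f(x_1,\dots,x_k)}(\mathrm{len}_{t_1},\dots,\mathrm{len}_{t_k})$; $\mathrm{len}_\varepsilon=0$, $\mathrm{len}_0=\mathrm{len}_1=1$; $\mathrm{zero},\mathrm{one}$: $m$; $\mathrm{lh}$: $\lfloor m/2\rfloor$; $\mathrm{rh}$: $\lceil m/2\rceil$; $x\triangleleft y$, $y\triangleright x$ (with $|x|=m,|y|=n$): $\max(m-n,0)$; $x\cdot y$: $m+n$; $\mathrm{cond}$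 with argument lengths $m,n,p_0,p_1$: $n$ if $m=0$, else $\max\{p_0,p_1\}$; $[\lambda\vec x.t](\vec y)$: that of $t[\vec y/\vec x]$; $\ell\mathrm{CRN}[h](x,\vec y)$, $r\mathrm{CRN}[h](x,\vec y)$: $m$; $f=\mathrm{TRN}[g,h,h_\ell,h_r]$: $\mathrm{len}_{g(x,z,\vec y)}(m,p,\vec n)$ if $m\le1$, else $\mathrm{len}_h$ applied to $m,p,\vec n$ and the lengths of $f(\mathrm{lh}(x),h_\ell(z),\vec y)$, $f(\mathrm{rh}(x),h_r(z),\vec y)$. **Term formulas** $\langle t\rangle^{\vec m}_i$, $1\le i\le\mathrm{len}_t(\vec m)$ (bit $i$ of $t$ from the left): for a variable $x$, $\langle x\rangle^m_1,\dots,\langle x\rangle^m_m$ are propositional atoms; $\langle f(t_1,\dots,t_k)\rangle_i$ is $\langle f(x_1,\dots,x_k)\rangle_i$ (fresh $x_j$ of length $\mathrm{len}_{t_j}$) with $\langle t_j\rangle_{i_j}$ substituted for $\langle x_j\rangle_{i_j}$; $\langle0\rangle_1=\bot$, $\langle1\rangle_1=\top$; $\langle\mathrm{zero}(x)\rangle_i=\bot$, $\langle\mathrm{one}(x)\rangle_i=\top$; $\langle\mathrm{lh}(x)\rangle_i=\langle x\rangle_i$, $\langle\mathrm{rh}(x)\rangle_i=\langle x\rangle_{i+\lfloor m/2\rfloor}$; $\langle x\triangleleft y\rangle_i=\langle x\rangle_i$, $\langle y\triangleright x\rangle_i=\langle x\rangle_{i+n}$ ($n=|y|$); $\langle x\cdot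 y\rangle_i=\langle x\rangle_i$ if $i\le m$, else $\langle y\rangle_{i-m}$; $\langle\mathrm{cond}(x,y,z_0,z_1)\rangle_i=\langle y\rangle_i$ if $m=0$, else $(\lnot\langle x\rangle_m\land\langle\mathrm{zero}(z_1\triangleleft z_0)\cdot z_0\rangle_i)\lor(\langle x\rangle_m\land\langle\mathrm{zero}(z_0\triangleleft z_1)\cdot z_1\rangle_i)$; $\langle[\lambda\vec x.t](\vec y)\rangle_i=\langle t[\vec y/\vec x]\rangle_i$; $\langle\ell\mathrm{CRN}[h](x,\vec y)\rangle^{m,\vec n}_i$ is $\langle h(z,\vec y)\cdot0\rangle^{m-i+1,\vec n}_1$ with $\langle x\rangle^m_{j+i-1}$ for $\langle z\rangle_j$ ($1\le j\le m-i+1$); $\langle r\mathrm{CRN}[h](x,\vec y)\rangle^{m,\vec n}_i$ is the last term formula of $0\cdot h(z,\vec y)$, $|z|=i$, with $\langle x\rangle^m_j$ for $\langle z\rangle_j$ ($1\le j\le i$); for $f=\mathrm{TRN}[g,h,h_\ell,h_r]$, $\langle f(x,z,\vec y)\rangle_i$ is $\langle g(x,z,\vec y)\rangle_i$ if $m\le1$, else $\langle h(x,z,\vec y,f(\mathrm{lh}(x),h_\ell(z),\vec y),f(\mathrm{rh}(x),h_r(z),\vec y))\rangle_i$. **Translations:** $[\![t=u]\!]^{\vec m}=\bigwedge_{1\le i\le\mathrm{len}_t}(\langle t\rangle_i\leftrightarrow\langle u\rangle_i)$ if $\mathrm{len}_t=\mathrm{len}_u$ (at the given lengths), and $\bot$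 otherwise; $[\![\cdot]\!]^{\vec m}$ commutes with the propositional connectives. A Frege proof is a proof in a fixed Frege system (standard sound and complete schematic propositional proof system) with connectives $\lnot,\land,\lor,\to,\leftrightarrow,\top,\bot$; all Frege systems are $p$-equivalent. -}

module Defs where

open import Data.Bool.Base as Bool using (Bool; true; false; not; _xor_; if_then_else_)
open import Data.Fin.Base using (Fin; zero; suc; _↑ˡ_; _↑ʳ_)
open import Data.List.Base as List using (List; []; _∷_)
open import Data.List.Membership.Propositional using (_∈_)
open import Data.List.Relation.Unary.All using (All)
open import Data.Nat.Base using (ℕ; zero; suc; _+_; _*_; _∸_; _⊔_; _<_; _≤ᵇ_; ⌊_/2⌋; ⌈_/2⌉)
open import Data.Nat.Induction using (Acc; acc; <-wellFounded)
open import Data.Nat.ListAction using (sum)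
open import Data.Nat.Properties using (_≟_; ⌊n/2⌋<n; ⌈n/2⌉<n)
open import Data.Product.Base using (Σ; _×_; _,_)
open import Data.Vec.Base as Vec using (Vec; []; _∷_; _++_; lookup; tabulate; zipWith)
open import Relation.Binary.PropositionalEquality using (_≡_)
open import Relation.Nullary.Decidable using (does)

infix  11 _⟨_⟩
infix   8 _≐_ _≠_
infix   7 ¬_
infixr  6 _∧_
infixr  5 _∨_
infixr  4 _⇒_
infix   3 _⇔_

------------------------------------------------------------------------
-- Terms and function symbols of T₁

mutual

  data Symbol : ℕ → Set where
    `ε `0 `1              : Symbol 0
    `zero `one `lh `rh    : Symbol 1
    -- `▷ takes the arguments (y , x) of y ▷ x, and `◁ the arguments
    -- (x , y) of x ◁ y.
    `· `▷ `◁              : Symbol 2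
    `cond                 : Symbol 4
    lam                   : ∀ {n} → Term n → Symbol n
    ℓCRN rCRN             : ∀ {n} → Symbol (suc n) → Symbol (suc n)
    -- The arity of h is n + 4, arranged so that its last two arguments
    -- are the recursive values.
    TRN                   : ∀ {n} (g : Symbol (2 + n)) (h : Symbol (2 + (n + 2)))
                            (hℓ hr : Symbol 1) →
                            rank h ≡ 0 → rank hℓ ≡ 0 → rank hr ≡ 0 →
                            Symbol (2 + n)

  -- Term n: the terms with all variables among n given ones.
  data Term (n : ℕ) : Set where
    var   : Fin n → Term n
    _⟨_⟩  : ∀ {k} → Symbol k → Vec (Term n) k → Term n

  rank : ∀ {n} → Symbol n → ℕ
  rank `ε                     = 0
  rank `0                     = 0
  rank `1                     = 0
  rank `zero                  = 0
  rank `one                   = 0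
  rank `lh                    = 0
  rank `rh                    = 0
  rank `·                     = 0
  rank `▷                     = 0
  rank `◁                     = 0
  rank `cond                  = 0
  rank (lam t)                = rankᵗ t
  rank (ℓCRN h)               = rank h
  rank (rCRN h)               = rank h
  rank (TRN _ _ _ _ _ _ _)    = 1

  rankᵗ : ∀ {n} → Term n → ℕ
  rankᵗ (var _)    = 0
  rankᵗ (f ⟨ ts ⟩) = rank f ⊔ rankᵗˢ ts

  rankᵗˢ : ∀ {n k} → Vec (Term n) k → ℕ
  rankᵗˢ []       = 0
  rankᵗˢ (t ∷ ts) = rankᵗ t ⊔ rankᵗˢ ts

module _ {n : ℕ} where

  infixl 10 _·_
  infix   9 _▷_ _◁_

  ε 𝟎 𝟏 : Term n
  ε = `ε ⟨ [] ⟩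
  𝟎 = `0 ⟨ [] ⟩
  𝟏 = `1 ⟨ [] ⟩

  bit : Bool → Term n
  bit false = 𝟎
  bit true  = 𝟏

  zeros ones lh rh : Term n → Term n
  zeros x = `zero ⟨ x ∷ [] ⟩
  ones  x = `one ⟨ x ∷ [] ⟩
  lh    x = `lh ⟨ x ∷ [] ⟩
  rh    x = `rh ⟨ x ∷ [] ⟩

  _·_ _▷_ _◁_ : Term n → Term n → Term n
  x · y = `· ⟨ x ∷ y ∷ [] ⟩
  y ▷ x = `▷ ⟨ y ∷ x ∷ [] ⟩
  x ◁ y = `◁ ⟨ x ∷ y ∷ [] ⟩

  cond : Term n → Term n → Term n → Term n → Term n
  cond x y z₀ z₁ = `cond ⟨ x ∷ y ∷ z₀ ∷ z₁ ∷ [] ⟩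

  E : Term n → Term n → Term n → Term n
  E x y z = cond (lh x ▷ rh x) y z z

-- All variables of the context but the first k.
vars : ∀ k {n} → Vec (Term (k + n)) n
vars k = tabulate (λ j → var (k ↑ʳ j))

mutual

  substᵗ : ∀ {n k} → Term n → Vec (Term k) n → Term k
  substᵗ (var j)    σ = lookup σ j
  substᵗ (f ⟨ ts ⟩) σ = f ⟨ substᵗˢ ts σ ⟩

  substᵗˢ : ∀ {n k l} → Vec (Term n) l → Vec (Term k) n → Vec (Term k) l
  substᵗˢ []       σ = []
  substᵗˢ (t ∷ ts) σ = substᵗ t σ ∷ substᵗˢ ts σ

------------------------------------------------------------------------
-- Formulas of T₁

data Formula (n : ℕ) : Set where
  _≐_             : Term n → Term n → Formula n
  ¬_              : Formula n → Formula n
  _∧_ _∨_ _⇒_ _⇔_ : Formula n → Formula n → Formula n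

_≠_ : ∀ {n} → Term n → Term n → Formula n
t ≠ u = ¬ (t ≐ u)

-- Simultaneous substitution for all variables.
subst : ∀ {n k} → Formula n → Vec (Term k) n → Formula k
subst (t ≐ u) σ = substᵗ t σ ≐ substᵗ u σ
subst (¬ A)   σ = ¬ subst A σ
subst (A ∧ B) σ = subst A σ ∧ subst B σ
subst (A ∨ B) σ = subst A σ ∨ subst B σ
subst (A ⇒ B) σ = subst A σ ⇒ subst B σ
subst (A ⇔ B) σ = subst A σ ⇔ subst B σ

-- A [ t ] is A[t/x] for x the variable 0, and A [ t , s ]₂ is A[t/x,s/z]
-- for x, z the variables 0, 1; the other variables are kept.
_[_] : ∀ {n} → Formula (1 + n) → Term (1 + n) → Formula (1 + n)
A [ t ] = subst A (t ∷ vars 1)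

_[_,_]₂ : ∀ {n} → Formula (2 + n) → Term (2 + n) → Term (2 + n) → Formula (2 + n)
A [ t , s ]₂ = subst A (t ∷ s ∷ vars 2)

------------------------------------------------------------------------
-- Axioms and rules of T₁

-- Kleene's axioms; with modus ponens they are complete.
data PropAxiom {n : ℕ} : Formula n → Set where
  ⇒-K   : ∀ A B   → PropAxiom (A ⇒ B ⇒ A)
  ⇒-S   : ∀ A B C → PropAxiom ((A ⇒ B ⇒ C) ⇒ (A ⇒ B) ⇒ A ⇒ C)
  ∧-I   : ∀ A B   → PropAxiom (A ⇒ B ⇒ A ∧ B)
  ∧-E₁  : ∀ A B   → PropAxiom (A ∧ B ⇒ A)
  ∧-E₂  : ∀ A B   → PropAxiom (A ∧ B ⇒ B)
  ∨-I₁  : ∀ A B   → PropAxiom (A ⇒ A ∨ B)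
  ∨-I₂  : ∀ A B   → PropAxiom (B ⇒ A ∨ B)
  ∨-E   : ∀ A B C → PropAxiom ((A ⇒ C) ⇒ (B ⇒ C) ⇒ A ∨ B ⇒ C)
  ¬-I   : ∀ A B   → PropAxiom ((A ⇒ B) ⇒ (A ⇒ ¬ B) ⇒ ¬ A)
  ¬¬-E  : ∀ A     → PropAxiom (¬ ¬ A ⇒ A)
  ⇔-I   : ∀ A B   → PropAxiom ((A ⇒ B) ⇒ (B ⇒ A) ⇒ (A ⇔ B))
  ⇔-E₁  : ∀ A B   → PropAxiom ((A ⇔ B) ⇒ A ⇒ B)
  ⇔-E₂  : ∀ A B   → PropAxiom ((A ⇔ B) ⇒ B ⇒ A)

private
  x : ∀ {n} → Term (1 + n)
  x = var zero

  y : ∀ {n} → Term (2 + n)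
  y = var (suc zero)

  z : ∀ {n} → Term (3 + n)
  z = var (suc (suc zero))

  w : ∀ {n} → Term (4 + n)
  w = var (suc (suc (suc zero)))

data EqAxiom : ∀ {n} → Formula n → Set where
  ≐-refl  : EqAxiom {1} (x ≐ x)
  ≐-sym   : EqAxiom {2} (x ≐ y ⇒ y ≐ x)
  ≐-trans : EqAxiom {3} (x ≐ y ⇒ y ≐ z ⇒ x ≐ z)
  -- x₁ = y₁ → … → xₖ = yₖ → f(x₁,…,xₖ) = f(y₁,…,yₖ)
  ≐-cong  : ∀ {k} (f : Symbol k) →
            let xs = tabulate (λ j → var (j ↑ˡ k)) ; ys = vars k in
            EqAxiom {k + k} (Vec.foldr′ _⇒_ (f ⟨ xs ⟩ ≐ f ⟨ ys ⟩) (zipWith _≐_ xs ys))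

data StringAxiom : ∀ {n} → Formula n → Set where
  ε≠0      : StringAxiom {0} (ε ≠ 𝟎)
  0≠1      : StringAxiom {0} (𝟎 ≠ 𝟏)
  1≠ε      : StringAxiom {0} (𝟏 ≠ ε)

  ·-ε      : StringAxiom {1} (x · ε ≐ x)
  ·-bit    : ∀ i → StringAxiom {2} (x · (y · bit i) ≐ (x · y) · bit i)
  ·≐ε      : StringAxiom {2} (x · y ≐ ε ⇒ x ≐ ε ∧ y ≐ ε)
  ·≐bit    : ∀ i → StringAxiom {2}
               (x · y ≐ bit i ⇒ (x ≐ ε ∧ y ≐ bit i) ∨ (x ≐ bit i ∧ y ≐ ε))

  ε-▷      : StringAxiom {1} (ε ▷ x ≐ x)
  bit·-▷   : ∀ i → StringAxiom {2} ((bit i · y) ▷ x ≐ bit i ▷ (y ▷ x))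
  bit-▷-ε  : ∀ i → StringAxiom {0} (bit i ▷ ε ≐ ε)
  bit-▷    : ∀ i j → StringAxiom {1} (bit i ▷ (bit j · x) ≐ x)
  ▷≐ε      : ∀ i → StringAxiom {2} (y ▷ x ≐ ε ⇔ x ▷ (y · bit i) ≠ ε)

  ◁-ε      : StringAxiom {1} (x ◁ ε ≐ x)
  ◁-·bit   : ∀ i → StringAxiom {2} (x ◁ (y · bit i) ≐ (x ◁ y) ◁ bit i)
  ε-◁-bit  : ∀ i → StringAxiom {0} (ε ◁ bit i ≐ ε)
  ◁-bit    : ∀ i j → StringAxiom {1} ((x · bit j) ◁ bit i ≐ x)
  ◁≐ε      : ∀ i → StringAxiom {2} (x ◁ y ≐ ε ⇔ (bit i · y) ◁ x ≠ ε)

  zeros-ε  : StringAxiom {0} (zeros ε ≐ ε)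
  zeros-·  : ∀ i → StringAxiom {1} (zeros (x · bit i) ≐ zeros x · 𝟎)
  ones-ε   : StringAxiom {0} (ones ε ≐ ε)
  ones-·   : ∀ i → StringAxiom {1} (ones (x · bit i) ≐ ones x · 𝟏)

  cond-ε   : StringAxiom {3} (cond ε x y z ≐ x)
  cond-0   : StringAxiom {4} (cond (w · 𝟎) x y z ≐ zeros (z ◁ y) · y)
  cond-1   : StringAxiom {4} (cond (w · 𝟏) x y z ≐ zeros (y ◁ z) · z)

  lh·rh    : StringAxiom {1} (lh x · rh x ≐ x)
  lh◁rh    : StringAxiom {1} (lh x ◁ rh x ≐ ε)
  1▷lh▷rh  : StringAxiom {1} (𝟏 ▷ (lh x ▷ rh x) ≐ ε)
  lh-·bit  : ∀ i → StringAxiom {1}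
               (lh (x · bit i) ≐ E x (lh x) (lh x · ((rh x · bit i) ◁ rh x)))
  rh-·bit  : ∀ i → StringAxiom {1}
               (rh (x · bit i) ≐ E x (rh x · bit i) (𝟏 ▷ (rh x · bit i)))
  lh-bit·  : ∀ i → StringAxiom {1}
               (lh (bit i · x) ≐ E x ((bit i · lh x) ◁ 𝟏) (bit i · lh x))
  rh-bit·  : ∀ i → StringAxiom {1}
               (rh (bit i · x) ≐ E x ((lh x ▷ (bit i · lh x)) · rh x) (rh x))

data DefAxiom : ∀ {n} → Formula n → Set where
  lam-β     : ∀ {n} (t : Term n) → DefAxiom (lam t ⟨ vars 0 ⟩ ≐ t)
  ℓCRN-ε    : ∀ {n} (h : Symbol (suc n)) →
              DefAxiom (ℓCRN h ⟨ ε ∷ vars 0 ⟩ ≐ ε)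
  ℓCRN-bit· : ∀ {n} (h : Symbol (suc n)) i →
              let hix = h ⟨ (bit i · x) ∷ vars 1 ⟩ in
              DefAxiom (ℓCRN h ⟨ (bit i · x) ∷ vars 1 ⟩
                          ≐ ((hix · 𝟎) ◁ hix) · ℓCRN h ⟨ x ∷ vars 1 ⟩)
  rCRN-ε    : ∀ {n} (h : Symbol (suc n)) →
              DefAxiom (rCRN h ⟨ ε ∷ vars 0 ⟩ ≐ ε)
  rCRN-·bit : ∀ {n} (h : Symbol (suc n)) i →
              let hxi = h ⟨ (x · bit i) ∷ vars 1 ⟩ in
              DefAxiom (rCRN h ⟨ (x · bit i) ∷ vars 1 ⟩
                          ≐ rCRN h ⟨ x ∷ vars 1 ⟩ · (hxi ▷ (𝟎 · hxi)))
  -- Here z is the variable 1.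
  TRN-def   : ∀ {n} (g : Symbol (2 + n)) (h : Symbol (2 + (n + 2))) (hℓ hr : Symbol 1)
              (e : rank h ≡ 0) (eℓ : rank hℓ ≡ 0) (er : rank hr ≡ 0) →
              let f  = TRN g h hℓ hr e eℓ er
                  z  = var (suc zero)
                  fℓ = f ⟨ lh x ∷ hℓ ⟨ z ∷ [] ⟩ ∷ vars 2 ⟩
                  fr = f ⟨ rh x ∷ hr ⟨ z ∷ [] ⟩ ∷ vars 2 ⟩
                  t  = h ⟨ x ∷ z ∷ vars 2 ++ fℓ ∷ fr ∷ [] ⟩
              in DefAxiom (f ⟨ x ∷ z ∷ vars 2 ⟩ ≐ cond (x ◁ 𝟏) (g ⟨ x ∷ z ∷ vars 2 ⟩) t t)

infix 2 T₁⊢_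

data T₁⊢_ : ∀ {n} → Formula n → Set where
  prop   : ∀ {n} {A : Formula n} → PropAxiom A → T₁⊢ A
  eq     : ∀ {n} {A : Formula n} → EqAxiom A → T₁⊢ A
  string : ∀ {n} {A : Formula n} → StringAxiom A → T₁⊢ A
  def    : ∀ {n} {A : Formula n} → DefAxiom A → T₁⊢ A
  mp     : ∀ {n} {A B : Formula n} → T₁⊢ A ⇒ B → T₁⊢ A → T₁⊢ B
  -- Iterated A ⊢ A[t/x]; it also adds, drops and permutes variables, so that
  -- the induction rules may be stated for the variables 0 and 1 only.
  sub    : ∀ {n k} {A : Formula n} (σ : Vec (Term k) n) → T₁⊢ A → T₁⊢ subst A σ
  NINDℓ  : ∀ {n} (A : Formula (1 + n)) →
           T₁⊢ A [ ε ] → T₁⊢ A ⇒ A [ 𝟎 · x ] → T₁⊢ A ⇒ A [ 𝟏 · x ] → T₁⊢ A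
  NINDr  : ∀ {n} (A : Formula (1 + n)) →
           T₁⊢ A [ ε ] → T₁⊢ A ⇒ A [ x · 𝟎 ] → T₁⊢ A ⇒ A [ x · 𝟏 ] → T₁⊢ A
  TIND   : ∀ {n} (A : Formula (2 + n)) (hℓ hr : Symbol 1) → rank hℓ ≡ 0 → rank hr ≡ 0 →
           let z = var (suc zero) in
           T₁⊢ A [ ε , z ]₂ → T₁⊢ A [ 𝟎 , z ]₂ → T₁⊢ A [ 𝟏 , z ]₂ →
           T₁⊢ A [ lh x , hℓ ⟨ z ∷ [] ⟩ ]₂ ∧ A [ rh x , hr ⟨ z ∷ [] ⟩ ]₂ ⇒ A →
           T₁⊢ A

------------------------------------------------------------------------
-- Propositional formulas

data Form (V : Set) : Set where
  atom            : V → Form V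
  ⊤ ⊥             : Form V
  ¬_              : Form V → Form V
  _∧_ _∨_ _⇒_ _⇔_ : Form V → Form V → Form V

module _ {V W : Set} (σ : V → Form W) where

  subᵖ : Form V → Form W
  subᵖ (atom a) = σ a
  subᵖ ⊤        = ⊤
  subᵖ ⊥        = ⊥
  subᵖ (¬ A)    = ¬ subᵖ A
  subᵖ (A ∧ B)  = subᵖ A ∧ subᵖ B
  subᵖ (A ∨ B)  = subᵖ A ∨ subᵖ B
  subᵖ (A ⇒ B)  = subᵖ A ⇒ subᵖ B
  subᵖ (A ⇔ B)  = subᵖ A ⇔ subᵖ B

⋀ : ∀ {V} → List (Form V) → Form V
⋀ = List.foldr _∧_ ⊤

evalᵖ : ∀ {V} → (V → Bool) → Form V → Bool
evalᵖ v (atom a) = v a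
evalᵖ v ⊤        = true
evalᵖ v ⊥        = false
evalᵖ v (¬ A)    = not (evalᵖ v A)
evalᵖ v (A ∧ B)  = evalᵖ v A Bool.∧ evalᵖ v B
evalᵖ v (A ∨ B)  = evalᵖ v A Bool.∨ evalᵖ v B
evalᵖ v (A ⇒ B)  = not (evalᵖ v A) Bool.∨ evalᵖ v B
evalᵖ v (A ⇔ B)  = not (evalᵖ v A xor evalᵖ v B)

_⊨_ : ∀ {V} → List (Form V) → Form V → Set
Γ ⊨ A = ∀ v → All (λ B → evalᵖ v B ≡ true) Γ → evalᵖ v A ≡ true

-- Number of symbols, an atom counting as one symbol.
size : ∀ {V} → Form V → ℕ
size (atom _) = 1
size ⊤        = 1
size ⊥        = 1
size (¬ A)    = suc (size A)
size (A ∧ B)  = suc (size A + size B)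
size (A ∨ B)  = suc (size A + size B)
size (A ⇒ B)  = suc (size A + size B)
size (A ⇔ B)  = suc (size A + size B)

------------------------------------------------------------------------
-- Frege systems

record Rule : Set where
  constructor _/_
  field
    premises   : List (Form ℕ)
    conclusion : Form ℕ

open Rule

module _ (rules : List Rule) {V : Set} (Γ : List (Form V)) where

  -- Indexed by the lines, the last one first.
  data Derivation : List (Form V) → Set where
    []    : Derivation []
    hyp   : ∀ {A ls} → A ∈ Γ → Derivation ls → Derivation (A ∷ ls)
    infer : ∀ {r ls} → r ∈ rules → (σ : ℕ → Form V) →
            All (λ B → subᵖ σ B ∈ ls) (premises r) →
            Derivation ls → Derivation (subᵖ σ (conclusion r) ∷ ls)

  Derives : Form V → Set
  Derives A = Σ (List (Form V)) λ ls → Derivation (A ∷ ls)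

record FregeSystem : Set where
  field
    rules    : List Rule
    sound    : ∀ {r} → r ∈ rules → premises r ⊨ conclusion r
    complete : ∀ (Γ : List (Form ℕ)) (A : Form ℕ) → Γ ⊨ A → Derives rules Γ A

open FregeSystem

FregeProof : FregeSystem → ∀ {V} → Form V → Set
FregeProof 𝓕 A = Derives (rules 𝓕) [] A

proofSize : ∀ {𝓕 V} {A : Form V} → FregeProof 𝓕 A → ℕ
proofSize {A = A} (ls , _) = sum (List.map size (A ∷ ls))

------------------------------------------------------------------------
-- Length functions

-- The length of f(x,z,ȳ) for f = TRN[g,h,hℓ,hr], given the length functions
-- of g, h, hℓ, hr; m = |x|, p = |z|, ns = |ȳ|.
lenTRN : ∀ {n} (g : Vec ℕ (2 + n) → ℕ) (h : Vec ℕ (2 + (n + 2)) → ℕ) (hℓ hr : Vec ℕ 1 → ℕ) →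
         (m p : ℕ) (ns : Vec ℕ n) → Acc _<_ m → ℕ
lenTRN g h hℓ hr 0 p ns _ = g (0 ∷ p ∷ ns)
lenTRN g h hℓ hr 1 p ns _ = g (1 ∷ p ∷ ns)
lenTRN g h hℓ hr m@(suc (suc k)) p ns (acc rs) =
  h (m ∷ p ∷ ns ++ lenTRN g h hℓ hr ⌊ m /2⌋ (hℓ (p ∷ [])) ns (rs (⌊n/2⌋<n (suc k)))
                 ∷ lenTRN g h hℓ hr ⌈ m /2⌉ (hr (p ∷ [])) ns (rs (⌈n/2⌉<n k))
                 ∷ [])

mutual

  lenˢ : ∀ {k} → Symbol k → Vec ℕ k → ℕ
  lenˢ `ε    []                    = 0
  lenˢ `0    []                    = 1
  lenˢ `1    []                    = 1
  lenˢ `zero (m ∷ [])              = m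
  lenˢ `one  (m ∷ [])              = m
  lenˢ `lh   (m ∷ [])              = ⌊ m /2⌋
  lenˢ `rh   (m ∷ [])              = ⌈ m /2⌉
  lenˢ `·    (m ∷ n ∷ [])          = m + n
  lenˢ `▷    (n ∷ m ∷ [])          = m ∸ n
  lenˢ `◁    (m ∷ n ∷ [])          = m ∸ n
  lenˢ `cond (0 ∷ n ∷ p₀ ∷ p₁ ∷ [])     = n
  lenˢ `cond (suc _ ∷ n ∷ p₀ ∷ p₁ ∷ []) = p₀ ⊔ p₁
  lenˢ (lam t)  ms                 = lenᵗ t ms
  lenˢ (ℓCRN h) (m ∷ ns)           = m
  lenˢ (rCRN h) (m ∷ ns)           = m
  lenˢ (TRN g h hℓ hr _ _ _) (m ∷ p ∷ ns) =
    lenTRN (lenˢ g) (lenˢ h) (lenˢ hℓ) (lenˢ hr) m p ns (<-wellFounded m)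

  lenᵗ : ∀ {n} → Term n → Vec ℕ n → ℕ
  lenᵗ (var j)    ms = lookup ms j
  lenᵗ (f ⟨ ts ⟩) ms = lenˢ f (lenᵗˢ ts ms)

  lenᵗˢ : ∀ {n k} → Vec (Term n) k → Vec ℕ n → Vec ℕ k
  lenᵗˢ []       ms = []
  lenᵗˢ (t ∷ ts) ms = lenᵗ t ms ∷ lenᵗˢ ts ms

------------------------------------------------------------------------
-- Term formulas

-- (j , i) is the atom ⟨xⱼ⟩ᵢ, with i counted from 1.
Atom : ℕ → Set
Atom n = Fin n × ℕ

-- The formulas ⟨t⟩₁, ⟨t⟩₂, … of a string t. Only those up to the length of t
-- are meaningful; the others are arbitrary and do not occur in translations.
Bits : Set → Set
Bits V = ℕ → Form V

varBits : ∀ {n} → Fin n → Bits (Atom n)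
varBits j i = atom (j , i)

-- All variables but the first k.
varsBits : ∀ k {n} → Vec (Bits (Atom (k + n))) n
varsBits k = tabulate (λ j → varBits (k ↑ʳ j))

_[_]ᵖ : ∀ {k V} → Form (Atom k) → Vec (Bits V) k → Form V
A [ bs ]ᵖ = subᵖ (λ (j , i) → lookup bs j i) A

-- The bits of x · y, for |x| = m.
catBits : ∀ {V} → (m : ℕ) → Bits V → Bits V → Bits V
catBits m b c i = if i ≤ᵇ m then b i else c (i ∸ m)

⊥s : ∀ {V} → Bits V
⊥s _ = ⊥

-- The bits of f(x,z,ȳ) for f = TRN[g,h,hℓ,hr], given the length functions of
-- hℓ, hr, f and the bits of g, h, hℓ, hr.
module _ {n : ℕ} (lenhℓ lenhr : Vec ℕ 1 → ℕ) (lenf : Vec ℕ (2 + n) → ℕ)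
         (g : Vec ℕ (2 + n) → Bits (Atom (2 + n)))
         (h : Vec ℕ (2 + (n + 2)) → Bits (Atom (2 + (n + 2))))
         (hℓ hr : Vec ℕ 1 → Bits (Atom 1))
         where

  bitsTRN : (m p : ℕ) (ns : Vec ℕ n) → Acc _<_ m → Bits (Atom (2 + n))
  bitsTRN 0 p ns _ i = g (0 ∷ p ∷ ns) i
  bitsTRN 1 p ns _ i = g (1 ∷ p ∷ ns) i
  bitsTRN m@(suc (suc k)) p ns (acc rs) i =
    h (m ∷ p ∷ ns ++ lenf (mℓ ∷ pℓ ∷ ns) ∷ lenf (mr ∷ pr ∷ ns) ∷ []) i
      [ bx ∷ bz ∷ varsBits 2 ++ fℓ ∷ fr ∷ [] ]ᵖ
    where
    mℓ = ⌊ m /2⌋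
    mr = ⌈ m /2⌉
    pℓ = lenhℓ (p ∷ [])
    pr = lenhr (p ∷ [])
    bx bz fℓ fr : Bits (Atom (2 + n))
    bx = varBits zero
    bz = varBits (suc zero)
    fℓ i′ = bitsTRN mℓ pℓ ns (rs (⌊n/2⌋<n (suc k))) i′
              [ bx ∷ (λ j → hℓ (p ∷ []) j [ bz ∷ [] ]ᵖ) ∷ varsBits 2 ]ᵖ
    fr i′ = bitsTRN mr pr ns (rs (⌈n/2⌉<n k)) i′
              [ (λ j → bx (j + mℓ)) ∷ (λ j → hr (p ∷ []) j [ bz ∷ [] ]ᵖ) ∷ varsBits 2 ]ᵖ

mutual

  -- bitˢ f ms i is ⟨f(x₁,…,xₖ)⟩ᵢ for |xⱼ| = mⱼ.
  bitˢ : ∀ {k} → Symbol k → Vec ℕ k → Bits (Atom k)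
  bitˢ `ε    _ i = ⊥
  bitˢ `0    _ i = ⊥
  bitˢ `1    _ i = ⊤
  bitˢ `zero _ i = ⊥
  bitˢ `one  _ i = ⊤
  bitˢ `lh   _ i = varBits zero i
  bitˢ `rh   (m ∷ []) i = varBits zero (i + ⌊ m /2⌋)
  bitˢ `·    (m ∷ _ ∷ []) i = catBits m (varBits zero) (varBits (suc zero)) i
  bitˢ `▷    (n ∷ _ ∷ []) i = varBits (suc zero) (i + n)
  bitˢ `◁    _ i = varBits zero i
  bitˢ `cond (0 ∷ _) i = varBits (suc zero) i
  bitˢ `cond (m@(suc _) ∷ _ ∷ p₀ ∷ p₁ ∷ []) i =
    (¬ bx m ∧ catBits (p₁ ∸ p₀) ⊥s bz₀ i) ∨ (bx m ∧ catBits (p₀ ∸ p₁) ⊥s bz₁ i)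
    where
    bx bz₀ bz₁ : Bits (Atom 4)
    bx  = varBits zero
    bz₀ = varBits (suc (suc zero))
    bz₁ = varBits (suc (suc (suc zero)))
  bitˢ (lam t)  ms i = bitᵗ t ms i
  bitˢ (ℓCRN h) (m ∷ ns) i =
    catBits (lenˢ h ms′) (bitˢ h ms′) ⊥s 1
      [ (λ j → varBits zero (j + i ∸ 1)) ∷ varsBits 1 ]ᵖ
    where ms′ = (m ∸ i + 1) ∷ ns
  -- The substitution of ⟨x⟩ⱼ for ⟨z⟩ⱼ is the identity.
  bitˢ (rCRN h) (m ∷ ns) i = catBits 1 ⊥s (bitˢ h (i ∷ ns)) (1 + lenˢ h (i ∷ ns))
  bitˢ f@(TRN g h hℓ hr _ _ _) (m ∷ p ∷ ns) i =
    bitsTRN (lenˢ hℓ) (lenˢ hr) (lenˢ f) (bitˢ g) (bitˢ h) (bitˢ hℓ) (bitˢ hr)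
            m p ns (<-wellFounded m) i

  bitᵗ : ∀ {n} → Term n → Vec ℕ n → Bits (Atom n)
  bitᵗ (var j)    ms i = varBits j i
  bitᵗ (f ⟨ ts ⟩) ms i = bitˢ f (lenᵗˢ ts ms) i [ bitᵗˢ ts ms ]ᵖ

  bitᵗˢ : ∀ {n k} → Vec (Term n) k → Vec ℕ n → Vec (Bits (Atom n)) k
  bitᵗˢ []       ms = []
  bitᵗˢ (t ∷ ts) ms = bitᵗ t ms ∷ bitᵗˢ ts ms

------------------------------------------------------------------------
-- Translations

⟦_⟧ : ∀ {n} → Formula n → Vec ℕ n → Form (Atom n)
⟦ t ≐ u ⟧ ms =
  if does (lenᵗ t ms ≟ lenᵗ u ms)
  then ⋀ (List.applyUpTo (λ i → bitᵗ t ms (suc i) ⇔ bitᵗ u ms (suc i)) (lenᵗ t ms))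
  else ⊥
⟦ ¬ A ⟧   ms = ¬ ⟦ A ⟧ ms
⟦ A ∧ B ⟧ ms = ⟦ A ⟧ ms ∧ ⟦ B ⟧ ms
⟦ A ∨ B ⟧ ms = ⟦ A ⟧ ms ∨ ⟦ B ⟧ ms
⟦ A ⇒ B ⟧ ms = ⟦ A ⟧ ms ⇒ ⟦ B ⟧ ms
⟦ A ⇔ B ⟧ ms = ⟦ A ⟧ ms ⇔ ⟦ B ⟧ ms

------------------------------------------------------------------------
-- Polynomials in n variables with coefficients in ℕ

data Poly (n : ℕ) : Set where
  con     : ℕ → Poly n
  var     : Fin n → Poly n
  _⊕_ _⊗_ : Poly n → Poly n → Poly n

evalPoly : ∀ {n} → Poly n → Vec ℕ n → ℕ
evalPoly (con c) ms = c
evalPoly (var j) ms = lookup ms j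
evalPoly (p ⊕ q) ms = evalPoly p ms + evalPoly q ms
evalPoly (p ⊗ q) ms = evalPoly p ms * evalPoly q ms

{-# OPTIONS --safe #-}
-- The translations are proved by recursion on the T₁-proof in an auxiliary
-- calculus of finitely many schematic rules, each of which the given Frege
-- system derives by completeness; only the number of inferences and the
-- largest formula have to be counted.
--
-- Every bit of a symbol of rank 0 is a formula of bounded size, whatever the
-- lengths of the arguments, and the length of its value is linear. Hence each
-- level of the recursion of TRN, or of a tree induction, costs only a constant
-- factor, and as there are logarithmically many levels everything stays
-- polynomial. The defining equations and the string axioms hold bitwise, even
-- syntactically except for the simplification of conditionals. An induction on
-- notation is unwound into its instances, where the two cases of the new bit
-- are combined by substituting ⊥ and ⊤ for its atom.

module Submission where

open import Defs
open import Data.Nat using (ℕ; _≤_)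
open import Data.Product using (Σ-syntax)
open import Data.Vec using (Vec)

open import Data.Bool.Base as Bool using (Bool; true; false; not; T; if_then_else_)
open import Data.Bool.Properties using (T-∧; T-≡; if-float)
open import Data.Fin using (Fin; zero; suc; toℕ; #_; _↑ˡ_; _↑ʳ_)
open import Data.List.Base as List using (List; []; _∷_; applyUpTo)
open import Data.List.Membership.Propositional using (_∈_)
open import Data.List.Membership.Propositional.Properties using (∈-map⁺; ∈-map⁻)
open import Data.List.Properties using (map-cong-local; map-∘)
open import Data.List.Relation.Unary.All as All using (All; []; _∷_)
import Data.List.Relation.Unary.All.Properties as Allₚ
open import Data.List.Relation.Unary.Any using (here; there)
open import Data.Nat
open import Data.Nat.Induction using (Acc; acc; <-wellFounded)
open import Data.Nat.ListAction using (sum)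
open import Data.Nat.Properties
open import Data.Nat.Tactic.RingSolver using (solve-∀)
open import Data.Product.Base using (_×_; _,_; proj₁; proj₂)
open import Data.Sum.Base using (_⊎_; inj₁; inj₂)
open import Data.Vec.Base as Vec using ([]; _∷_; _++_; lookup; tabulate; zipWith)
open import Data.Vec.Properties
  using (lookup∘tabulate; lookup-map; lookup-zipWith; sum-++; tabulate-∘; tabulate-cong; tabulate∘lookup)
open import Data.Vec.Relation.Binary.Pointwise.Inductive as Pointwise using (Pointwise; []; _∷_; ++⁺)
open import Data.Vec.Relation.Unary.All as VecAll using ([]; _∷_)
import Data.Vec.Relation.Unary.All.Properties as VecAllₚ
open import Function.Base using (_∘_; id)
open import Function.Bundles using (module Equivalence)
open import Induction.WellFounded using (acc-inverse)
open import Relation.Binary.PropositionalEquality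
  using (_≡_; _≢_; refl; sym; trans; cong; cong₂; module ≡-Reasoning)
import Relation.Binary.PropositionalEquality as ≡
open import Relation.Nullary.Decidable using (does; yes; no)
open import Relation.Nullary.Negation using (contradiction)

open Equivalence using (to)

-- The obstacle is substitution into proofs: it keeps the number of inferences but multiplies the
-- size of every formula by that of the substituted ones. A constant factor per level is harmless
-- for `TIND`, whose depth is logarithmic, but would be fatal for induction on notation, whose depth
-- is |x|. There the proof of the previous instance is therefore only renamed, atom for atom. As
-- proofs are counted as trees, the previous instance must moreover enter just once, so a single
-- rule draws both cases of the new bit from it. Bits outside the length of a string are arbitrary,
-- and in general neither sizes nor identities are under control there. Hence substitutions are
-- constrained only at atoms that occur, and term formulas are shown to mention only atoms in range.

private variable
  c k l m n M : ℕ
  U V W : Set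

-- Polynomially bounded functions

-- The `2 +` makes the base at least 2 even for empty strings, so that constants and constant
-- factors are absorbed by raising the exponent.
N : Vec ℕ n → ℕ
N ms = 2 + Vec.sum ms

-- A bare exponent without coefficients: closure under sums, products and composition becomes
-- arithmetic of exponents. The conversion to a `Poly` happens once, at the end.
PolyBounded : (Vec ℕ n → ℕ) → Set
PolyBounded f = Σ[ d ∈ ℕ ] ∀ ms → f ms ≤ N ms ^ d

1≤N^ : ∀ (ms : Vec ℕ n) d → 1 ≤ N ms ^ d
1≤N^ ms d = m^n>0 (N ms) d

n≤2^n : ∀ n → n ≤ 2 ^ n
n≤2^n zero    = z≤n
n≤2^n (suc n) = ≤-trans (+-mono-≤ (m^n>0 2 n) (n≤2^n n)) (+-monoʳ-≤ (2 ^ n) (m≤m+n _ 0))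

≤-base^ : ∀ {b} → 2 ≤ b → ∀ n → n ≤ b ^ n
≤-base^ 2≤b n = ≤-trans (n≤2^n n) (^-monoˡ-≤ n 2≤b)

-- The exponent `d + e` serves both summands, and one further factor `b ≥ 2` pays for there being
-- two of them.
+-≤-base^ : ∀ {b x y d e} → 2 ≤ b → x ≤ b ^ d → y ≤ b ^ e → x + y ≤ b ^ suc (d + e)
+-≤-base^ {b@(suc _)} {x} {y} {d} {e} 2≤b x≤ y≤ = begin
  x + y                      ≤⟨ +-mono-≤ (≤-trans x≤ (^-monoʳ-≤ b (m≤m+n d e)))
                                         (≤-trans y≤ (^-monoʳ-≤ b (m≤n+m e d))) ⟩
  b ^ (d + e) + b ^ (d + e)  ≡⟨ cong (b ^ (d + e) +_) (+-identityʳ _) ⟨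
  2 * b ^ (d + e)            ≤⟨ *-monoˡ-≤ (b ^ (d + e)) 2≤b ⟩
  b ^ suc (d + e)            ∎
  where open ≤-Reasoning

2≤N : (ms : Vec ℕ n) → 2 ≤ N ms
2≤N ms = s≤s (s≤s z≤n)

mono-PB : {f g : Vec ℕ n → ℕ} → (∀ ms → f ms ≤ g ms) → PolyBounded g → PolyBounded f
mono-PB f≤g (d , g≤) = d , λ ms → ≤-trans (f≤g ms) (g≤ ms)

const-PB : ∀ c → PolyBounded {n} (λ _ → c)
const-PB c = c , λ ms → ≤-base^ (2≤N ms) c

infixl 6 _+-PB_
infixl 7 _*-PB_

_+-PB_ : {f g : Vec ℕ n → ℕ} → PolyBounded f → PolyBounded g → PolyBounded (λ ms → f ms + g ms)
(d , f≤) +-PB (e , g≤) = suc (d + e) , λ ms → +-≤-base^ {d = d} {e} (2≤N ms) (f≤ ms) (g≤ ms)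

_*-PB_ : {f g : Vec ℕ n → ℕ} → PolyBounded f → PolyBounded g → PolyBounded (λ ms → f ms * g ms)
(d , f≤) *-PB (e , g≤) = d + e , λ ms →
  ≤-trans (*-mono-≤ (f≤ ms) (g≤ ms)) (≤-reflexive (sym (^-distribˡ-+-* (N ms) d e)))

^-PB : {f : Vec ℕ n → ℕ} → ∀ e → PolyBounded f → PolyBounded (λ ms → f ms ^ e)
^-PB zero    pf = const-PB 1
^-PB (suc e) pf = pf *-PB ^-PB e pf

sum-PB : PolyBounded {n} Vec.sum
sum-PB = 1 , λ ms → ≤-trans (m≤n+m _ 2) (≤-reflexive (sym (*-identityʳ (N ms))))

lookup≤sum : ∀ (ms : Vec ℕ n) j → lookup ms j ≤ Vec.sum ms
lookup≤sum (m ∷ ms) zero    = m≤m+n m _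
lookup≤sum (m ∷ ms) (suc j) = ≤-trans (lookup≤sum ms j) (m≤n+m _ m)

lookup-PB : ∀ j → PolyBounded {n} (λ ms → lookup ms j)
lookup-PB j = mono-PB (λ ms → lookup≤sum ms j) sum-PB

-- `N` depends on its argument only through the sum, so a bound on the sum of the components of `g`
-- controls the composite.
∘-PB : {f : Vec ℕ k → ℕ} {g : Vec ℕ n → Vec ℕ k} →
       PolyBounded f → PolyBounded (Vec.sum ∘ g) → PolyBounded (f ∘ g)
∘-PB {g = g} (d , f≤) pg = mono-PB (λ ms → f≤ (g ms)) (^-PB d (const-PB 2 +-PB pg))

N-mono : ∀ {m m′} (ns : Vec ℕ n) → m ≤ m′ → N (m ∷ ns) ≤ N (m′ ∷ ns)
N-mono ns m≤m′ = s≤s (s≤s (+-monoˡ-≤ (Vec.sum ns) m≤m′))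

-- Recursion on ⌊m/2⌋ and ⌈m/2⌉

-- A function with 2 g(⌈m/2⌉) ≤ g(m), which makes g(m)ˣ absorb a factor 2ˣ at
-- each step of the recursion.
halving : ℕ → ℕ
halving m = 1 ⊔ 2 * (m ∸ 1)

halving-step : ∀ k → 2 * halving ⌈ 2 + k /2⌉ ≤ halving (2 + k)
halving-step k = begin
  2 * (1 ⊔ 2 * ⌈ k /2⌉)       ≡⟨ *-distribˡ-⊔ 2 1 (2 * ⌈ k /2⌉) ⟩
  2 ⊔ 2 * (2 * ⌈ k /2⌉)       ≤⟨ ⊔-lub (*-monoʳ-≤ 2 (s≤s z≤n)) (*-monoʳ-≤ 2 2⌈k/2⌉≤1+k) ⟩
  2 * suc k                   ≤⟨ m≤n⊔m 1 (2 * suc k) ⟩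
  halving (2 + k)             ∎
  where
  open ≤-Reasoning
  2⌈k/2⌉≤1+k : 2 * ⌈ k /2⌉ ≤ suc k
  2⌈k/2⌉≤1+k = begin
    ⌈ k /2⌉ + (⌈ k /2⌉ + 0)   ≡⟨ cong (⌈ k /2⌉ +_) (+-identityʳ _) ⟩
    ⌊ suc k /2⌋ + ⌊ suc k /2⌋ ≤⟨ +-monoʳ-≤ ⌊ suc k /2⌋ (⌊n/2⌋≤⌈n/2⌉ (suc k)) ⟩
    ⌊ suc k /2⌋ + ⌈ suc k /2⌉ ≡⟨ ⌊n/2⌋+⌈n/2⌉≡n (suc k) ⟩
    suc k                     ∎

halving-mono : ∀ {m n} → m ≤ n → halving m ≤ halving n
halving-mono m≤n = ⊔-monoʳ-≤ 1 (*-monoʳ-≤ 2 (∸-monoˡ-≤ 1 m≤n))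

1≤halving : ∀ m → 1 ≤ halving m
1≤halving m = m≤m⊔n 1 (2 * (m ∸ 1))

^-distribʳ-* : ∀ a b e → (a * b) ^ e ≡ a ^ e * b ^ e
^-distribʳ-* a b zero    = refl
^-distribʳ-* a b (suc e) = trans (cong (a * b *_) (^-distribʳ-* a b e)) (interchange a b (a ^ e) (b ^ e))
  where
  interchange : ∀ a b u v → a * b * (u * v) ≡ a * u * (b * v)
  interchange = solve-∀

-- The recursion common to the lengths of `TRN`, the bits of `TRN` and `TIND`. `Q m p b` says that
-- `b` is a bound at |x| = `m` and |z| = `p`, and `q` is the sum of the other lengths. `c` limits
-- the growth of z under `hℓ` and `hr`, `C` is the cost factor of a level, and `e` the degree of the
-- cost outside the recursive calls. The exponent `d` is fixed before `q`, `Q`, `hℓ` and `hr`, hence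
-- uniform in them.
HalvingInduction : (c C e d : ℕ) → Set₁
HalvingInduction c C e d =
  ∀ (q : ℕ) (Q : ℕ → ℕ → ℕ → Set) (hℓ hr : ℕ → ℕ) →
  (∀ {m p b b′} → b ≤ b′ → Q m p b → Q m p b′) →
  (∀ p → hℓ p ≤ c * suc p) → (∀ p → hr p ≤ c * suc p) →
  (∀ m p → m ≤ 1 → Q m p ((2 + (m + (p + q))) ^ e)) →
  (∀ k p b₁ b₂ → let m = 2 + k in Q ⌊ m /2⌋ (hℓ p) b₁ → Q ⌈ m /2⌉ (hr p) b₂ →
                 Q m p ((2 + (m + (p + q))) ^ e + C * (b₁ + b₂))) →
  ∀ m p → Q m p ((2 + (m + (p + q))) ^ d)

-- The invariant bound is `halving m ^ X * s m p ^ e`. When m is halved, the second factor grows at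
-- most by `suc c ^ e`, since z may grow; two calls weighted by `C` give `2 * C * suc c ^ e`, and
-- the local cost adds 1, which makes `X` in total. The first factor gains `2 ^ X ≥ X`.
halvingInduction : ∀ c C e → Σ[ d ∈ ℕ ] HalvingInduction c C e d
halvingInduction c C e = X + X + e , proof
  where
  X = 1 + 2 * C * suc c ^ e
  proof : HalvingInduction c C e (X + X + e)
  proof q Q hℓ hr mono hℓ≤ hr≤ base step m p = mono final (go m p (<-wellFounded m))
    where
    open ≤-Reasoning
    s : ℕ → ℕ → ℕ
    s m p = 2 + (m + (p + q))
    B : ℕ → ℕ → ℕ
    B m p = halving m ^ X * s m p ^ e

    s-step : ∀ {m m′ p p′} → m′ ≤ m → p′ ≤ c * suc p → s m′ p′ ≤ suc c * s m p
    s-step {m} {m′} {p} {p′} m′≤m p′≤ = begin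
      2 + (m′ + (p′ + q))                         ≤⟨ +-monoʳ-≤ 2 (+-mono-≤ m′≤m (+-monoˡ-≤ q p′≤)) ⟩
      2 + (m + (c * suc p + q))                   ≤⟨ m≤m+n _ (p + c * (1 + m + q)) ⟩
      2 + (m + (c * suc p + q)) + (p + c * (1 + m + q)) ≡⟨ lemma c m p q ⟩
      suc c * s m p                               ∎
      where
      lemma : ∀ c m p q → 2 + (m + (c * suc p + q)) + (p + c * (1 + m + q)) ≡ suc c * (2 + (m + (p + q)))
      lemma = solve-∀

    B-step : ∀ k {m′ p p′} → m′ ≤ ⌈ 2 + k /2⌉ → p′ ≤ c * suc p →
             B m′ p′ ≤ halving ⌈ 2 + k /2⌉ ^ X * (suc c ^ e * s (2 + k) p ^ e)
    B-step k {m′} {p} {p′} m′≤ p′≤ = *-mono-≤ (^-monoˡ-≤ X (halving-mono m′≤))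
      (≤-trans (^-monoˡ-≤ e (s-step (≤-trans m′≤ (⌈n/2⌉≤n (2 + k))) p′≤))
               (≤-reflexive (^-distribʳ-* (suc c) (s (2 + k) p) e)))

    bound : ∀ k p → s (2 + k) p ^ e + C * (B ⌊ 2 + k /2⌋ (hℓ p) + B ⌈ 2 + k /2⌉ (hr p)) ≤ B (2 + k) p
    bound k p = begin
      σ + C * (B ⌊ 2 + k /2⌋ (hℓ p) + B ⌈ 2 + k /2⌉ (hr p))
        ≤⟨ +-mono-≤ (≤-trans (≤-reflexive (sym (*-identityˡ σ))) (*-monoˡ-≤ σ 1≤u))
                    (*-monoʳ-≤ C (+-mono-≤ (B-step k (⌊n/2⌋≤⌈n/2⌉ (2 + k)) (hℓ≤ p))
                      (B-step k ≤-refl (hr≤ p)))) ⟩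
      u * σ + C * (u * (suc c ^ e * σ) + u * (suc c ^ e * σ))
        ≡⟨ lemma u σ C (suc c ^ e) ⟩
      X * u * σ
        ≤⟨ *-monoˡ-≤ σ (*-monoˡ-≤ u (n≤2^n X)) ⟩
      2 ^ X * u * σ
        ≡⟨ cong (_* σ) (^-distribʳ-* 2 (halving ⌈ 2 + k /2⌉) X) ⟨
      (2 * halving ⌈ 2 + k /2⌉) ^ X * σ
        ≤⟨ *-monoˡ-≤ σ (^-monoˡ-≤ X (halving-step k)) ⟩
      B (2 + k) p ∎
      where
      σ = s (2 + k) p ^ e
      u = halving ⌈ 2 + k /2⌉ ^ X
      1≤u : 1 ≤ u
      1≤u = ≤-trans (≤-reflexive (sym (^-zeroˡ X))) (^-monoˡ-≤ X (1≤halving ⌈ 2 + k /2⌉))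
      lemma : ∀ u σ C w → u * σ + C * (u * (w * σ) + u * (w * σ)) ≡ (1 + 2 * C * w) * u * σ
      lemma = solve-∀

    base≤ : ∀ m p → s m p ^ e ≤ B m p
    base≤ m p = ≤-trans (≤-reflexive (sym (*-identityˡ _)))
      (*-monoˡ-≤ (s m p ^ e) (≤-trans (≤-reflexive (sym (^-zeroˡ X))) (^-monoˡ-≤ X (1≤halving m))))

    go : ∀ m p → Acc _<_ m → Q m p (B m p)
    go 0 p _ = mono (base≤ 0 p) (base 0 p z≤n)
    go 1 p _ = mono (base≤ 1 p) (base 1 p (s≤s z≤n))
    go (suc (suc k)) p (acc rs) = mono (bound k p)
      (step k p _ _ (go ⌊ 2 + k /2⌋ (hℓ p) (rs (⌊n/2⌋<n (suc k))))
                    (go ⌈ 2 + k /2⌉ (hr p) (rs (⌈n/2⌉<n k))))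

    -- Turns the invariant into a pure power of `s m p`, with exponent 2 for each of the `X`
    -- factors.
    halving≤ : ∀ m p → halving m ≤ s m p ^ 2
    halving≤ m p = ⊔-lub (m^n>0 (s m p) 2) (begin
      2 * (m ∸ 1)         ≤⟨ *-mono-≤ {2} {s m p} (s≤s (s≤s z≤n))
        (≤-trans (m∸n≤m m 1) (≤-trans (m≤m+n m _) (m≤n+m _ 2))) ⟩
      s m p * s m p       ≡⟨ cong (s m p *_) (*-identityʳ (s m p)) ⟨
      s m p ^ 2           ∎)

    final : B m p ≤ s m p ^ (X + X + e)
    final = begin
      halving m ^ X * s m p ^ e   ≤⟨ *-monoˡ-≤ (s m p ^ e) (^-monoˡ-≤ X (halving≤ m p)) ⟩
      (s m p ^ 2) ^ X * s m p ^ e ≡⟨ cong (_* s m p ^ e) (^-*-assoc (s m p) 2 X) ⟩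
      s m p ^ (X + (X + 0)) * s m p ^ e ≡⟨ cong (λ d → s m p ^ (X + d) * s m p ^ e) (+-identityʳ X) ⟩
      s m p ^ (X + X) * s m p ^ e ≡⟨ ^-distribˡ-+-* (s m p) (X + X) e ⟨
      s m p ^ (X + X + e)         ∎

-- From exponents to polynomials

sumᵖ : ∀ {n k} → Vec (Poly n) k → Poly n
sumᵖ []       = con 0
sumᵖ (p ∷ ps) = p ⊕ sumᵖ ps

powᵖ : Poly n → ℕ → Poly n
powᵖ p zero    = con 1
powᵖ p (suc d) = p ⊗ powᵖ p d

evalPoly-sum : ∀ (ps : Vec (Poly n) k) ms → evalPoly (sumᵖ ps) ms ≡ Vec.sum (Vec.map (λ p → evalPoly p ms)
  ps)
evalPoly-sum []       ms = refl
evalPoly-sum (p ∷ ps) ms = cong (evalPoly p ms +_) (evalPoly-sum ps ms)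

evalPoly-pow : ∀ (p : Poly n) d ms → evalPoly (powᵖ p d) ms ≡ evalPoly p ms ^ d
evalPoly-pow p zero    ms = refl
evalPoly-pow p (suc d) ms = cong (evalPoly p ms *_) (evalPoly-pow p d ms)

Nᵖ : Poly n
Nᵖ = con 2 ⊕ sumᵖ (tabulate var)

evalPoly-N : ∀ (ms : Vec ℕ n) → evalPoly Nᵖ ms ≡ N ms
evalPoly-N ms = cong (2 +_) (trans (evalPoly-sum (tabulate var) ms)
  (cong Vec.sum (trans (sym (tabulate-∘ (λ p → evalPoly p ms) var)) (tabulate∘lookup ms))))

-- Substitution in propositional formulas

-- A condition on the atoms that occur, built along the formula so that it passes through
-- substitutions. Conditions on all atoms may fail at the arbitrary bits out of range.
data AllAtoms (P : V → Set) : Form V → Set where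
  atom : ∀ {a} → P a → AllAtoms P (atom a)
  ⊤    : AllAtoms P ⊤
  ⊥    : AllAtoms P ⊥
  ¬_   : ∀ {A} → AllAtoms P A → AllAtoms P (¬ A)
  _∧_  : ∀ {A B} → AllAtoms P A → AllAtoms P B → AllAtoms P (A ∧ B)
  _∨_  : ∀ {A B} → AllAtoms P A → AllAtoms P B → AllAtoms P (A ∨ B)
  _⇒_  : ∀ {A B} → AllAtoms P A → AllAtoms P B → AllAtoms P (A ⇒ B)
  _⇔_  : ∀ {A B} → AllAtoms P A → AllAtoms P B → AllAtoms P (A ⇔ B)

module _ {P Q : V → Set} (f : ∀ {a} → P a → Q a) where

  mapAtoms : ∀ {A} → AllAtoms P A → AllAtoms Q A
  mapAtoms (atom p) = atom (f p)
  mapAtoms ⊤        = ⊤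
  mapAtoms ⊥        = ⊥
  mapAtoms (¬ p)    = ¬ mapAtoms p
  mapAtoms (p ∧ q)  = mapAtoms p ∧ mapAtoms q
  mapAtoms (p ∨ q)  = mapAtoms p ∨ mapAtoms q
  mapAtoms (p ⇒ q)  = mapAtoms p ⇒ mapAtoms q
  mapAtoms (p ⇔ q)  = mapAtoms p ⇔ mapAtoms q

module _ {P : V → Set} (f : ∀ a → P a) where

  allAtoms : ∀ A → AllAtoms P A
  allAtoms (atom a) = atom (f a)
  allAtoms ⊤        = ⊤
  allAtoms ⊥        = ⊥
  allAtoms (¬ A)    = ¬ allAtoms A
  allAtoms (A ∧ B)  = allAtoms A ∧ allAtoms B
  allAtoms (A ∨ B)  = allAtoms A ∨ allAtoms B
  allAtoms (A ⇒ B)  = allAtoms A ⇒ allAtoms B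
  allAtoms (A ⇔ B)  = allAtoms A ⇔ allAtoms B

module _ {σ : V → Form W} {P : W → Set} where

  allAtoms-sub : ∀ {A} → AllAtoms (λ a → AllAtoms P (σ a)) A → AllAtoms P (subᵖ σ A)
  allAtoms-sub (atom p) = p
  allAtoms-sub ⊤        = ⊤
  allAtoms-sub ⊥        = ⊥
  allAtoms-sub (¬ p)    = ¬ allAtoms-sub p
  allAtoms-sub (p ∧ q)  = allAtoms-sub p ∧ allAtoms-sub q
  allAtoms-sub (p ∨ q)  = allAtoms-sub p ∨ allAtoms-sub q
  allAtoms-sub (p ⇒ q)  = allAtoms-sub p ⇒ allAtoms-sub q
  allAtoms-sub (p ⇔ q)  = allAtoms-sub p ⇔ allAtoms-sub q

module _ {σ τ : V → Form W} where

  sub-ext : ∀ {A} → AllAtoms (λ a → σ a ≡ τ a) A → subᵖ σ A ≡ subᵖ τ A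
  sub-ext (atom e) = e
  sub-ext ⊤        = refl
  sub-ext ⊥        = refl
  sub-ext (¬ p)    = cong ¬_ (sub-ext p)
  sub-ext (p ∧ q)  = cong₂ _∧_ (sub-ext p) (sub-ext q)
  sub-ext (p ∨ q)  = cong₂ _∨_ (sub-ext p) (sub-ext q)
  sub-ext (p ⇒ q)  = cong₂ _⇒_ (sub-ext p) (sub-ext q)
  sub-ext (p ⇔ q)  = cong₂ _⇔_ (sub-ext p) (sub-ext q)

  sub-ext′ : (∀ a → σ a ≡ τ a) → ∀ A → subᵖ σ A ≡ subᵖ τ A
  sub-ext′ e A = sub-ext (allAtoms e A)

sub-sub : (τ : V → Form W) (σ : U → Form V) → ∀ A → subᵖ τ (subᵖ σ A) ≡ subᵖ (subᵖ τ ∘ σ) A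
sub-sub τ σ (atom a) = refl
sub-sub τ σ ⊤        = refl
sub-sub τ σ ⊥        = refl
sub-sub τ σ (¬ A)    = cong ¬_ (sub-sub τ σ A)
sub-sub τ σ (A ∧ B)  = cong₂ _∧_ (sub-sub τ σ A) (sub-sub τ σ B)
sub-sub τ σ (A ∨ B)  = cong₂ _∨_ (sub-sub τ σ A) (sub-sub τ σ B)
sub-sub τ σ (A ⇒ B)  = cong₂ _⇒_ (sub-sub τ σ A) (sub-sub τ σ B)
sub-sub τ σ (A ⇔ B)  = cong₂ _⇔_ (sub-sub τ σ A) (sub-sub τ σ B)

sub-atom : (A : Form V) → subᵖ atom A ≡ A
sub-atom (atom a) = refl
sub-atom ⊤        = refl
sub-atom ⊥        = refl
sub-atom (¬ A)    = cong ¬_ (sub-atom A)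
sub-atom (A ∧ B)  = cong₂ _∧_ (sub-atom A) (sub-atom B)
sub-atom (A ∨ B)  = cong₂ _∨_ (sub-atom A) (sub-atom B)
sub-atom (A ⇒ B)  = cong₂ _⇒_ (sub-atom A) (sub-atom B)
sub-atom (A ⇔ B)  = cong₂ _⇔_ (sub-atom A) (sub-atom B)

module _ (v : W → Bool) (σ : V → Form W) {w : V → Bool} (e : ∀ a → evalᵖ v (σ a) ≡ w a) where

  eval-sub : ∀ A → evalᵖ v (subᵖ σ A) ≡ evalᵖ w A
  eval-sub (atom a) = e a
  eval-sub ⊤        = refl
  eval-sub ⊥        = refl
  eval-sub (¬ A)    = cong not (eval-sub A)
  eval-sub (A ∧ B)  = cong₂ Bool._∧_ (eval-sub A) (eval-sub B)
  eval-sub (A ∨ B)  = cong₂ Bool._∨_ (eval-sub A) (eval-sub B)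
  eval-sub (A ⇒ B)  = cong₂ (λ a b → not a Bool.∨ b) (eval-sub A) (eval-sub B)
  eval-sub (A ⇔ B)  = cong₂ (λ a b → not (a Bool.xor b)) (eval-sub A) (eval-sub B)

1≤size : (A : Form V) → 1 ≤ size A
1≤size (atom _) = s≤s z≤n
1≤size ⊤        = s≤s z≤n
1≤size ⊥        = s≤s z≤n
1≤size (¬ _)    = s≤s z≤n
1≤size (_ ∧ _)  = s≤s z≤n
1≤size (_ ∨ _)  = s≤s z≤n
1≤size (_ ⇒ _)  = s≤s z≤n
1≤size (_ ⇔ _)  = s≤s z≤n

module _ {σ : V → Form W} {t : ℕ} (1≤t : 1 ≤ t) where

  private
    one : 1 ≤ 1 * t
    one = ≤-trans 1≤t (m≤m+n t 0)

    two : ∀ {a b a′ b′} → a′ ≤ a * t → b′ ≤ b * t → suc (a′ + b′) ≤ suc (a + b) * t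
    two {a} {b} a≤ b≤ = +-mono-≤ 1≤t (≤-trans (+-mono-≤ a≤ b≤) (≤-reflexive (sym (*-distribʳ-+ t a b))))

  size-sub : ∀ {A} → AllAtoms (λ a → size (σ a) ≤ t) A → size (subᵖ σ A) ≤ size A * t
  size-sub (atom p) = ≤-trans p (m≤m+n t 0)
  size-sub ⊤        = one
  size-sub ⊥        = one
  size-sub (¬ p)    = +-mono-≤ 1≤t (size-sub p)
  size-sub {A ∧ B} (p ∧ q) = two {size A} {size B} (size-sub p) (size-sub q)
  size-sub {A ∨ B} (p ∨ q) = two {size A} {size B} (size-sub p) (size-sub q)
  size-sub {A ⇒ B} (p ⇒ q) = two {size A} {size B} (size-sub p) (size-sub q)
  size-sub {A ⇔ B} (p ⇔ q) = two {size A} {size B} (size-sub p) (size-sub q)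

module _ (σ : V → Form W) where

  private
    left : ∀ {A} a b → AllAtoms (λ x → size (σ x) ≤ a) A → AllAtoms (λ x → size (σ x) ≤ suc (a + b)) A
    left a b = mapAtoms λ p → ≤-trans p (≤-trans (m≤m+n a b) (n≤1+n _))

    right : ∀ {A} a b → AllAtoms (λ x → size (σ x) ≤ b) A → AllAtoms (λ x → size (σ x) ≤ suc (a + b)) A
    right a b = mapAtoms λ p → ≤-trans p (≤-trans (m≤n+m b a) (n≤1+n _))

  -- What is put for an occurring atom is a subformula of the result. Hence clipping at the size of
  -- the result leaves it unchanged.
  size-atoms : ∀ A → AllAtoms (λ a → size (σ a) ≤ size (subᵖ σ A)) A
  size-atoms (atom a) = atom ≤-refl
  size-atoms ⊤        = ⊤
  size-atoms ⊥        = ⊥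
  size-atoms (¬ A)    = ¬ mapAtoms (λ p → ≤-trans p (n≤1+n _)) (size-atoms A)
  size-atoms (A ∧ B)  = left _ _ (size-atoms A) ∧ right (size (subᵖ σ A)) _ (size-atoms B)
  size-atoms (A ∨ B)  = left _ _ (size-atoms A) ∨ right (size (subᵖ σ A)) _ (size-atoms B)
  size-atoms (A ⇒ B)  = left _ _ (size-atoms A) ⇒ right (size (subᵖ σ A)) _ (size-atoms B)
  size-atoms (A ⇔ B)  = left _ _ (size-atoms A) ⇔ right (size (subᵖ σ A)) _ (size-atoms B)

-- Replacing the long formulas makes the size of a substitution bounded without
-- changing the short results.
clip : ℕ → Form V → Form V
clip t A = if size A ≤ᵇ t then A else ⊤

size-clip : 1 ≤ M → (A : Form V) → size (clip M A) ≤ M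
size-clip {M} 1≤M A with size A ≤ᵇ M in e
... | true  = ≤ᵇ⇒≤ _ _ (≡.subst T (sym e) _)
... | false = 1≤M

clip-≤ : (A : Form V) → size A ≤ M → clip M A ≡ A
clip-≤ {M = M} A p with size A ≤ᵇ M | ≤⇒≤ᵇ p
... | true | _ = refl

sub-clip : ∀ {σ : V → Form W} {A} → AllAtoms (λ a → size (σ a) ≤ M) A → subᵖ (clip M ∘ σ) A ≡ subᵖ σ A
sub-clip = sub-ext ∘ mapAtoms (clip-≤ _)

-- Proofs by schematic rules

infix 1 _⊢_

-- With five metavariables for every schema, validity is a truth table of 32 rows.
record Schema : Set where
  constructor _⊢_
  field
    premisesˢ   : List (Form (Fin 5))
    conclusionˢ : Form (Fin 5)

open Schema

infixr 2 _▹_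
infix  2 ⊢_

⊢_ : Form (Fin 5) → Schema
⊢ A = [] ⊢ A

_▹_ : Form (Fin 5) → Schema → Schema
B ▹ (Γ ⊢ A) = (B ∷ Γ) ⊢ A

schemas : Vec Schema 47
schemas =
  -- 0-13: modus ponens and Kleene's axioms
    (A ⇒ B ▹ A ▹ ⊢ B)
  ∷ (⊢ A ⇒ B ⇒ A)
  ∷ (⊢ (A ⇒ B ⇒ C) ⇒ (A ⇒ B) ⇒ A ⇒ C)
  ∷ (⊢ A ⇒ B ⇒ A ∧ B)
  ∷ (⊢ A ∧ B ⇒ A)
  ∷ (⊢ A ∧ B ⇒ B)
  ∷ (⊢ A ⇒ A ∨ B)
  ∷ (⊢ B ⇒ A ∨ B)
  ∷ (⊢ (A ⇒ C) ⇒ (B ⇒ C) ⇒ A ∨ B ⇒ C)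
  ∷ (⊢ (A ⇒ B) ⇒ (A ⇒ ¬ B) ⇒ ¬ A)
  ∷ (⊢ ¬ ¬ A ⇒ A)
  ∷ (⊢ (A ⇒ B) ⇒ (B ⇒ A) ⇒ (A ⇔ B))
  ∷ (⊢ (A ⇔ B) ⇒ A ⇒ B)
  ∷ (⊢ (A ⇔ B) ⇒ B ⇒ A)
  -- 14-25: deduction
  ∷ (A ⇒ B ▹ A ⇒ C ▹ A ▹ ⊢ B ∧ C)
  ∷ (⊢ H ⇒ ⊤)
  ∷ (H ⇒ ⊥ ▹ ⊢ H ⇒ A)
  ∷ (A ▹ B ▹ ⊢ A ∧ B)
  ∷ (H ⇒ A ▹ H ⇒ B ▹ ⊢ H ⇒ A ∧ B)
  ∷ (H ⇒ A ∧ B ▹ ⊢ H ⇒ A)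
  ∷ (H ⇒ A ∧ B ▹ ⊢ H ⇒ B)
  ∷ (⊢ A ⇒ A)
  ∷ (H ⇒ A ∧ B ⇒ C ▹ ⊢ H ∧ A ⇒ B ⇒ C)
  ∷ (H ∧ A ⇒ B ▹ ⊢ H ⇒ A ⇒ B)
  ∷ (H ⇒ ⊤ ⇒ A ▹ ⊢ H ⇒ A)
  ∷ (⊤ ⇒ A ▹ ⊢ A)
  -- 26-33: equivalence
  ∷ (⊢ H ⇒ (A ⇔ A))
  ∷ (H ⇒ (A ⇔ B) ▹ ⊢ H ⇒ (B ⇔ A))
  ∷ (H ⇒ (A ⇔ B) ▹ H ⇒ (B ⇔ C) ▹ ⊢ H ⇒ (A ⇔ C))
  ∷ (H ⇒ (A ⇔ B) ▹ ⊢ H ⇒ (¬ A ⇔ ¬ B))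
  ∷ (H ⇒ (A ⇔ B) ▹ H ⇒ (C ⇔ D) ▹ ⊢ H ⇒ (A ∧ C ⇔ B ∧ D))
  ∷ (H ⇒ (A ⇔ B) ▹ H ⇒ (C ⇔ D) ▹ ⊢ H ⇒ (A ∨ C ⇔ B ∨ D))
  ∷ (H ⇒ (A ⇔ B) ▹ H ⇒ (C ⇔ D) ▹ ⊢ H ⇒ ((A ⇒ C) ⇔ (B ⇒ D)))
  ∷ (H ⇒ (A ⇔ B) ▹ H ⇒ (C ⇔ D) ▹ ⊢ H ⇒ ((A ⇔ C) ⇔ (B ⇔ D)))
  -- 34-36: case distinction on C
  ∷ (A ∧ B ▹ ¬ C ⇒ (A ⇔ D) ▹ C ⇒ (B ⇔ D) ▹ ⊢ D)
  ∷ (⊢ ¬ A ⇒ (⊥ ⇔ A))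
  ∷ (⊢ A ⇒ (⊤ ⇔ A))
  -- 37-46: the axioms on cond, and the disequations
  ∷ (⊢ H ⇒ (A ⇔ (¬ B ∧ A) ∨ (B ∧ A)))
  ∷ (⊢ H ⇒ ((¬ ⊥ ∧ A) ∨ (⊥ ∧ B) ⇔ A))
  ∷ (⊢ H ⇒ ((¬ ⊤ ∧ A) ∨ (⊤ ∧ B) ⇔ B))
  ∷ (⊢ ¬ ⊥)
  ∷ (⊢ ¬ ((⊥ ⇔ ⊤) ∧ ⊤))
  ∷ (⊢ A ⇒ (⊤ ∧ A) ∨ (⊥ ∧ ⊥))
  ∷ (⊢ A ⇒ (⊥ ∧ ⊥) ∨ (A ∧ ⊤))
  ∷ (⊢ ⊤ ⇔ ¬ ⊥)
  ∷ (⊢ ⊥ ⇔ ¬ ⊤)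
  ∷ (⊢ ⊥ ⇒ A)
  ∷ []
  where
  A B C D H : Form (Fin 5)
  A = atom (# 0)
  B = atom (# 1)
  C = atom (# 2)
  D = atom (# 3)
  H = atom (# 4)

allVec : ∀ n → (Vec Bool n → Bool) → Bool
allVec zero    p = p []
allVec (suc n) p = allVec n (p ∘ (false ∷_)) Bool.∧ allVec n (p ∘ (true ∷_))

T-∧⁻ : ∀ {a b} → T (a Bool.∧ b) → T a × T b
T-∧⁻ = T-∧ .to

allVec-sound : ∀ n (p : Vec Bool n → Bool) → T (allVec n p) → ∀ v → T (p v)
allVec-sound zero    p t []          = t
allVec-sound (suc n) p t (false ∷ v) = allVec-sound n _ (proj₁ (T-∧⁻ t)) v
allVec-sound (suc n) p t (true  ∷ v) = allVec-sound n _ (proj₂ (T-∧⁻ t)) v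

holds : Schema → Vec Bool 5 → Bool
holds (Γ ⊢ A) v = List.foldr (λ B b → not (evalᵖ (lookup v) B) Bool.∨ b) (evalᵖ (lookup v) A) Γ

schemas-valid : ∀ i → T (allVec 5 (holds (lookup schemas i)))
-- The `_` stands for all 47 truth tables: their conjunction evaluates to `true`, so its proof is
-- found by computation.
schemas-valid = VecAllₚ.lookup⁺ (toAll schemas _)
  where
  Valid : Schema → Set
  Valid S = T (allVec 5 (holds S))
  toAll : ∀ {n} (Ss : Vec Schema n) → T (Vec.foldr _ (λ S b → allVec 5 (holds S) Bool.∧ b) true Ss) →
    VecAll.All Valid Ss
  toAll []       _ = []
  toAll (S ∷ Ss) t = proj₁ (T-∧⁻ t) ∷ toAll Ss (proj₂ (T-∧⁻ t))

holds⇒ : ∀ Γ A (v : Vec Bool 5) → T (holds (Γ ⊢ A) v) → All (λ B → evalᵖ (lookup v) B ≡ true) Γ →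
         evalᵖ (lookup v) A ≡ true
holds⇒ []      A v t []       = T-≡ .to t
holds⇒ (B ∷ Γ) A v t (e ∷ es) = holds⇒ Γ A v (≡.subst (λ b → T (not b Bool.∨ holds (Γ ⊢ A) v)) e t) es

ruleForm : Form (Fin 5) → Form ℕ
ruleForm = subᵖ (atom ∘ toℕ)

schema-sound : ∀ i → let Γ ⊢ A = lookup schemas i in List.map ruleForm Γ ⊨ ruleForm A
schema-sound i v es = trans (eval≡ A) (holds⇒ Γ A w (allVec-sound 5 (holds (Γ ⊢ A)) (schemas-valid i) w)
    (All.map (λ {B} e → trans (sym (eval≡ B)) e) (Allₚ.map⁻ es)))
  where
  Γ = premisesˢ (lookup schemas i)
  A = conclusionˢ (lookup schemas i)
  w : Vec Bool 5
  w = tabulate (v ∘ toℕ)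
  eval≡ : ∀ B → evalᵖ v (ruleForm B) ≡ evalᵖ (lookup w) B
  eval≡ = eval-sub v (atom ∘ toℕ) (λ j → sym (lookup∘tabulate (v ∘ toℕ) j))

inst : Vec (Form V) 5 → Form (Fin 5) → Form V
inst As = subᵖ (lookup As)

-- A proof tree with at most n inferences in which all formulas have size at
-- most M.
mutual

  data Prf {V : Set} (M : ℕ) : ℕ → Form V → Set where
    by    : ∀ {n} i As → let Γ ⊢ A = lookup schemas i in
            Prfs M n (List.map (inst As) Γ) → size (inst As A) ≤ M → Prf M (suc n) (inst As A)
    relax : ∀ {m n A} → m ≤ n → Prf M m A → Prf M n A

  data Prfs {V : Set} (M : ℕ) : ℕ → List (Form V) → Set where
    []  : Prfs M 0 []
    -- A separate singleton keeps a trailing `+ 0` out of the counts.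
    ⟪_⟫ : ∀ {n A} → Prf M n A → Prfs M n (A ∷ [])
    _∷_ : ∀ {m n A As} → Prf M m A → Prfs M n As → Prfs M (m + n) (A ∷ As)

fits : {A : Form V} → Prf M n A → size A ≤ M
fits (by _ _ _ fit) = fit
fits (relax _ p)    = fits p

fitss : {As : List (Form V)} → Prfs M n As → All (λ A → size A ≤ M) As
fitss []       = []
fitss ⟪ p ⟫    = fits p ∷ []
fitss (p ∷ ps) = fits p ∷ fitss ps

mutual

  enlarge : ∀ {M M′} {A : Form V} → M ≤ M′ → Prf M n A → Prf M′ n A
  enlarge le (by i As ps fit) = by i As (enlarges le ps) (≤-trans fit le)
  enlarge le (relax m≤n p)    = relax m≤n (enlarge le p)

  enlarges : ∀ {M M′} {As : List (Form V)} → M ≤ M′ → Prfs M n As → Prfs M′ n As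
  enlarges le []       = []
  enlarges le ⟪ p ⟫    = ⟪ enlarge le p ⟫
  enlarges le (p ∷ ps) = enlarge le p ∷ enlarges le ps

module _ (σ : V → Form W) {t : ℕ} (1≤t : 1 ≤ t) (σ≤ : ∀ a → size (σ a) ≤ t) where

  inst-sub : ∀ (As : Vec (Form V) 5) A → inst (Vec.map (subᵖ σ) As) A ≡ subᵖ σ (inst As A)
  inst-sub As A = trans (sub-ext′ (λ j → lookup-map j (subᵖ σ) As) A) (sym (sub-sub σ (lookup As) A))

  mutual

    Prf-sub′ : ∀ {A} → Prf M n A → Prf (M * t) n (subᵖ σ A)
    Prf-sub′ {M = M} (by {n} i As ps fit) =
      ≡.subst (Prf (M * t) (suc n)) (inst-sub As A)
        (by i (Vec.map (subᵖ σ) As)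
            (≡.subst (Prfs (M * t) n)
              (trans (sym (map-∘ Γ)) (sym (map-cong-local (All.universal (inst-sub As) Γ))))
              (Prfs-sub′ ps))
            (≡.subst (λ B → size B ≤ M * t) (sym (inst-sub As A))
              (≤-trans (size-sub 1≤t (allAtoms σ≤ (inst As A))) (*-monoˡ-≤ t fit))))
      where
      Γ = premisesˢ (lookup schemas i)
      A = conclusionˢ (lookup schemas i)
    Prf-sub′ (relax m≤n p) = relax m≤n (Prf-sub′ p)

    Prfs-sub′ : ∀ {As} → Prfs M n As → Prfs (M * t) n (List.map (subᵖ σ) As)
    Prfs-sub′ []       = []
    Prfs-sub′ ⟪ p ⟫    = ⟪ Prf-sub′ p ⟫
    Prfs-sub′ (p ∷ ps) = Prf-sub′ p ∷ Prfs-sub′ ps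

-- Lines inside the proof may contain atoms absent from its conclusion, where nothing is known about
-- `σ`. Clipping `σ` at `t` bounds it everywhere and does not alter the conclusion.
Prf-sub : ∀ {σ : V → Form W} {t A} → 1 ≤ t → AllAtoms (λ a → size (σ a) ≤ t) A →
          Prf M n A → Prf (M * t) n (subᵖ σ A)
Prf-sub {M = M} {n = n} {σ = σ} {t} 1≤t σ≤ p =
  ≡.subst (Prf (M * t) n) (sub-clip σ≤) (Prf-sub′ (clip t ∘ σ) 1≤t (size-clip 1≤t ∘ σ) p)

-- Simulation by an arbitrary Frege system

totalSize : List (Form V) → ℕ
totalSize = sum ∘ List.map size

_⊆_ : List (Form V) → List (Form V) → Set
ls ⊆ ls′ = ∀ {A} → A ∈ ls → A ∈ ls′

module Simulation (𝓕 : FregeSystem) where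

  open FregeSystem 𝓕

  conclusionᴺ : Fin 47 → Form ℕ
  conclusionᴺ i = ruleForm (conclusionˢ (lookup schemas i))

  abstract

    derivedSchema : ∀ i → Derives rules (List.map ruleForm (premisesˢ (lookup schemas i))) (conclusionᴺ i)
    derivedSchema i = complete _ _ (schema-sound i)

  schemaSize : Fin 47 → ℕ
  schemaSize i = totalSize (conclusionᴺ i ∷ proj₁ (derivedSchema i))

  abstract

    -- The total size of the derivations of all schemas. The given Frege system enters the final
    -- bound only through this constant.
    K : ℕ
    K = Vec.sum (tabulate schemaSize)

    schemaSize≤K : ∀ i → schemaSize i ≤ K
    schemaSize≤K i = ≤-trans (≤-reflexive (sym (lookup∘tabulate schemaSize i)))
      (lookup≤sum (tabulate schemaSize) i)

  module _ {Γ : List (Form ℕ)} {σ : ℕ → Form V} (1≤M : 1 ≤ M) (σ≤ : ∀ a → size (σ a) ≤ M)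
           {base : List (Form V)} (D : Derivation rules [] base)
           (Γ⊆ : ∀ {B} → B ∈ Γ → subᵖ σ B ∈ base) where

    -- Frege rules are closed under substitution, so a derivation from `Γ` can be replayed under `σ`
    -- on top of lines that already contain the instances of `Γ`. Citing a hypothesis then adds no
    -- line.
    splice : ∀ {ls} → Derivation rules Γ ls →
             Σ[ ls′ ∈ List (Form V) ] Derivation rules [] ls′ × base ⊆ ls′ ×
               (∀ {B} → B ∈ ls → subᵖ σ B ∈ ls′) × totalSize ls′ ≤ totalSize ls * M + totalSize base
    splice [] = base , D , id , (λ ()) , ≤-refl
    splice (hyp {A} {ls} A∈Γ D′) with splice D′
    ... | ls′ , E , base⊆ , ls⊆ , le =
      ls′ , E , base⊆ , (λ { (here refl) → base⊆ (Γ⊆ A∈Γ) ; (there B∈) → ls⊆ B∈ }) ,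
      ≤-trans le (+-monoˡ-≤ _ (*-monoˡ-≤ M (m≤n+m (totalSize ls) (size A))))
    splice (infer {r} {ls} r∈ τ prems D′) with splice D′
    ... | ls′ , E , base⊆ , ls⊆ , le =
      subᵖ (subᵖ σ ∘ τ) C ∷ ls′ ,
      infer r∈ (subᵖ σ ∘ τ) (All.map (λ {B} B∈ → ≡.subst (_∈ ls′) (sub-sub σ τ B) (ls⊆ B∈)) prems) E ,
      there ∘ base⊆ ,
      (λ { (here refl) → here (sub-sub σ τ C) ; (there B∈) → there (ls⊆ B∈) }) ,
      (begin
        size (subᵖ (subᵖ σ ∘ τ) C) + totalSize ls′
          ≡⟨ cong (λ B → size B + totalSize ls′) (sub-sub σ τ C) ⟨
        size (subᵖ σ (subᵖ τ C)) + totalSize ls′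
          ≤⟨ +-mono-≤ (size-sub 1≤M (allAtoms σ≤ (subᵖ τ C))) le ⟩
        size (subᵖ τ C) * M + (totalSize ls * M + totalSize base)
          ≡⟨ +-assoc (size (subᵖ τ C) * M) (totalSize ls * M) (totalSize base) ⟨
        size (subᵖ τ C) * M + totalSize ls * M + totalSize base
          ≡⟨ cong (_+ totalSize base) (*-distribʳ-+ M (size (subᵖ τ C)) (totalSize ls)) ⟨
        (size (subᵖ τ C) + totalSize ls) * M + totalSize base ∎)
      where
      open ≤-Reasoning
      C = Rule.conclusion r

  -- A derivation supplied by completeness may use atoms beyond the five metavariables; these are
  -- sent to `⊤`.
  nth : Vec (Form V) k → ℕ → Form V
  nth []       _       = ⊤
  nth (A ∷ As) zero    = A
  nth (A ∷ As) (suc j) = nth As j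

  nth-toℕ : ∀ (As : Vec (Form V) k) j → nth As (toℕ j) ≡ lookup As j
  nth-toℕ (A ∷ As) zero    = refl
  nth-toℕ (A ∷ As) (suc j) = nth-toℕ As j

  module _ (As : Vec (Form V) 5) where

    ruleInst : ℕ → Form ℕ → Form V
    ruleInst M = subᵖ (clip M ∘ nth As)

    -- By `size-atoms` the metavariables occurring in `B` have instances no larger than the result,
    -- so the clip does not touch them. It only affects metavariables foreign to `B`, which the
    -- spliced derivation may still mention.
    ruleInst-inst : ∀ {B} → size (inst As B) ≤ M → ruleInst M (ruleForm B) ≡ inst As B
    ruleInst-inst {M = M} {B} fit = trans (sub-sub _ _ B) (sub-ext (mapAtoms
      (λ {j} p → trans (cong (clip M) (nth-toℕ As j)) (clip-≤ _ (≤-trans p fit)))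
        (size-atoms (lookup As) B)))

  -- Lines are only added on top of `base`, so the derivations of several premises accumulate in one
  -- sequence and their costs add up.
  Extension : List (Form V) → (List (Form V) → Set) → ℕ → Set
  Extension {V} base P b =
    Σ[ ls ∈ List (Form V) ] Derivation rules [] ls × base ⊆ ls × P ls × totalSize ls ≤ b + totalSize base

  mutual

    extend : ∀ {A : Form V} → Prf M n A → ∀ {base} → Derivation rules [] base →
             Extension base (A ∈_) (n * (K * M))
    extend {M = M} (by {n} i As ps fit) {base} D with extends ps D
    ... | ls , E , base⊆ , Γ∈ , le with splice {M = M}
        (≤-trans (1≤size (inst As (conclusionˢ (lookup schemas i)))) fit)
          (λ j → size-clip (≤-trans (1≤size (inst As (conclusionˢ (lookup schemas i)))) fit) (nth As j)) E
          (λ B∈ → premise∈ (∈-map⁻ ruleForm B∈)) (proj₂ (derivedSchema i))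
      where
      Γ = premisesˢ (lookup schemas i)
      premise∈ : ∀ {B} → Σ[ B′ ∈ Form (Fin 5) ] B′ ∈ Γ × B ≡ ruleForm B′ → ruleInst As M B ∈ ls
      premise∈ (B′ , B′∈ , refl) =
        ≡.subst (_∈ ls) (sym (ruleInst-inst As {B = B′} (All.lookup (Allₚ.map⁻ (fitss ps)) B′∈)))
                (All.lookup Γ∈ (∈-map⁺ (inst As) B′∈))
    ... | ls′ , E′ , ls⊆ , new , le′ =
      ls′ , E′ , ls⊆ ∘ base⊆ , ≡.subst (_∈ ls′) (ruleInst-inst As {B = A} fit) (new (here refl)) ,
      (begin
        totalSize ls′                                   ≤⟨ le′ ⟩
        schemaSize i * M + totalSize ls                 ≤⟨ +-mono-≤ (*-monoˡ-≤ M (schemaSize≤K i)) le ⟩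
        K * M + (n * (K * M) + totalSize base)          ≡⟨ +-assoc (K * M) (n * (K * M)) (totalSize base) ⟨
        suc n * (K * M) + totalSize base                ∎)
      where
      open ≤-Reasoning
      A = conclusionˢ (lookup schemas i)
    extend {M = M} (relax m≤n p) D with extend p D
    ... | ls , E , base⊆ , A∈ , le =
      ls , E , base⊆ , A∈ , ≤-trans le (+-monoˡ-≤ _ (*-monoˡ-≤ (K * M) m≤n))

    extends : ∀ {As : List (Form V)} → Prfs M n As → ∀ {base} → Derivation rules [] base →
              Extension base (λ ls → All (_∈ ls) As) (n * (K * M))
    extends [] D = _ , D , id , [] , ≤-refl
    extends ⟪ p ⟫ D with extend p D
    ... | ls , E , base⊆ , A∈ , le = ls , E , base⊆ , A∈ ∷ [] , le
    extends {M = M} (_∷_ {m} {n} p ps) {base} D with extend p D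
    ... | ls , E , base⊆ , A∈ , le with extends ps E
    ... | ls′ , E′ , ls⊆ , As∈ , le′ =
      ls′ , E′ , ls⊆ ∘ base⊆ , ls⊆ A∈ ∷ As∈ ,
      (begin
        totalSize ls′                                              ≤⟨ le′ ⟩
        n * (K * M) + totalSize ls                                 ≤⟨ +-monoʳ-≤ (n * (K * M)) le ⟩
        n * (K * M) + (m * (K * M) + totalSize base)               ≡⟨ +-assoc (n * (K * M)) (m * (K * M))
          (totalSize base) ⟨
        n * (K * M) + m * (K * M) + totalSize base                 ≡⟨ cong (_+ totalSize base)
          (+-comm (n * (K * M)) (m * (K * M))) ⟩
        m * (K * M) + n * (K * M) + totalSize base                 ≡⟨ cong (_+ totalSize base)
          (*-distribʳ-+ (K * M) m n) ⟨
        (m + n) * (K * M) + totalSize base                         ∎)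
      where open ≤-Reasoning

  -- A Frege proof ends with its conclusion, but here the formula may lie deeper: a schema whose
  -- derivation ends by citing a hypothesis adds no line. An initial part of a derivation is again a
  -- derivation.
  truncate : ∀ {A : Form V} {ls} → A ∈ ls → Derivation rules [] ls →
             Σ[ p ∈ FregeProof 𝓕 A ] proofSize {𝓕} p ≤ totalSize ls
  truncate (here refl) D = (_ , D) , ≤-refl
  truncate (there {x = B} A∈) (infer _ _ _ D) with truncate A∈ D
  ... | p , le = p , ≤-trans le (m≤n+m _ (size B))

  toFrege : ∀ {A : Form V} → Prf M n A → Σ[ p ∈ FregeProof 𝓕 A ] proofSize {𝓕} p ≤ n * (K * M)
  toFrege p with extend p []
  ... | ls , D , _ , A∈ , le with truncate A∈ D
  ... | q , le′ = q , ≤-trans le′ (≤-trans le (≤-reflexive (+-identityʳ _)))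

-- Bits in range

InRange : Vec ℕ n → Atom n → Set
InRange ms (j , i) = 1 ≤ i × i ≤ lookup ms j

OnRange : (Form V → Set) → ℕ → Bits V → Set
OnRange P m b = ∀ i → 1 ≤ i → i ≤ m → P (b i)

Scoped : Vec ℕ n → ℕ → Bits (Atom n) → Set
Scoped ms = OnRange (AllAtoms (InRange ms))

Sized : ℕ → ℕ → Bits V → Set
Sized t = OnRange (λ A → size A ≤ t)

module _ {ms : Vec ℕ k} {bs : Vec (Bits V) k} {A : Form (Atom k)} (s : AllAtoms (InRange ms) A) where

  []-scoped : ∀ {P} → Pointwise (OnRange (AllAtoms P)) ms bs → AllAtoms P (A [ bs ]ᵖ)
  []-scoped pw = allAtoms-sub (mapAtoms (λ {a} (1≤i , i≤) → Pointwise.lookup pw (proj₁ a) (proj₂ a) 1≤i i≤)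
    s)

  atoms-sized : ∀ {t} → Pointwise (Sized t) ms bs →
    AllAtoms (λ a → size (lookup bs (proj₁ a) (proj₂ a)) ≤ t) A
  atoms-sized pw = mapAtoms (λ {a} (1≤i , i≤) → Pointwise.lookup pw (proj₁ a) (proj₂ a) 1≤i i≤) s

  []-sized : ∀ {t} → 1 ≤ t → Pointwise (Sized t) ms bs → size (A [ bs ]ᵖ) ≤ size A * t
  []-sized 1≤t pw = size-sub 1≤t (atoms-sized pw)

  []-ext : {cs : Vec (Bits V) k} → (∀ j i → 1 ≤ i → i ≤ lookup ms j → lookup bs j i ≡ lookup cs j i) →
           A [ bs ]ᵖ ≡ A [ cs ]ᵖ
  []-ext e = sub-ext (mapAtoms (λ {a} (1≤i , i≤) → e (proj₁ a) (proj₂ a) 1≤i i≤) s)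

_≗ᵇ_ : Bits V → Bits V → Set
b ≗ᵇ c = ∀ i → b i ≡ c i

[]-ext′ : {bs cs : Vec (Bits V) k} → Pointwise _≗ᵇ_ bs cs → ∀ A → A [ bs ]ᵖ ≡ A [ cs ]ᵖ
[]-ext′ pw = sub-ext′ (λ (j , i) → Pointwise.lookup pw j i)

pointwise-tabulate : ∀ {a b ℓ} {A : Set a} {B : Set b} {R : A → B → Set ℓ} (xs : Vec A n) {f : Fin n → B} →
                     (∀ j → R (lookup xs j) (f j)) → Pointwise R xs (tabulate f)
pointwise-tabulate []       r = []
pointwise-tabulate (x ∷ xs) r = r zero ∷ pointwise-tabulate xs (r ∘ suc)

catBits-elim : ∀ (P : Form V → Set) m b c i → (i ≤ m → P (b i)) → (m < i → P (c (i ∸ m))) →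
  P (catBits m b c i)
catBits-elim P m b c i l r with i ≤ᵇ m in e
... | true  = l (≤ᵇ⇒≤ i m (≡.subst T (sym e) _))
... | false = r (≰⇒> (λ i≤m → ≡.subst T e (≤⇒≤ᵇ i≤m)))

catBits-≤ : ∀ {m} {b c : Bits V} {i} → i ≤ m → catBits m b c i ≡ b i
catBits-≤ {m = m} {b} {c} {i} i≤m = catBits-elim (_≡ b i) m b c i (λ _ → refl)
  (λ m<i → contradiction i≤m (<⇒≱ m<i))

catBits-> : ∀ {m} {b c : Bits V} {i} → m < i → catBits m b c i ≡ c (i ∸ m)
catBits-> {m = m} {b} {c} {i} m<i = catBits-elim (_≡ c (i ∸ m)) m b c i
  (λ i≤m → contradiction i≤m (<⇒≱ m<i)) (λ _ → refl)

sub-catBits : ∀ (σ : V → Form W) m b c i → subᵖ σ (catBits m b c i) ≡ catBits m (subᵖ σ ∘ b) (subᵖ σ ∘ c) i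
sub-catBits σ m b c i with i ≤ᵇ m
... | true  = refl
... | false = refl

-- If `n` exceeded `m`, truncated subtraction would leave no index `i ≥ 1`.
i+n≤m : ∀ {i m} n → 1 ≤ i → i ≤ m ∸ n → i + n ≤ m
i+n≤m {i} {m} n 1≤i i≤ = begin
  i + n     ≤⟨ +-monoˡ-≤ n i≤ ⟩
  m ∸ n + n ≡⟨ m∸n+n≡m n≤m ⟩
  m         ∎
  where
  open ≤-Reasoning
  n≤m : n ≤ m
  n≤m with n ≤? m
  ... | yes n≤m = n≤m
  ... | no  n≰m = contradiction (≤-trans 1≤i (≤-trans i≤ (≤-reflexive (m≤n⇒m∸n≡0 (<⇒≤ (≰⇒> n≰m)))))) λ ()

-- For `cond`: a branch of length `p` is padded on the left by `q ∸ p` zeros, and past the padding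
-- the index falls into the branch itself.
≤⊔⇒∸∸≤ : ∀ {i} p q → i ≤ p ⊔ q → i ∸ (q ∸ p) ≤ p
≤⊔⇒∸∸≤ {i} p q i≤ = m≤n+o⇒m∸n≤o i (q ∸ p)
  (≤-trans i≤ (≤-trans (⊔-lub (m≤m+n p _) (m≤n+m∸n q p)) (≤-reflexive (+-comm p (q ∸ p)))))

-- For `ℓCRN`: bit `j` of the suffix of x starting at position `i` is bit `j + i ∸ 1` of x.
shift-range : ∀ {m i j} → 1 ≤ i → i ≤ m → 1 ≤ j → j ≤ m ∸ i + 1 → 1 ≤ j + i ∸ 1 × j + i ∸ 1 ≤ m
shift-range {m} {suc i} {suc j} _ i<m _ (s≤s′) = ≤-trans 1≤suc (m≤n+m (suc i) j) , (begin
  j + suc i           ≤⟨ +-monoˡ-≤ (suc i) (s≤s⁻¹ (≤-trans s≤s′ (≤-reflexive (+-comm _ 1)))) ⟩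
  m ∸ suc i + suc i   ≡⟨ m∸n+n≡m i<m ⟩
  m                   ∎)
  where
  open ≤-Reasoning
  1≤suc : ∀ {i} → 1 ≤ suc i
  1≤suc = s≤s z≤n

half-range : ∀ {j} m → j ≤ ⌈ m /2⌉ → j + ⌊ m /2⌋ ≤ m
half-range {j} m j≤ = ≤-trans (+-monoˡ-≤ ⌊ m /2⌋ j≤)
  (≤-reflexive (trans (+-comm ⌈ m /2⌉ ⌊ m /2⌋) (⌊n/2⌋+⌈n/2⌉≡n m)))

-- The recursion of TRN

-- Within the recursion the accessibility proof for ⌊m/2⌋ is a part of the one for m, whereas `lenˢ`
-- restarts from `<-wellFounded`. The two values must be identified before the defining equation of
-- `TRN` can be read off.
lenTRN-irrelevant : ∀ {n} (g : Vec ℕ (2 + n) → ℕ) (h : Vec ℕ (2 + (n + 2)) → ℕ) hℓ hr m p ns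
  (a a′ : Acc _<_ m) →
                    lenTRN g h hℓ hr m p ns a ≡ lenTRN g h hℓ hr m p ns a′
lenTRN-irrelevant g h hℓ hr 0 p ns _ _ = refl
lenTRN-irrelevant g h hℓ hr 1 p ns _ _ = refl
lenTRN-irrelevant g h hℓ hr m@(suc (suc k)) p ns (acc rs) (acc rs′) =
  cong₂ (λ a b → h (m ∷ p ∷ ns ++ a ∷ b ∷ []))
    (lenTRN-irrelevant g h hℓ hr ⌊ m /2⌋ _ ns _ _) (lenTRN-irrelevant g h hℓ hr ⌈ m /2⌉ _ ns _ _)

module _ {n : ℕ} (lhℓ lhr : Vec ℕ 1 → ℕ) (lf : Vec ℕ (2 + n) → ℕ)
         (g : Vec ℕ (2 + n) → Bits (Atom (2 + n)))
         (h : Vec ℕ (2 + (n + 2)) → Bits (Atom (2 + (n + 2))))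
         (hℓ hr : Vec ℕ 1 → Bits (Atom 1)) where

  private
    bits : (m p : ℕ) (ns : Vec ℕ n) → Acc _<_ m → Bits (Atom (2 + n))
    bits = bitsTRN lhℓ lhr lf g h hℓ hr

    bx bz : Bits (Atom (2 + n))
    bx = varBits zero
    bz = varBits (suc zero)

  pointwise-refl : ∀ {k} {bs : Vec (Bits V) k} → Pointwise _≗ᵇ_ bs bs
  pointwise-refl = Pointwise.refl (λ _ → refl)

  bitsTRN-irrelevant : ∀ m p ns a a′ → bits m p ns a ≗ᵇ bits m p ns a′
  bitsTRN-irrelevant 0 p ns _ _ i = refl
  bitsTRN-irrelevant 1 p ns _ _ i = refl
  bitsTRN-irrelevant m@(suc (suc k)) p ns (acc rs) (acc rs′) i =
    []-ext′ {bs = bx ∷ bz ∷ varsBits 2 ++ _ ∷ _ ∷ []}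
      ((λ _ → refl) ∷ (λ _ → refl) ∷ ++⁺ pointwise-refl
        ((λ i′ → cong (_[ bx ∷ (λ j → hℓ (p ∷ []) j [ bz ∷ [] ]ᵖ) ∷ varsBits 2 ]ᵖ)
                   (bitsTRN-irrelevant ⌊ m /2⌋ (lhℓ (p ∷ [])) ns _ _ i′))
         ∷ (λ i′ → cong (_[ (λ j → bx (j + ⌊ m /2⌋)) ∷ (λ j → hr (p ∷ []) j [ bz ∷ [] ]ᵖ) ∷ varsBits 2 ]ᵖ)
                   (bitsTRN-irrelevant ⌈ m /2⌉ (lhr (p ∷ [])) ns _ _ i′))
         ∷ []))
      (h (m ∷ p ∷ ns ++ lf (⌊ m /2⌋ ∷ lhℓ (p ∷ []) ∷ ns) ∷ lf (⌈ m /2⌉ ∷ lhr (p ∷ []) ∷ ns) ∷ []) i)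

  module _ (lg : Vec ℕ (2 + n) → ℕ) (lh : Vec ℕ (2 + (n + 2)) → ℕ)
           (lf≡ : ∀ m p ns a → lf (m ∷ p ∷ ns) ≡ lenTRN lg lh lhℓ lhr m p ns a)
           (g-scoped : ∀ ms → Scoped ms (lg ms) (g ms)) (h-scoped : ∀ ms → Scoped ms (lh ms) (h ms))
           (hℓ-scoped : ∀ ms → Scoped ms (lhℓ ms) (hℓ ms)) (hr-scoped : ∀ ms → Scoped ms (lhr ms) (hr ms))
             where

    bitsTRN-scoped : ∀ m p ns a → Scoped (m ∷ p ∷ ns) (lf (m ∷ p ∷ ns)) (bits m p ns a)
    bitsTRN-scoped 0 p ns a i 1≤i i≤ = g-scoped _ i 1≤i (≤-trans i≤ (≤-reflexive (lf≡ 0 p ns a)))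
    bitsTRN-scoped 1 p ns a i 1≤i i≤ = g-scoped _ i 1≤i (≤-trans i≤ (≤-reflexive (lf≡ 1 p ns a)))
    bitsTRN-scoped m@(suc (suc k)) p ns (acc rs) i 1≤i i≤ =
      []-scoped (h-scoped (m ∷ p ∷ ns ++ lf (mℓ ∷ pℓ ∷ ns) ∷ lf (mr ∷ pr ∷ ns) ∷ []) i 1≤i
                  (≤-trans i≤ (≤-reflexive len≡)))
        (((λ i 1≤i i≤ → atom (1≤i , i≤)) ∷ (λ i 1≤i i≤ → atom (1≤i , i≤)) ∷
          ++⁺ vars-scoped
            ((λ i′ 1≤i′ i′≤ → []-scoped (bitsTRN-scoped mℓ pℓ ns _ i′ 1≤i′ i′≤)
               ((λ i 1≤i i≤ → atom (1≤i , ≤-trans i≤ (⌊n/2⌋≤n m)))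
                ∷ z-scoped hℓ hℓ-scoped ∷ vars-scoped))
             ∷ (λ i′ 1≤i′ i′≤ → []-scoped (bitsTRN-scoped mr pr ns _ i′ 1≤i′ i′≤)
               ((λ j 1≤j j≤ → atom (≤-trans 1≤j (m≤m+n j _) , half-range m j≤))
                ∷ z-scoped hr hr-scoped ∷ vars-scoped))
             ∷ [])))
      where
      mℓ = ⌊ m /2⌋
      mr = ⌈ m /2⌉
      pℓ = lhℓ (p ∷ [])
      pr = lhr (p ∷ [])
      len≡ : lf (m ∷ p ∷ ns) ≡ lh (m ∷ p ∷ ns ++ lf (mℓ ∷ pℓ ∷ ns) ∷ lf (mr ∷ pr ∷ ns) ∷ [])
      len≡ = trans (lf≡ m p ns (acc rs))
        (cong₂ (λ a b → lh (m ∷ p ∷ ns ++ a ∷ b ∷ [])) (sym (lf≡ mℓ pℓ ns _)) (sym (lf≡ mr pr ns _)))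
      vars-scoped : Pointwise (Scoped (m ∷ p ∷ ns)) ns (varsBits 2)
      vars-scoped = pointwise-tabulate ns (λ j i 1≤i i≤ → atom (1≤i , i≤))
      z-scoped : ∀ {l : Vec ℕ 1 → ℕ} (b : Vec ℕ 1 → Bits (Atom 1)) → (∀ ms → Scoped ms (l ms) (b ms)) →
                 Scoped (m ∷ p ∷ ns) (l (p ∷ [])) (λ j → b (p ∷ []) j [ bz ∷ [] ]ᵖ)
      z-scoped b b-scoped j 1≤j j≤ = []-scoped (b-scoped (p ∷ []) j 1≤j j≤) ((λ i 1≤i i≤ → atom (1≤i , i≤))
        ∷ [])

lenˢ-TRN : ∀ {n} (g : Symbol (2 + n)) h hℓ hr {e eℓ er} m p ns a →
           lenˢ (TRN g h hℓ hr e eℓ er) (m ∷ p ∷ ns) ≡ lenTRN (lenˢ g) (lenˢ h) (lenˢ hℓ) (lenˢ hr) m p ns a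
lenˢ-TRN g h hℓ hr m p ns a = lenTRN-irrelevant _ _ _ _ m p ns _ a

-- Scopes

mutual

  bitˢ-scoped : ∀ (f : Symbol k) ms → Scoped ms (lenˢ f ms) (bitˢ f ms)
  bitˢ-scoped `ε    [] i 1≤i i≤ = ⊥
  bitˢ-scoped `0    [] i 1≤i i≤ = ⊥
  bitˢ-scoped `1    [] i 1≤i i≤ = ⊤
  bitˢ-scoped `zero ms i 1≤i i≤ = ⊥
  bitˢ-scoped `one  ms i 1≤i i≤ = ⊤
  bitˢ-scoped `lh (m ∷ []) i 1≤i i≤ = atom (1≤i , ≤-trans i≤ (⌊n/2⌋≤n m))
  bitˢ-scoped `rh (m ∷ []) i 1≤i i≤ = atom (≤-trans 1≤i (m≤m+n i _) , half-range m i≤)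
  bitˢ-scoped `· ms@(m ∷ n ∷ []) i 1≤i i≤ = catBits-elim (AllAtoms (InRange ms)) m (varBits zero)
    (varBits (suc zero)) i
    (λ i≤m → atom (1≤i , i≤m)) (λ m<i → atom (m<n⇒0<n∸m m<i , m≤n+o⇒m∸n≤o i m i≤))
  bitˢ-scoped `▷ (n ∷ m ∷ []) i 1≤i i≤ = atom (≤-trans 1≤i (m≤m+n i _) , i+n≤m n 1≤i i≤)
  bitˢ-scoped `◁ (m ∷ n ∷ []) i 1≤i i≤ = atom (1≤i , ≤-trans i≤ (m∸n≤m m n))
  bitˢ-scoped `cond (0 ∷ n ∷ p₀ ∷ p₁ ∷ []) i 1≤i i≤ = atom (1≤i , i≤)
  bitˢ-scoped `cond ms@(suc m ∷ n ∷ p₀ ∷ p₁ ∷ []) i 1≤i i≤ =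
    (¬ last ∧ catBits-elim (AllAtoms (InRange ms)) (p₁ ∸ p₀) ⊥s (varBits (suc (suc zero))) i (λ _ → ⊥)
               (λ lt → atom (m<n⇒0<n∸m lt , ≤⊔⇒∸∸≤ p₀ p₁ i≤)))
    ∨ (last ∧ catBits-elim (AllAtoms (InRange ms)) (p₀ ∸ p₁) ⊥s (varBits (suc (suc (suc zero)))) i (λ _ → ⊥)
               (λ lt → atom (m<n⇒0<n∸m lt , ≤⊔⇒∸∸≤ p₁ p₀ (≤-trans i≤ (≤-reflexive (⊔-comm p₀ p₁))))))
    where
    last : AllAtoms (InRange ms) (varBits zero (suc m))
    last = atom (s≤s z≤n , ≤-refl)
  bitˢ-scoped (lam t) ms = bitᵗ-scoped t ms
  bitˢ-scoped (ℓCRN h) (m ∷ ns) i 1≤i i≤ =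
    []-scoped (firstBit-scoped h ms′)
      ((λ j 1≤j j≤ → atom (shift-range 1≤i i≤ 1≤j j≤)) ∷ pointwise-tabulate ns
        (λ j i 1≤i i≤ → atom (1≤i , i≤)))
    where ms′ = (m ∸ i + 1) ∷ ns
  bitˢ-scoped (rCRN h) (m ∷ ns) i 1≤i i≤ =
    mapAtoms (λ {a} → widen {a}) (lastBit-scoped h (i ∷ ns))
    where
    widen : ∀ {a} → InRange (i ∷ ns) a → InRange (m ∷ ns) a
    widen {zero  , _} (1≤j , j≤) = 1≤j , ≤-trans j≤ i≤
    widen {suc _ , _} r          = r
  bitˢ-scoped (TRN g h hℓ hr e eℓ er) (m ∷ p ∷ ns) =
    bitsTRN-scoped _ _ _ (bitˢ g) (bitˢ h) (bitˢ hℓ) (bitˢ hr) (lenˢ g) (lenˢ h)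
      (lenˢ-TRN g h hℓ hr {e} {eℓ} {er}) (bitˢ-scoped g) (bitˢ-scoped h) (bitˢ-scoped hℓ) (bitˢ-scoped hr)
        m p ns _

  firstBit-scoped : ∀ (h : Symbol k) ms → AllAtoms (InRange ms) (catBits (lenˢ h ms) (bitˢ h ms) ⊥s 1)
  firstBit-scoped h ms = catBits-elim (AllAtoms (InRange ms)) (lenˢ h ms) (bitˢ h ms) ⊥s 1
    (λ 1≤len → bitˢ-scoped h ms 1 ≤-refl 1≤len) (λ _ → ⊥)

  lastBit-scoped : ∀ (h : Symbol k) ms → AllAtoms (InRange ms) (catBits 1 ⊥s (bitˢ h ms) (suc (lenˢ h ms)))
  lastBit-scoped h ms = catBits-elim (AllAtoms (InRange ms)) 1 ⊥s (bitˢ h ms) (suc (lenˢ h ms))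
    (λ _ → ⊥) (λ lt → bitˢ-scoped h ms _ (s≤s⁻¹ lt) ≤-refl)

  bitᵗ-scoped : ∀ (t : Term n) ms → Scoped ms (lenᵗ t ms) (bitᵗ t ms)
  bitᵗ-scoped (var j)    ms i 1≤i i≤ = atom (1≤i , i≤)
  bitᵗ-scoped (f ⟨ ts ⟩) ms i 1≤i i≤ = []-scoped (bitˢ-scoped f _ i 1≤i i≤) (bitᵗˢ-scoped ts ms)

  bitᵗˢ-scoped : ∀ (ts : Vec (Term n) k) ms → Pointwise (Scoped ms) (lenᵗˢ ts ms) (bitᵗˢ ts ms)
  bitᵗˢ-scoped []       ms = []
  bitᵗˢ-scoped (t ∷ ts) ms = bitᵗ-scoped t ms ∷ bitᵗˢ-scoped ts ms

⋀-atoms : ∀ {P : V → Set} φ k → (∀ i → i < k → AllAtoms P (φ i)) → AllAtoms P (⋀ (applyUpTo φ k))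
⋀-atoms φ zero    p = ⊤
⋀-atoms φ (suc k) p = p 0 (s≤s z≤n) ∧ ⋀-atoms (φ ∘ suc) k (λ i i<k → p (suc i) (s≤s i<k))

≟-elim : ∀ {A : Set} (P : A → Set) m n {x y} → (m ≡ n → P x) → (m ≢ n → P y) →
  P (if does (m ≟ n) then x else y)
≟-elim P m n px py with m ≡ᵇ n in e
... | true  = px (≡ᵇ⇒≡ m n (≡.subst T (sym e) _))
... | false = py (λ m≡n → ≡.subst T e (≡⇒≡ᵇ m n m≡n))

bitwise : Term n → Term n → Vec ℕ n → ℕ → Form (Atom n)
bitwise t u ms i = bitᵗ t ms (suc i) ⇔ bitᵗ u ms (suc i)

⟦≐⟧-elim : ∀ {t u : Term n} {ms} (P : Form (Atom n) → Set) →
           (lenᵗ t ms ≡ lenᵗ u ms → P (⋀ (applyUpTo (bitwise t u ms) (lenᵗ t ms)))) →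
           (lenᵗ t ms ≢ lenᵗ u ms → P ⊥) → P (⟦ t ≐ u ⟧ ms)
⟦≐⟧-elim {t = t} {u} {ms} P = ≟-elim P (lenᵗ t ms) (lenᵗ u ms)

⟦⟧-scoped : ∀ (A : Formula n) ms → AllAtoms (InRange ms) (⟦ A ⟧ ms)
⟦⟧-scoped (t ≐ u) ms = ⟦≐⟧-elim {t = t} {u} (AllAtoms (InRange ms))
  (λ e → ⋀-atoms _ (lenᵗ t ms) λ i i< →
           bitᵗ-scoped t ms (suc i) (s≤s z≤n) i< ⇔
           bitᵗ-scoped u ms (suc i) (s≤s z≤n) (≤-trans i< (≤-reflexive e)))
  (λ _ → ⊥)
⟦⟧-scoped (¬ A)   ms = ¬ ⟦⟧-scoped A ms
⟦⟧-scoped (A ∧ B) ms = ⟦⟧-scoped A ms ∧ ⟦⟧-scoped B ms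
⟦⟧-scoped (A ∨ B) ms = ⟦⟧-scoped A ms ∨ ⟦⟧-scoped B ms
⟦⟧-scoped (A ⇒ B) ms = ⟦⟧-scoped A ms ⇒ ⟦⟧-scoped B ms
⟦⟧-scoped (A ⇔ B) ms = ⟦⟧-scoped A ms ⇔ ⟦⟧-scoped B ms

-- Translation of substitution instances

lookup-lenᵗˢ : ∀ (ts : Vec (Term n) k) ms j → lookup (lenᵗˢ ts ms) j ≡ lenᵗ (lookup ts j) ms
lookup-lenᵗˢ (t ∷ ts) ms zero    = refl
lookup-lenᵗˢ (t ∷ ts) ms (suc j) = lookup-lenᵗˢ ts ms j

lookup-bitᵗˢ : ∀ (ts : Vec (Term n) k) ms j → lookup (bitᵗˢ ts ms) j ≡ bitᵗ (lookup ts j) ms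
lookup-bitᵗˢ (t ∷ ts) ms zero    = refl
lookup-bitᵗˢ (t ∷ ts) ms (suc j) = lookup-bitᵗˢ ts ms j

module _ (σ : Vec (Term k) n) (ms : Vec ℕ k) where

  mutual

    lenᵗ-subst : ∀ t → lenᵗ (substᵗ t σ) ms ≡ lenᵗ t (lenᵗˢ σ ms)
    lenᵗ-subst (var j)    = sym (lookup-lenᵗˢ σ ms j)
    lenᵗ-subst (f ⟨ ts ⟩) = cong (lenˢ f) (lenᵗˢ-subst ts)

    lenᵗˢ-subst : ∀ (ts : Vec (Term n) l) → lenᵗˢ (substᵗˢ ts σ) ms ≡ lenᵗˢ ts (lenᵗˢ σ ms)
    lenᵗˢ-subst []       = refl
    lenᵗˢ-subst (t ∷ ts) = cong₂ _∷_ (lenᵗ-subst t) (lenᵗˢ-subst ts)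

  mutual

    bitᵗ-subst : ∀ t i → bitᵗ (substᵗ t σ) ms i ≡ bitᵗ t (lenᵗˢ σ ms) i [ bitᵗˢ σ ms ]ᵖ
    bitᵗ-subst (var j)    i = cong (λ b → b i) (sym (lookup-bitᵗˢ σ ms j))
    bitᵗ-subst (f ⟨ ts ⟩) i = begin
      bitˢ f (lenᵗˢ (substᵗˢ ts σ) ms) i [ bitᵗˢ (substᵗˢ ts σ) ms ]ᵖ
        ≡⟨ cong (λ ls → bitˢ f ls i [ bitᵗˢ (substᵗˢ ts σ) ms ]ᵖ) (lenᵗˢ-subst ts) ⟩
      bitˢ f (lenᵗˢ ts (lenᵗˢ σ ms)) i [ bitᵗˢ (substᵗˢ ts σ) ms ]ᵖ
        ≡⟨ sub-ext′ (λ (j , i) → bitᵗˢ-subst ts j i) (bitˢ f (lenᵗˢ ts (lenᵗˢ σ ms)) i) ⟩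
      subᵖ (λ (j , i) → lookup (bitᵗˢ ts (lenᵗˢ σ ms)) j i [ bitᵗˢ σ ms ]ᵖ) (bitˢ f (lenᵗˢ ts (lenᵗˢ σ ms))
        i)
        ≡⟨ sub-sub _ _ (bitˢ f (lenᵗˢ ts (lenᵗˢ σ ms)) i) ⟨
      bitˢ f (lenᵗˢ ts (lenᵗˢ σ ms)) i [ bitᵗˢ ts (lenᵗˢ σ ms) ]ᵖ [ bitᵗˢ σ ms ]ᵖ ∎
      where open ≡-Reasoning

    bitᵗˢ-subst : ∀ (ts : Vec (Term n) l) j i →
                  lookup (bitᵗˢ (substᵗˢ ts σ) ms) j i ≡ lookup (bitᵗˢ ts (lenᵗˢ σ ms)) j i [ bitᵗˢ σ ms ]ᵖ
    bitᵗˢ-subst (t ∷ ts) zero    i = bitᵗ-subst t i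
    bitᵗˢ-subst (t ∷ ts) (suc j) i = bitᵗˢ-subst ts j i

⋀-cong : ∀ {φ ψ : ℕ → Form V} k → (∀ i → i < k → φ i ≡ ψ i) → ⋀ (applyUpTo φ k) ≡ ⋀ (applyUpTo ψ k)
⋀-cong zero    e = refl
⋀-cong (suc k) e = cong₂ _∧_ (e 0 (s≤s z≤n)) (⋀-cong k (λ i i<k → e (suc i) (s≤s i<k)))

sub-⋀ : ∀ (σ : V → Form W) φ k → subᵖ σ (⋀ (applyUpTo φ k)) ≡ ⋀ (applyUpTo (subᵖ σ ∘ φ) k)
sub-⋀ σ φ zero    = refl
sub-⋀ σ φ (suc k) = cong (subᵖ σ (φ 0) ∧_) (sub-⋀ σ (φ ∘ suc) k)

module _ (σ : Vec (Term k) n) (ms : Vec ℕ k) where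

  -- An identity of formulas, not just an equivalence, because term formulas are themselves built by
  -- substitution. The substitution rule thus costs no propositional reasoning.
  ⟦subst⟧ : ∀ A → ⟦ subst A σ ⟧ ms ≡ ⟦ A ⟧ (lenᵗˢ σ ms) [ bitᵗˢ σ ms ]ᵖ
  ⟦subst⟧ (t ≐ u) = begin
    ⟦ subst (t ≐ u) σ ⟧ ms
      ≡⟨ cong₂ (λ L L′ → if does (L ≟ L′) then ⋀ (applyUpTo φ L) else ⊥) (lenᵗ-subst σ ms t)
        (lenᵗ-subst σ ms u) ⟩
    (if does (L ≟ L′) then ⋀ (applyUpTo φ L) else ⊥)
      ≡⟨ cong (if does (L ≟ L′) then_else ⊥)
           (trans (⋀-cong L (λ i _ → cong₂ _⇔_ (bitᵗ-subst σ ms t (suc i)) (bitᵗ-subst σ ms u (suc i))))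
                  (sym (sub-⋀ _ _ L))) ⟩
    (if does (L ≟ L′) then ⋀ (applyUpTo (bitwise t u ls) L) [ bitᵗˢ σ ms ]ᵖ else ⊥)
      ≡⟨ if-float (_[ bitᵗˢ σ ms ]ᵖ) (does (L ≟ L′)) ⟨
    ⟦ t ≐ u ⟧ ls [ bitᵗˢ σ ms ]ᵖ ∎
    where
    open ≡-Reasoning
    ls = lenᵗˢ σ ms
    L = lenᵗ t ls
    L′ = lenᵗ u ls
    φ = bitwise (substᵗ t σ) (substᵗ u σ) ms
  ⟦subst⟧ (¬ A)   = cong ¬_ (⟦subst⟧ A)
  ⟦subst⟧ (A ∧ B) = cong₂ _∧_ (⟦subst⟧ A) (⟦subst⟧ B)
  ⟦subst⟧ (A ∨ B) = cong₂ _∨_ (⟦subst⟧ A) (⟦subst⟧ B)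
  ⟦subst⟧ (A ⇒ B) = cong₂ _⇒_ (⟦subst⟧ A) (⟦subst⟧ B)
  ⟦subst⟧ (A ⇔ B) = cong₂ _⇔_ (⟦subst⟧ A) (⟦subst⟧ B)

-- Symbols of rank 0: linear length and bits of bounded size

⊔≡0⇒ : ∀ a b → a ⊔ b ≡ 0 → a ≡ 0 × b ≡ 0
⊔≡0⇒ a b e = n≤0⇒n≡0 (≤-trans (m≤m⊔n a b) (≤-reflexive e)) , n≤0⇒n≡0 (≤-trans (m≤n⊔m a b) (≤-reflexive e))

mutual

  -- Rank 0 excludes `TRN`, concatenation recursion preserves the length of its first argument, and
  -- linear bounds compose.
  lenˢ-linear : ∀ (f : Symbol k) → rank f ≡ 0 → Σ[ c ∈ ℕ ] ∀ ms → lenˢ f ms ≤ c * suc (Vec.sum ms)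
  lenˢ-linear `ε    _ = 0 , λ { [] → z≤n }
  lenˢ-linear `0    _ = 1 , λ { [] → ≤-refl }
  lenˢ-linear `1    _ = 1 , λ { [] → ≤-refl }
  lenˢ-linear `zero _ = 1 , λ { (m ∷ []) → ≤-trans (m≤m+n m 0) (≤-trans (n≤1+n _) (m≤m+n _ 0)) }
  lenˢ-linear `one  _ = 1 , λ { (m ∷ []) → ≤-trans (m≤m+n m 0) (≤-trans (n≤1+n _) (m≤m+n _ 0)) }
  lenˢ-linear `lh   _ = 1 , λ { (m ∷ []) → ≤-trans (⌊n/2⌋≤n m)
    (≤-trans (m≤m+n m 0) (≤-trans (n≤1+n _) (m≤m+n _ 0))) }
  lenˢ-linear `rh   _ = 1 , λ { (m ∷ []) → ≤-trans (⌈n/2⌉≤n m)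
    (≤-trans (m≤m+n m 0) (≤-trans (n≤1+n _) (m≤m+n _ 0))) }
  lenˢ-linear `·    _ = 1 , λ { (m ∷ n ∷ []) → ≤-trans (+-monoʳ-≤ m (m≤m+n n 0))
    (≤-trans (n≤1+n _) (m≤m+n _ 0)) }
  lenˢ-linear `▷    _ = 1 , λ { (n ∷ m ∷ []) → ≤-trans (m∸n≤m m n)
    (≤-trans (≤-trans (m≤m+n m 0) (m≤n+m _ n)) (≤-trans (n≤1+n _) (m≤m+n _ 0))) }
  lenˢ-linear `◁    _ = 1 , λ { (m ∷ n ∷ []) → ≤-trans (m∸n≤m m n)
    (≤-trans (m≤m+n m _) (≤-trans (n≤1+n _) (m≤m+n _ 0))) }
  lenˢ-linear `cond _ = 1 , λ
    { (0 ∷ n ∷ p₀ ∷ p₁ ∷ []) → ≤-trans (m≤m+n n _) (≤-trans (n≤1+n _) (m≤m+n _ 0))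
    ; (suc m ∷ n ∷ p₀ ∷ p₁ ∷ []) →
        ≤-trans (m⊔n≤m+n p₀ p₁)
        (≤-trans (+-monoʳ-≤ p₀ (m≤m+n p₁ 0))
        (≤-trans (≤-trans (m≤n+m _ n) (m≤n+m _ (suc m))) (≤-trans (n≤1+n _) (m≤m+n _ 0)))) }
  lenˢ-linear (lam t)  r = lenᵗ-linear t r
  lenˢ-linear (ℓCRN h) r = 1 , λ { (m ∷ ns) → ≤-trans (m≤m+n m _) (≤-trans (n≤1+n _) (m≤m+n _ 0)) }
  lenˢ-linear (rCRN h) r = 1 , λ { (m ∷ ns) → ≤-trans (m≤m+n m _) (≤-trans (n≤1+n _) (m≤m+n _ 0)) }

  lenᵗ-linear : ∀ (t : Term n) → rankᵗ t ≡ 0 → Σ[ c ∈ ℕ ] ∀ ms → lenᵗ t ms ≤ c * suc (Vec.sum ms)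
  lenᵗ-linear (var j)    _ = 1 , λ ms → ≤-trans (lookup≤sum ms j) (≤-trans (n≤1+n _) (m≤m+n _ 0))
  lenᵗ-linear (f ⟨ ts ⟩) r with ⊔≡0⇒ (rank f) (rankᵗˢ ts) r
  ... | rf , rts with lenˢ-linear f rf | lenᵗˢ-linear ts rts
  ... | c , len-f | d , len-ts = c * suc d , λ ms → begin
    lenˢ f (lenᵗˢ ts ms)              ≤⟨ len-f (lenᵗˢ ts ms) ⟩
    c * suc (Vec.sum (lenᵗˢ ts ms))   ≤⟨ *-monoʳ-≤ c (+-mono-≤ {1} (s≤s z≤n) (len-ts ms)) ⟩
    c * (suc d * suc (Vec.sum ms))    ≡⟨ *-assoc c (suc d) _ ⟨
    c * suc d * suc (Vec.sum ms)      ∎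
    where open ≤-Reasoning

  lenᵗˢ-linear : ∀ (ts : Vec (Term n) k) → rankᵗˢ ts ≡ 0 →
                 Σ[ c ∈ ℕ ] ∀ ms → Vec.sum (lenᵗˢ ts ms) ≤ c * suc (Vec.sum ms)
  lenᵗˢ-linear []       _ = 0 , λ _ → z≤n
  lenᵗˢ-linear (t ∷ ts) r with ⊔≡0⇒ (rankᵗ t) (rankᵗˢ ts) r
  ... | rt , rts with lenᵗ-linear t rt | lenᵗˢ-linear ts rts
  ... | c , len-t | d , len-ts = c + d , λ ms →
    ≤-trans (+-mono-≤ (len-t ms) (len-ts ms)) (≤-reflexive (sym (*-distribʳ-+ _ c d)))

varsBits-size : ∀ k (j : Fin n) i → size (lookup (varsBits k) j i) ≤ 1
varsBits-size {n} k j i = ≤-reflexive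
  (cong (λ b → size (b i)) (lookup∘tabulate {n = n} (λ j → varBits (k ↑ʳ j)) j))

mutual

  -- A bit of `ℓCRN` or `rCRN` applies `h` once, to a suffix or prefix, and does not refer to the
  -- other bits of the value; so at rank 0 the size depends on the symbol alone, even out of range.
  bitˢ-bounded : ∀ (f : Symbol k) → rank f ≡ 0 → Σ[ c ∈ ℕ ] ∀ ms i → size (bitˢ f ms i) ≤ c
  bitˢ-bounded `ε    _ = 1 , λ _ _ → ≤-refl
  bitˢ-bounded `0    _ = 1 , λ _ _ → ≤-refl
  bitˢ-bounded `1    _ = 1 , λ _ _ → ≤-refl
  bitˢ-bounded `zero _ = 1 , λ _ _ → ≤-refl
  bitˢ-bounded `one  _ = 1 , λ _ _ → ≤-refl
  bitˢ-bounded `lh   _ = 1 , λ _ _ → ≤-refl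
  bitˢ-bounded `rh   _ = 1 , λ { (m ∷ []) _ → ≤-refl }
  bitˢ-bounded `·    _ = 1 , λ { (m ∷ n ∷ []) i →
    catBits-elim (λ A → size A ≤ 1) m (varBits zero) (varBits (suc zero)) i (λ _ → ≤-refl) (λ _ → ≤-refl) }
  bitˢ-bounded `▷    _ = 1 , λ { (n ∷ m ∷ []) _ → ≤-refl }
  bitˢ-bounded `◁    _ = 1 , λ _ _ → ≤-refl
  -- The formula `(¬ a ∧ b) ∨ (a ∧ c)` has eight symbols.
  bitˢ-bounded `cond _ = 8 , λ
    { (0 ∷ _) _ → s≤s z≤n
    ; (suc m ∷ n ∷ p₀ ∷ p₁ ∷ []) i → +-monoʳ-≤ 1 (+-mono-≤
        (+-monoʳ-≤ 3 (catBits-elim (λ A → size A ≤ 1) (p₁ ∸ p₀) ⊥s (varBits (suc (suc zero))) i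
          (λ _ → ≤-refl) (λ _ → ≤-refl)))
        (+-monoʳ-≤ 2 (catBits-elim (λ A → size A ≤ 1) (p₀ ∸ p₁) ⊥s (varBits (suc (suc (suc zero)))) i
          (λ _ → ≤-refl) (λ _ → ≤-refl)))) }
  bitˢ-bounded (lam t)  r = bitᵗ-bounded t r
  bitˢ-bounded (ℓCRN h) r with bitˢ-bounded h r
  -- The `suc` leaves room for the `⊥` contributed by the appended 0, and the factor 1 is the size
  -- of the substituted atoms.
  ... | c , bit-h = suc c * 1 , λ { (m ∷ ns) i →
    let ms′ = (m ∸ i + 1) ∷ ns
        bs = (λ j → varBits zero (j + i ∸ 1)) ∷ varsBits 1
    in ≤-trans (size-sub {σ = λ (j , i) → lookup bs j i} ≤-refl
                 (allAtoms (λ { (zero , _) → ≤-refl ; (suc j , i) → varsBits-size 1 j i })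
                           (catBits (lenˢ h ms′) (bitˢ h ms′) ⊥s 1)))
               (*-monoˡ-≤ 1 (catBits-elim (λ A → size A ≤ suc c) (lenˢ h ms′) (bitˢ h ms′) ⊥s 1
                 (λ _ → ≤-trans (bit-h ms′ 1) (n≤1+n c)) (λ _ → s≤s z≤n))) }
  bitˢ-bounded (rCRN h) r with bitˢ-bounded h r
  ... | c , bit-h = suc c , λ { (m ∷ ns) i →
    catBits-elim (λ A → size A ≤ suc c) 1 ⊥s (bitˢ h (i ∷ ns)) _
      (λ _ → s≤s z≤n) (λ _ → ≤-trans (bit-h _ _) (n≤1+n c)) }

  bitᵗ-bounded : ∀ (t : Term n) → rankᵗ t ≡ 0 → Σ[ c ∈ ℕ ] ∀ ms i → size (bitᵗ t ms i) ≤ c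
  bitᵗ-bounded (var j)    _ = 1 , λ _ _ → ≤-refl
  bitᵗ-bounded (f ⟨ ts ⟩) r with ⊔≡0⇒ (rank f) (rankᵗˢ ts) r
  ... | rf , rts with bitˢ-bounded f rf | bitᵗˢ-bounded ts rts
  ... | c , bit-f | d , bit-ts = c * suc d , λ ms i →
    ≤-trans (size-sub (s≤s z≤n) (allAtoms (λ (j , i) → bit-ts ms j i) (bitˢ f _ i)))
      (*-monoˡ-≤ (suc d) (bit-f _ i))

  bitᵗˢ-bounded : ∀ (ts : Vec (Term n) k) → rankᵗˢ ts ≡ 0 →
                  Σ[ c ∈ ℕ ] ∀ ms j i → size (lookup (bitᵗˢ ts ms) j i) ≤ suc c
  bitᵗˢ-bounded []       _ = 0 , λ _ ()
  bitᵗˢ-bounded (t ∷ ts) r with ⊔≡0⇒ (rankᵗ t) (rankᵗˢ ts) r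
  ... | rt , rts with bitᵗ-bounded t rt | bitᵗˢ-bounded ts rts
  ... | c , bit-t | d , bit-ts = c + d , λ
    { ms zero    i → ≤-trans (bit-t ms i) (≤-trans (m≤m+n c d) (n≤1+n _))
    ; ms (suc j) i → ≤-trans (bit-ts ms j i) (s≤s (m≤n+m d c)) }

-- Arbitrary symbols: polynomial length

lenˢ-TRN-step : ∀ {n} (g : Symbol (2 + n)) h hℓ hr {e eℓ er} k p ns →
  let f = TRN g h hℓ hr e eℓ er ; m = 2 + k in
  lenˢ f (m ∷ p ∷ ns) ≡ lenˢ h (m ∷ p ∷ ns ++ lenˢ f (⌊ m /2⌋ ∷ lenˢ hℓ (p ∷ []) ∷ ns)
                                            ∷ lenˢ f (⌈ m /2⌉ ∷ lenˢ hr (p ∷ []) ∷ ns) ∷ [])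
lenˢ-TRN-step g h hℓ hr {e} {eℓ} {er} k p ns =
  cong₂ (λ a b → lenˢ h (2 + k ∷ p ∷ ns ++ a ∷ b ∷ []))
    (sym (lenˢ-TRN g h hℓ hr {e} {eℓ} {er} ⌊ 2 + k /2⌋ _ ns _))
    (sym (lenˢ-TRN g h hℓ hr {e} {eℓ} {er} ⌈ 2 + k /2⌉ _ ns _))

linear₁ : ∀ {f : Vec ℕ 1 → ℕ} {c c′} → (∀ ms → f ms ≤ c * suc (Vec.sum ms)) → c ≤ c′ → ∀ p →
  f (p ∷ []) ≤ c′ * suc p
linear₁ f≤ c≤ p = ≤-trans (f≤ (p ∷ [])) (*-mono-≤ c≤ (s≤s (≤-reflexive (+-identityʳ p))))

m*b≤b^[1+m] : ∀ {b} → 2 ≤ b → ∀ m → m * b ≤ b ^ suc m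
m*b≤b^[1+m] {b} 2≤b m = ≤-trans (*-monoˡ-≤ b (≤-base^ 2≤b m)) (≤-reflexive (*-comm (b ^ m) b))

mutual

  lenˢ-PB : (f : Symbol k) → PolyBounded (lenˢ f)
  lenˢ-PB `ε    = linear-PB (lenˢ-linear `ε refl)
  lenˢ-PB `0    = linear-PB (lenˢ-linear `0 refl)
  lenˢ-PB `1    = linear-PB (lenˢ-linear `1 refl)
  lenˢ-PB `zero = linear-PB (lenˢ-linear `zero refl)
  lenˢ-PB `one  = linear-PB (lenˢ-linear `one refl)
  lenˢ-PB `lh   = linear-PB (lenˢ-linear `lh refl)
  lenˢ-PB `rh   = linear-PB (lenˢ-linear `rh refl)
  lenˢ-PB `·    = linear-PB (lenˢ-linear `· refl)
  lenˢ-PB `▷    = linear-PB (lenˢ-linear `▷ refl)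
  lenˢ-PB `◁    = linear-PB (lenˢ-linear `◁ refl)
  lenˢ-PB `cond = linear-PB (lenˢ-linear `cond refl)
  lenˢ-PB (lam t)  = lenᵗ-PB t
  lenˢ-PB (ℓCRN h) = mono-PB (λ { (m ∷ ns) → m≤m+n m _ }) sum-PB
  lenˢ-PB (rCRN h) = mono-PB (λ { (m ∷ ns) → m≤m+n m _ }) sum-PB
  lenˢ-PB (TRN g h hℓ hr e eℓ er) = lenTRN-PB g h hℓ hr (lenˢ-PB g) e eℓ er

  linear-PB : {f : Vec ℕ n → ℕ} → Σ[ c ∈ ℕ ] (∀ ms → f ms ≤ c * suc (Vec.sum ms)) → PolyBounded f
  linear-PB (c , f≤) = mono-PB f≤ (const-PB c *-PB (const-PB 1 +-PB sum-PB))

  -- Since `h` has rank 0, its length is at most `c` times the sum of its argument lengths plus one.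
  -- A level therefore multiplies the two recursive lengths by `c` and adds a term linear in `N`.
  lenTRN-PB : ∀ (g : Symbol (2 + n)) h hℓ hr → PolyBounded (lenˢ g) → ∀ e eℓ er →
              PolyBounded (lenˢ (TRN g h hℓ hr e eℓ er))
  lenTRN-PB {n} g h hℓ hr (dg , len-g) e eℓ er
    with lenˢ-linear h e | lenˢ-linear hℓ eℓ | lenˢ-linear hr er
  ... | c , len-h | cℓ , len-hℓ | cr , len-hr
    -- `dg` covers the base case given by `g`, and `suc c` the local term through
    -- `c * N ≤ N ^ suc c`.
    with halvingInduction (cℓ + cr) c (dg + suc c)
  ... | d , induction = d , λ { (m ∷ p ∷ ns) → bound m p ns }
    where
    f = TRN g h hℓ hr e eℓ er
    bound : ∀ m p ns → lenˢ f (m ∷ p ∷ ns) ≤ N (m ∷ p ∷ ns) ^ d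
    bound m p ns = induction (Vec.sum ns) (λ m p b → lenˢ f (m ∷ p ∷ ns) ≤ b)
      (λ p → lenˢ hℓ (p ∷ [])) (λ p → lenˢ hr (p ∷ [])) (λ b≤ l≤ → ≤-trans l≤ b≤)
      (linear₁ len-hℓ (m≤m+n cℓ cr)) (linear₁ len-hr (m≤n+m cr cℓ))
      (λ { 0 p _ → base 0 p (len-g _) ; 1 p _ → base 1 p (len-g _) ; (suc (suc _)) p (s≤s ()) })
      step m p
      where
      open ≤-Reasoning
      base : ∀ m p {l} → l ≤ N (m ∷ p ∷ ns) ^ dg → l ≤ N (m ∷ p ∷ ns) ^ (dg + suc c)
      base m p l≤ = ≤-trans l≤ (^-monoʳ-≤ (N (m ∷ p ∷ ns)) (m≤m+n dg (suc c)))
      step : ∀ k p b₁ b₂ → let m = 2 + k in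
             lenˢ f (⌊ m /2⌋ ∷ lenˢ hℓ (p ∷ []) ∷ ns) ≤ b₁ → lenˢ f (⌈ m /2⌉ ∷ lenˢ hr (p ∷ []) ∷ ns) ≤ b₂ →
             lenˢ f (m ∷ p ∷ ns) ≤ N (m ∷ p ∷ ns) ^ (dg + suc c) + c * (b₁ + b₂)
      step k p b₁ b₂ ≤b₁ ≤b₂ = begin
        lenˢ f (μ ∷ p ∷ ns)                              ≡⟨ lenˢ-TRN-step g h hℓ hr {e} {eℓ} {er} k p ns ⟩
        lenˢ h (μ ∷ p ∷ ns ++ l₁ ∷ l₂ ∷ [])              ≤⟨ len-h (μ ∷ p ∷ ns ++ l₁ ∷ l₂ ∷ []) ⟩
        c * suc (μ + (p + Vec.sum (ns ++ l₁ ∷ l₂ ∷ []))) ≡⟨ cong (λ s → c * suc (μ + (p + s))) (sum-++ ns) ⟩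
        c * suc (μ + (p + (Vec.sum ns + (l₁ + (l₂ + 0))))) ≡⟨ cong (c *_) (rearrange μ p (Vec.sum ns) l₁
          l₂) ⟩
        c * (suc (μ + (p + Vec.sum ns)) + (l₁ + l₂))     ≤⟨ *-monoʳ-≤ c
          (+-mono-≤ (n≤1+n (suc (μ + (p + Vec.sum ns)))) (+-mono-≤ ≤b₁ ≤b₂)) ⟩
        c * (N (μ ∷ p ∷ ns) + (b₁ + b₂))                 ≡⟨ *-distribˡ-+ c (N (μ ∷ p ∷ ns)) (b₁ + b₂) ⟩
        c * N (μ ∷ p ∷ ns) + c * (b₁ + b₂)               ≤⟨ +-monoˡ-≤ (c * (b₁ + b₂))
          (≤-trans (m*b≤b^[1+m] (2≤N (μ ∷ p ∷ ns)) c)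
                                                              (^-monoʳ-≤ (N (μ ∷ p ∷ ns))
                                                                (m≤n+m (suc c) dg))) ⟩
        N (μ ∷ p ∷ ns) ^ (dg + suc c) + c * (b₁ + b₂)    ∎
        where
        μ = 2 + k
        l₁ = lenˢ f (⌊ μ /2⌋ ∷ lenˢ hℓ (p ∷ []) ∷ ns)
        l₂ = lenˢ f (⌈ μ /2⌉ ∷ lenˢ hr (p ∷ []) ∷ ns)
        rearrange : ∀ m p s l₁ l₂ → suc (m + (p + (s + (l₁ + (l₂ + 0))))) ≡ suc (m + (p + s)) + (l₁ + l₂)
        rearrange = solve-∀

  lenᵗ-PB : (t : Term n) → PolyBounded (lenᵗ t)
  lenᵗ-PB (var j)    = lookup-PB j
  lenᵗ-PB (f ⟨ ts ⟩) = ∘-PB (lenˢ-PB f) (lenᵗˢ-PB ts)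

  lenᵗˢ-PB : (ts : Vec (Term n) k) → PolyBounded (Vec.sum ∘ lenᵗˢ ts)
  lenᵗˢ-PB []       = const-PB 0
  lenᵗˢ-PB (t ∷ ts) = lenᵗ-PB t +-PB lenᵗˢ-PB ts

-- Polynomial size of the bits

-- In contrast to rank 0, the bound is claimed only in range, the sole place where the recursive
-- bits of `TRN` are known to be scoped.
SizeBound : (Vec ℕ n → ℕ) → (Vec ℕ n → Bits V) → Set
SizeBound l b = Σ[ d ∈ ℕ ] ∀ ms → Sized (N ms ^ d) (l ms) (b ms)

rank0-size : ∀ (f : Symbol k) → rank f ≡ 0 → SizeBound (lenˢ f) (bitˢ f)
rank0-size f r with bitˢ-bounded f r
... | c , b≤ = c , λ ms i _ _ → ≤-trans (b≤ ms i) (≤-base^ (2≤N ms) c)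

varsBits-sized : ∀ k {t} (ns : Vec ℕ n) → 1 ≤ t → Pointwise (Sized t) ns (varsBits k)
varsBits-sized k {t} ns 1≤t = pointwise-tabulate {R = Sized t} ns (λ _ _ _ _ → 1≤t)

Sized-≤ : ∀ {t t′ m} {b : Bits V} → t ≤ t′ → Sized t m b → Sized t′ m b
Sized-≤ t≤ s i 1≤i i≤ = ≤-trans (s i 1≤i i≤) t≤

Pointwise-Sized-≤ : ∀ {t t′} {ms : Vec ℕ n} {bs : Vec (Bits V) n} → t ≤ t′ → Pointwise (Sized t) ms bs →
  Pointwise (Sized t′) ms bs
Pointwise-Sized-≤ t≤ = Pointwise.map (λ {_} {b} → Sized-≤ {b = b} t≤)

mutual

  bitˢ-size : (f : Symbol k) → SizeBound (lenˢ f) (bitˢ f)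
  bitˢ-size `ε    = rank0-size `ε refl
  bitˢ-size `0    = rank0-size `0 refl
  bitˢ-size `1    = rank0-size `1 refl
  bitˢ-size `zero = rank0-size `zero refl
  bitˢ-size `one  = rank0-size `one refl
  bitˢ-size `lh   = rank0-size `lh refl
  bitˢ-size `rh   = rank0-size `rh refl
  bitˢ-size `·    = rank0-size `· refl
  bitˢ-size `▷    = rank0-size `▷ refl
  bitˢ-size `◁    = rank0-size `◁ refl
  bitˢ-size `cond = rank0-size `cond refl
  bitˢ-size (lam t)  = bitᵗ-size t
  bitˢ-size (ℓCRN h) with bitˢ-size h
  ... | d , bit-h = d , λ { (m ∷ ns) i 1≤i i≤ →
    let ms′ = (m ∸ i + 1) ∷ ns
        m∸i+1≤m = ≤-trans (+-monoʳ-≤ (m ∸ i) 1≤i) (≤-reflexive (m∸n+n≡m i≤))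
    in ≤-trans ([]-sized (firstBit-scoped h ms′) ≤-refl ((λ _ _ _ → ≤-refl) ∷ varsBits-sized 1 ns ≤-refl))
       (≤-trans (≤-reflexive (*-identityʳ _))
       (≤-trans (catBits-elim (λ A → size A ≤ N ms′ ^ d) (lenˢ h ms′) (bitˢ h ms′) ⊥s 1
                  (λ 1≤len → bit-h ms′ 1 ≤-refl 1≤len) (λ _ → 1≤N^ ms′ d))
                (^-monoˡ-≤ d (N-mono ns m∸i+1≤m)))) }
  bitˢ-size (rCRN h) with bitˢ-size h
  ... | d , bit-h = d , λ { (m ∷ ns) i 1≤i i≤ →
    ≤-trans (catBits-elim (λ A → size A ≤ N (i ∷ ns) ^ d) 1 ⊥s (bitˢ h (i ∷ ns)) (suc (lenˢ h (i ∷ ns)))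
              (λ _ → 1≤N^ (i ∷ ns) d) (λ lt → bit-h (i ∷ ns) _ (s≤s⁻¹ lt) ≤-refl))
            (^-monoˡ-≤ d (N-mono ns i≤)) }
  bitˢ-size (TRN g h hℓ hr e eℓ er) = bitsTRN-size g h hℓ hr (bitˢ-size g) e eℓ er

  -- A bit of `h` has bounded size, hence boundedly many atoms. Each turns at worst into a bit of a
  -- recursive value in which the atoms of z have become bits of `hℓ` or `hr`, again of bounded
  -- size. So a level costs the factor `c * (suc bℓ + suc br)`.
  bitsTRN-size : ∀ (g : Symbol (2 + n)) h hℓ hr → SizeBound (lenˢ g) (bitˢ g) → ∀ e eℓ er →
                 let f = TRN g h hℓ hr e eℓ er in SizeBound (lenˢ f) (bitˢ f)
  bitsTRN-size {n} g h hℓ hr (dg , bit-g) e eℓ er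
    with lenˢ-linear hℓ eℓ | lenˢ-linear hr er | bitˢ-bounded h e | bitˢ-bounded hℓ eℓ | bitˢ-bounded hr er
  ... | cℓ , len-hℓ | cr , len-hr | c , bit-h | bℓ , bit-hℓ | br , bit-hr
    with halvingInduction (cℓ + cr) (c * (suc bℓ + suc br)) (dg + c)
  ... | d , induction = d , λ { (m ∷ p ∷ ns) → bound m p ns _ }
    where
    f = TRN g h hℓ hr e eℓ er
    bits : (m p : ℕ) (ns : Vec ℕ n) → Acc _<_ m → Bits (Atom (2 + n))
    bits = bitsTRN (lenˢ hℓ) (lenˢ hr) (lenˢ f) (bitˢ g) (bitˢ h) (bitˢ hℓ) (bitˢ hr)
    bound : ∀ m p ns a → Sized (N (m ∷ p ∷ ns) ^ d) (lenˢ f (m ∷ p ∷ ns)) (bits m p ns a)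
    -- Quantifying over `a` inside the predicate makes the hypotheses applicable to whichever
    -- accessibility proofs the recursion passes on.
    bound m p ns = induction (Vec.sum ns) (λ m p b → ∀ a → Sized b (lenˢ f (m ∷ p ∷ ns)) (bits m p ns a))
      (λ p → lenˢ hℓ (p ∷ [])) (λ p → lenˢ hr (p ∷ [])) (λ b≤ s a → Sized-≤ b≤ (s a))
      (linear₁ len-hℓ (m≤m+n cℓ cr)) (linear₁ len-hr (m≤n+m cr cℓ))
      (λ { 0 p _ a → base 0 p (bit-g (0 ∷ p ∷ ns)) ; 1 p _ a → base 1 p (bit-g (1 ∷ p ∷ ns)) ;
        (suc (suc _)) p (s≤s ()) })
      step m p
      where
      open ≤-Reasoning
      base : ∀ m p {l} {b : Bits (Atom (2 + n))} → Sized (N (m ∷ p ∷ ns) ^ dg) l b →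
        Sized (N (m ∷ p ∷ ns) ^ (dg + c)) l b
      base m p = Sized-≤ (^-monoʳ-≤ (N (m ∷ p ∷ ns)) (m≤m+n dg c))
      step : ∀ k p b₁ b₂ → let m = 2 + k in
             (∀ a → Sized b₁ (lenˢ f (⌊ m /2⌋ ∷ lenˢ hℓ (p ∷ []) ∷ ns)) (bits ⌊ m /2⌋ (lenˢ hℓ (p ∷ [])) ns
               a)) →
             (∀ a → Sized b₂ (lenˢ f (⌈ m /2⌉ ∷ lenˢ hr (p ∷ []) ∷ ns)) (bits ⌈ m /2⌉ (lenˢ hr (p ∷ [])) ns
               a)) →
             ∀ a → Sized (N (m ∷ p ∷ ns) ^ (dg + c) + c * (suc bℓ + suc br) * (b₁ + b₂))
               (lenˢ f (m ∷ p ∷ ns)) (bits m p ns a)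
      step k p b₁ b₂ s₁ s₂ (acc rs) i 1≤i i≤ = begin
        size (bits μ p ns (acc rs) i)
          ≤⟨ []-sized (bitˢ-scoped h (μ ∷ p ∷ ns ++ lenˢ f (mℓ ∷ pℓ ∷ ns) ∷ lenˢ f (mr ∷ pr ∷ ns) ∷ []) i
            1≤i
                        (≤-trans i≤ (≤-reflexive (lenˢ-TRN-step g h hℓ hr {e} {eℓ} {er} k p ns))))
               1≤t ((λ _ _ _ → 1≤t) ∷ (λ _ _ _ → 1≤t) ∷
                    ++⁺ (varsBits-sized 2 ns 1≤t)
                      ((λ i′ 1≤i′ i′≤ → ≤-trans ([]-sized (scoped mℓ pℓ _ i′ 1≤i′ i′≤) (s≤s z≤n)
                           ((λ _ _ _ → s≤s z≤n) ∷ (λ j _ _ → z-size (bitˢ hℓ) bit-hℓ j) ∷ varsBits-sized 2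
                             ns (s≤s z≤n)))
                           (≤-trans (*-monoˡ-≤ (suc bℓ) (s₁ _ i′ 1≤i′ i′≤))
                             (≤-trans (m≤m+n (b₁ * suc bℓ) (b₂ * suc br)) (n≤1+n _))))
                       ∷ (λ i′ 1≤i′ i′≤ → ≤-trans ([]-sized (scoped mr pr _ i′ 1≤i′ i′≤) (s≤s z≤n)
                           ((λ _ _ _ → s≤s z≤n) ∷ (λ j _ _ → z-size (bitˢ hr) bit-hr j) ∷ varsBits-sized 2
                             ns (s≤s z≤n)))
                           (≤-trans (*-monoˡ-≤ (suc br) (s₂ _ i′ 1≤i′ i′≤))
                             (≤-trans (m≤n+m (b₂ * suc br) (b₁ * suc bℓ)) (n≤1+n _))))
                       ∷ [])) ⟩
        size (bitˢ h (μ ∷ p ∷ ns ++ lenˢ f (mℓ ∷ pℓ ∷ ns) ∷ lenˢ f (mr ∷ pr ∷ ns) ∷ []) i) * t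
          ≤⟨ *-monoˡ-≤ t (bit-h _ i) ⟩
        c * t
          ≤⟨ m≤m+n (c * t) (c * (b₁ * suc br + b₂ * suc bℓ)) ⟩
        c * t + c * (b₁ * suc br + b₂ * suc bℓ)
          ≡⟨ rearrange c b₁ b₂ (suc bℓ) (suc br) ⟩
        c + c * (suc bℓ + suc br) * (b₁ + b₂)
          ≤⟨ +-monoˡ-≤ _ (≤-trans (≤-base^ (2≤N (μ ∷ p ∷ ns)) c) (^-monoʳ-≤ (N (μ ∷ p ∷ ns)) (m≤n+m c dg)))
            ⟩
        N (μ ∷ p ∷ ns) ^ (dg + c) + c * (suc bℓ + suc br) * (b₁ + b₂) ∎
        where
        μ = 2 + k
        mℓ = ⌊ μ /2⌋
        mr = ⌈ μ /2⌉
        pℓ = lenˢ hℓ (p ∷ [])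
        pr = lenˢ hr (p ∷ [])
        -- Bounds everything substituted into `h`: the atoms of the variables and the bits of both
        -- recursive values.
        t = 1 + (b₁ * suc bℓ + b₂ * suc br)
        1≤t : 1 ≤ t
        1≤t = s≤s z≤n
        scoped : ∀ m p a → Scoped (m ∷ p ∷ ns) (lenˢ f (m ∷ p ∷ ns)) (bits m p ns a)
        scoped m p a = bitsTRN-scoped _ _ _ (bitˢ g) (bitˢ h) (bitˢ hℓ) (bitˢ hr) (lenˢ g) (lenˢ h)
          (lenˢ-TRN g h hℓ hr {e} {eℓ} {er}) (bitˢ-scoped g) (bitˢ-scoped h) (bitˢ-scoped hℓ)
            (bitˢ-scoped hr) m p ns a
        z-size : ∀ (b : Vec ℕ 1 → Bits (Atom 1)) {c} → (∀ ms i → size (b ms i) ≤ c) → ∀ j →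
                 size (b (p ∷ []) j [ varBits {2 + n} (suc zero) ∷ [] ]ᵖ) ≤ suc c
        z-size b b≤ j = ≤-trans (size-sub ≤-refl (allAtoms (λ { (zero , _) → ≤-refl }) (b (p ∷ []) j)))
          (≤-trans (≤-reflexive (*-identityʳ _)) (≤-trans (b≤ _ j) (n≤1+n _)))
        rearrange : ∀ c b₁ b₂ x y → c * (1 + (b₁ * x + b₂ * y)) + c * (b₁ * y + b₂ * x) ≡ c + c * (x + y) *
          (b₁ + b₂)
        rearrange = solve-∀

  bitᵗ-size : (t : Term n) → SizeBound (lenᵗ t) (bitᵗ t)
  bitᵗ-size (var j)    = 0 , λ _ _ _ _ → ≤-refl
  bitᵗ-size (f ⟨ ts ⟩) with bitˢ-size f | bitᵗˢ-size ts | const-PB 2 +-PB lenᵗˢ-PB ts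
  ... | d , bit-f | d′ , bit-ts | l , len-ts = l * d + d′ , λ ms i 1≤i i≤ → begin
    size (bitᵗ (f ⟨ ts ⟩) ms i)             ≤⟨ []-sized (bitˢ-scoped f _ i 1≤i i≤) (1≤N^ ms d′) (bit-ts ms)
      ⟩
    size (bitˢ f (lenᵗˢ ts ms) i) * N ms ^
      d′ ≤⟨ *-monoˡ-≤ (N ms ^ d′) (≤-trans (bit-f _ i 1≤i i≤) (^-monoˡ-≤ d (len-ts ms))) ⟩
    (N ms ^ l) ^ d * N ms ^ d′              ≡⟨ cong (_* N ms ^ d′) (^-*-assoc (N ms) l d) ⟩
    N ms ^ (l * d) * N ms ^ d′              ≡⟨ ^-distribˡ-+-* (N ms) (l * d) d′ ⟨
    N ms ^ (l * d + d′)                     ∎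
    where open ≤-Reasoning

  bitᵗˢ-size : (ts : Vec (Term n) k) → Σ[ d ∈ ℕ ] ∀ ms → Pointwise (Sized (N ms ^ d)) (lenᵗˢ ts ms)
    (bitᵗˢ ts ms)
  bitᵗˢ-size []       = 0 , λ _ → []
  bitᵗˢ-size (t ∷ ts) with bitᵗ-size t | bitᵗˢ-size ts
  ... | d , bit-t | d′ , bit-ts = d + d′ , λ ms →
    Sized-≤ {b = bitᵗ t ms} (^-monoʳ-≤ (N ms) (m≤m+n d d′)) (bit-t ms) ∷ Pointwise-Sized-≤
      (^-monoʳ-≤ (N ms) (m≤n+m d′ d)) (bit-ts ms)

N^-PB : ∀ d → PolyBounded {n} (λ ms → N ms ^ d)
N^-PB d = d , λ _ → ≤-refl

size-⋀ : ∀ {t} (φ : ℕ → Form V) k → (∀ i → i < k → size (φ i) ≤ t) → size (⋀ (applyUpTo φ k)) ≤ suc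
  (k * suc t)
size-⋀ φ zero    φ≤ = ≤-refl
size-⋀ {t = t} φ (suc k) φ≤ =
  s≤s (≤-trans (+-mono-≤ (φ≤ 0 (s≤s z≤n)) (size-⋀ (φ ∘ suc) k (λ i i<k → φ≤ (suc i) (s≤s i<k))))
               (≤-reflexive (+-suc t (k * suc t))))

⟦⟧-size : (A : Formula n) → PolyBounded (size ∘ ⟦ A ⟧)
⟦⟧-size (t ≐ u) with bitᵗ-size t | bitᵗ-size u
... | d , bit-t | d′ , bit-u = mono-PB
  (λ ms → ⟦≐⟧-elim {t = t} {u} (λ A → size A ≤ suc (lenᵗ t ms * suc (suc (N ms ^ d + N ms ^ d′))))
    (λ e → size-⋀ (bitwise t u ms) (lenᵗ t ms) (λ i i< → s≤s (+-mono-≤ (bit-t ms (suc i) (s≤s z≤n) i<)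
                                                  (bit-u ms (suc i) (s≤s z≤n)
                                                    (≤-trans i< (≤-reflexive e))))))
    (λ _ → s≤s z≤n))
  (const-PB 1 +-PB lenᵗ-PB t *-PB (const-PB 2 +-PB (N^-PB d +-PB N^-PB d′)))
⟦⟧-size (¬ A)   = const-PB 1 +-PB ⟦⟧-size A
⟦⟧-size (A ∧ B) = const-PB 1 +-PB (⟦⟧-size A +-PB ⟦⟧-size B)
⟦⟧-size (A ∨ B) = const-PB 1 +-PB (⟦⟧-size A +-PB ⟦⟧-size B)
⟦⟧-size (A ⇒ B) = const-PB 1 +-PB (⟦⟧-size A +-PB ⟦⟧-size B)
⟦⟧-size (A ⇔ B) = const-PB 1 +-PB (⟦⟧-size A +-PB ⟦⟧-size B)

private variable
  s : ℕ
  P Q R S Γ : Form V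

-- Derived rules

resize : ∀ {M′ n′} → M ≤ M′ → n ≤ n′ → Prf M n P → Prf M′ n′ P
resize M≤ n≤ p = relax n≤ (enlarge M≤ p)

⇒-fits : ∀ (A B : Form V) → size A ≤ s → size B ≤ s → size (A ⇒ B) ≤ suc (s + s)
⇒-fits _ _ a≤ b≤ = s≤s (+-mono-≤ a≤ b≤)

fitsˡ : ∀ a b → suc (a + b) ≤ M → a ≤ M
fitsˡ a b le = ≤-trans (≤-trans (m≤m+n a b) (n≤1+n _)) le

fitsʳ : ∀ a b → suc (a + b) ≤ M → b ≤ M
fitsʳ a b le = ≤-trans (≤-trans (m≤n+m b a) (n≤1+n _)) le

size-regroup : (h a b c : ℕ) → 1 + (1 + (h + a) + (1 + (b + c))) ≡ 1 + (h + (1 + (1 + (a + b) + c)))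
size-regroup = solve-∀

mpᵖ : Prf M m (P ⇒ Q) → Prf M n P → Prf M (suc (m + n)) Q
mpᵖ {P = P} {Q = Q} p q = by (# 0) (P ∷ Q ∷ ⊤ ∷ ⊤ ∷ ⊤ ∷ []) (p ∷ ⟪ q ⟫) (fitsʳ (size P) (size Q) (fits p))

-- Two applications of modus ponens would contain the proof of `P` twice, and iterating this along
-- an induction on notation would double the tree at every step. Here it occurs once.
mp² : Prf M k (P ⇒ Q) → Prf M m (P ⇒ R) → Prf M n P → size (Q ∧ R) ≤ M → Prf M (suc (k + (m + n))) (Q ∧ R)
mp² {P = P} {Q = Q} {R = R} p q r fit = by (# 14) (P ∷ Q ∷ R ∷ ⊤ ∷ ⊤ ∷ []) (p ∷ (q ∷ ⟪ r ⟫)) fit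

⊤-introʰ : size (Γ ⇒ ⊤) ≤ M → Prf M 1 (Γ ⇒ ⊤)
⊤-introʰ {Γ = Γ} fit = by (# 15) (⊤ ∷ ⊤ ∷ ⊤ ∷ ⊤ ∷ Γ ∷ []) [] fit

⊥-elimʰ : Prf M n (Γ ⇒ ⊥) → size (Γ ⇒ P) ≤ M → Prf M (suc n) (Γ ⇒ P)
⊥-elimʰ {Γ = Γ} {P = P} p fit = by (# 16) (P ∷ ⊤ ∷ ⊤ ∷ ⊤ ∷ Γ ∷ []) ⟪ p ⟫ fit

∧-introᵖ : Prf M m P → Prf M n Q → size (P ∧ Q) ≤ M → Prf M (suc (m + n)) (P ∧ Q)
∧-introᵖ {P = P} {Q = Q} p q fit = by (# 17) (P ∷ Q ∷ ⊤ ∷ ⊤ ∷ ⊤ ∷ []) (p ∷ ⟪ q ⟫) fit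

∧-introʰ : Prf M m (Γ ⇒ P) → Prf M n (Γ ⇒ Q) → size (Γ ⇒ P ∧ Q) ≤ M → Prf M (suc (m + n)) (Γ ⇒ P ∧ Q)
∧-introʰ {Γ = Γ} {P = P} {Q = Q} p q fit = by (# 18) (P ∷ Q ∷ ⊤ ∷ ⊤ ∷ Γ ∷ []) (p ∷ ⟪ q ⟫) fit

∧-elimˡʰ : Prf M n (Γ ⇒ P ∧ Q) → Prf M (suc n) (Γ ⇒ P)
∧-elimˡʰ {Γ = Γ} {P = P} {Q = Q} p = by (# 19) (P ∷ Q ∷ ⊤ ∷ ⊤ ∷ Γ ∷ []) ⟪ p ⟫
  (≤-trans (s≤s (+-monoʳ-≤ (size Γ) (fitsˡ (size P) (size Q) ≤-refl))) (fits p))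

∧-elimʳʰ : Prf M n (Γ ⇒ P ∧ Q) → Prf M (suc n) (Γ ⇒ Q)
∧-elimʳʰ {Γ = Γ} {P = P} {Q = Q} p = by (# 20) (P ∷ Q ∷ ⊤ ∷ ⊤ ∷ Γ ∷ []) ⟪ p ⟫
  (≤-trans (s≤s (+-monoʳ-≤ (size Γ) (fitsʳ (size P) (size Q) ≤-refl))) (fits p))

assume : size (P ⇒ P) ≤ M → Prf M 1 (P ⇒ P)
assume {P = P} fit = by (# 21) (P ∷ ⊤ ∷ ⊤ ∷ ⊤ ∷ ⊤ ∷ []) [] fit

regroup : Prf M n (Γ ⇒ P ∧ Q ⇒ R) → Prf M (suc n) (Γ ∧ P ⇒ Q ⇒ R)
regroup {Γ = Γ} {P = P} {Q = Q} {R = R} p = by (# 22) (P ∷ Q ∷ R ∷ ⊤ ∷ Γ ∷ []) ⟪ p ⟫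
  (≤-trans (≤-reflexive lemma) (fits p))
  where
  lemma : size (Γ ∧ P ⇒ Q ⇒ R) ≡ size (Γ ⇒ P ∧ Q ⇒ R)
  lemma = size-regroup (size Γ) (size P) (size Q) (size R)

curryʰ : Prf M n (Γ ∧ P ⇒ Q) → Prf M (suc n) (Γ ⇒ P ⇒ Q)
curryʰ {Γ = Γ} {P = P} {Q = Q} p = by (# 23) (P ∷ Q ∷ ⊤ ∷ ⊤ ∷ Γ ∷ []) ⟪ p ⟫ (≤-trans (≤-reflexive lemma)
  (fits p))
  where
  lemma : size (Γ ⇒ P ⇒ Q) ≡ size (Γ ∧ P ⇒ Q)
  lemma = cong suc (trans (+-suc (size Γ) (size P + size Q))
    (cong suc (sym (+-assoc (size Γ) (size P) (size Q)))))

discharge-⊤ : Prf M n (Γ ⇒ ⊤ ⇒ P) → Prf M (suc n) (Γ ⇒ P)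
discharge-⊤ {Γ = Γ} {P = P} p = by (# 24) (P ∷ ⊤ ∷ ⊤ ∷ ⊤ ∷ Γ ∷ []) ⟪ p ⟫
  (≤-trans (s≤s (+-monoʳ-≤ (size Γ) (fitsʳ 1 (size P) ≤-refl))) (fits p))

⊤⇒-elim : Prf M n (⊤ ⇒ P) → Prf M (suc n) P
⊤⇒-elim {P = P} p = by (# 25) (P ∷ ⊤ ∷ ⊤ ∷ ⊤ ∷ ⊤ ∷ []) ⟪ p ⟫ (fitsʳ 1 (size P) (fits p))

⇔-reflʰ : size (Γ ⇒ (P ⇔ P)) ≤ M → Prf M 1 (Γ ⇒ (P ⇔ P))
⇔-reflʰ {Γ = Γ} {P = P} fit = by (# 26) (P ∷ ⊤ ∷ ⊤ ∷ ⊤ ∷ Γ ∷ []) [] fit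

⇔-symʰ : Prf M n (Γ ⇒ (P ⇔ Q)) → Prf M (suc n) (Γ ⇒ (Q ⇔ P))
⇔-symʰ {Γ = Γ} {P = P} {Q = Q} p = by (# 27) (P ∷ Q ∷ ⊤ ∷ ⊤ ∷ Γ ∷ []) ⟪ p ⟫
  (≤-trans (≤-reflexive (cong (λ b → suc (size Γ + suc b)) (+-comm (size Q) (size P)))) (fits p))

⇔-transʰ : Prf M m (Γ ⇒ (P ⇔ Q)) → Prf M n (Γ ⇒ (Q ⇔ R)) → size (Γ ⇒ (P ⇔ R)) ≤ M →
           Prf M (suc (m + n)) (Γ ⇒ (P ⇔ R))
⇔-transʰ {Γ = Γ} {P = P} {Q = Q} {R = R} p q fit = by (# 28) (P ∷ Q ∷ R ∷ ⊤ ∷ Γ ∷ []) (p ∷ ⟪ q ⟫) fit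

module _ {V : Set} {M : ℕ} {H : Form V} where

  ⋀-introʰ : ∀ (φ : ℕ → Form V) k → size (H ⇒ ⋀ (applyUpTo φ k)) ≤ M →
             (∀ i → i < k → Prf M c (H ⇒ φ i)) → Prf M (suc (k * suc c)) (H ⇒ ⋀ (applyUpTo φ k))
  ⋀-introʰ φ zero    fit p = ⊤-introʰ fit
  ⋀-introʰ {c = c} φ (suc k) fit p = relax (≤-reflexive (cong suc (+-suc c (k * suc c))))
    (∧-introʰ (p 0 (s≤s z≤n))
      (⋀-introʰ (φ ∘ suc) k (≤-trans (s≤s (+-monoʳ-≤ (size H) (fitsʳ (size (φ 0)) _ ≤-refl))) fit)
                (λ i i<k → p (suc i) (s≤s i<k))) fit)

  ⋀-elimʰ : ∀ (φ : ℕ → Form V) k i → i < k → Prf M n (H ⇒ ⋀ (applyUpTo φ k)) → Prf M (suc (n + i)) (H ⇒ φ i)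
  ⋀-elimʰ {n = n} φ (suc k) zero    _         p = relax (s≤s (m≤m+n n 0)) (∧-elimˡʰ p)
  ⋀-elimʰ {n = n} φ (suc k) (suc i) (s≤s i<k) p =
    relax (≤-reflexive (cong suc (sym (+-suc n i)))) (⋀-elimʰ (φ ∘ suc) k i i<k (∧-elimʳʰ p))

size-∈⋀ : ∀ (φ : ℕ → Form V) k i → i < k → size (φ i) ≤ size (⋀ (applyUpTo φ k))
size-∈⋀ φ (suc k) zero    _         = fitsˡ (size (φ 0)) _ ≤-refl
size-∈⋀ φ (suc k) (suc i) (s≤s i<k) = ≤-trans (size-∈⋀ (φ ∘ suc) k i i<k) (fitsʳ (size (φ 0)) _ ≤-refl)

-- Replacement of equivalents and case distinction on an atom

module _ {V W : Set} {M c : ℕ} {H : Form W} {σ τ : V → Form W} where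

  private
    fitˡ : ∀ a a′ b b′ → suc (size H + suc (suc (a + b) + suc (a′ + b′))) ≤ M →
      suc (size H + suc (a + a′)) ≤ M
    fitˡ a a′ b b′ fit = ≤-trans
      (s≤s (+-monoʳ-≤ (size H) (s≤s (+-mono-≤ (fitsˡ a b ≤-refl) (fitsˡ a′ b′ ≤-refl))))) fit

    fitʳ : ∀ a a′ b b′ → suc (size H + suc (suc (a + b) + suc (a′ + b′))) ≤ M →
      suc (size H + suc (b + b′)) ≤ M
    fitʳ a a′ b b′ fit = ≤-trans
      (s≤s (+-monoʳ-≤ (size H) (s≤s (+-mono-≤ (fitsʳ a b ≤-refl) (fitsʳ a′ b′ ≤-refl))))) fit

    steps : ∀ a b → suc (a * suc c + b * suc c) ≤ suc (a + b) * suc c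
    steps a b = s≤s (≤-trans (≤-reflexive (sym (*-distribʳ-+ (suc c) a b))) (m≤n+m _ c))

    leaf : 1 ≤ 1 * suc c
    leaf = s≤s z≤n

  -- Replacement of equivalents along `A`: an atom costs `c` inferences and a connective one, hence
  -- `suc c` per symbol is ample.
  sub-congʰ : ∀ {A} → AllAtoms (λ a → Prf M c (H ⇒ (σ a ⇔ τ a))) A → size (H ⇒ (subᵖ σ A ⇔ subᵖ τ A)) ≤ M →
              Prf M (size A * suc c) (H ⇒ (subᵖ σ A ⇔ subᵖ τ A))
  sub-congʰ (atom p) fit = relax (≤-trans (n≤1+n c) (m≤m+n _ 0)) p
  sub-congʰ ⊤ fit = relax leaf (⇔-reflʰ fit)
  sub-congʰ ⊥ fit = relax leaf (⇔-reflʰ fit)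
  sub-congʰ (¬_ {A} p) fit = relax (s≤s (m≤n+m _ c)) (by (# 29) (subᵖ σ A ∷ subᵖ τ A ∷ ⊤ ∷ ⊤ ∷ H ∷ [])
    ⟪ sub-congʰ p (≤-trans (s≤s (+-monoʳ-≤ (size H) (s≤s (+-mono-≤ (n≤1+n _) (n≤1+n _))))) fit) ⟫ fit)
  sub-congʰ (_∧_ {A} {B} p q) fit = relax (steps (size A) (size B))
    (by (# 30) (subᵖ σ A ∷ subᵖ τ A ∷ subᵖ σ B ∷ subᵖ τ B ∷ H ∷ [])
      (sub-congʰ p (fitˡ (size (subᵖ σ A)) (size (subᵖ τ A)) (size (subᵖ σ B)) (size (subᵖ τ B)) fit) ∷
       ⟪ sub-congʰ q (fitʳ (size (subᵖ σ A)) (size (subᵖ τ A)) (size (subᵖ σ B)) (size (subᵖ τ B)) fit) ⟫)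
         fit)
  sub-congʰ (_∨_ {A} {B} p q) fit = relax (steps (size A) (size B))
    (by (# 31) (subᵖ σ A ∷ subᵖ τ A ∷ subᵖ σ B ∷ subᵖ τ B ∷ H ∷ [])
      (sub-congʰ p (fitˡ (size (subᵖ σ A)) (size (subᵖ τ A)) (size (subᵖ σ B)) (size (subᵖ τ B)) fit) ∷
       ⟪ sub-congʰ q (fitʳ (size (subᵖ σ A)) (size (subᵖ τ A)) (size (subᵖ σ B)) (size (subᵖ τ B)) fit) ⟫)
         fit)
  sub-congʰ (_⇒_ {A} {B} p q) fit = relax (steps (size A) (size B))
    (by (# 32) (subᵖ σ A ∷ subᵖ τ A ∷ subᵖ σ B ∷ subᵖ τ B ∷ H ∷ [])
      (sub-congʰ p (fitˡ (size (subᵖ σ A)) (size (subᵖ τ A)) (size (subᵖ σ B)) (size (subᵖ τ B)) fit) ∷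
       ⟪ sub-congʰ q (fitʳ (size (subᵖ σ A)) (size (subᵖ τ A)) (size (subᵖ σ B)) (size (subᵖ τ B)) fit) ⟫)
         fit)
  sub-congʰ (_⇔_ {A} {B} p q) fit = relax (steps (size A) (size B))
    (by (# 33) (subᵖ σ A ∷ subᵖ τ A ∷ subᵖ σ B ∷ subᵖ τ B ∷ H ∷ [])
      (sub-congʰ p (fitˡ (size (subᵖ σ A)) (size (subᵖ τ A)) (size (subᵖ σ B)) (size (subᵖ τ B)) fit) ∷
       ⟪ sub-congʰ q (fitʳ (size (subᵖ σ A)) (size (subᵖ τ A)) (size (subᵖ σ B)) (size (subᵖ τ B)) fit) ⟫)
         fit)

Replaces : (V → Form V) → V → Form V → V → Set
Replaces σ b A a = (a ≡ b × σ a ≡ A) ⊎ σ a ≡ atom a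

module _ {V : Set} {M : ℕ} {σ₀ σ₁ : V → Form V} {b : V} {A : Form V}
         (r₀ : AllAtoms (Replaces σ₀ b ⊥) A) (r₁ : AllAtoms (Replaces σ₁ b ⊤) A)
         (fit : 8 + (size A + size A) ≤ M) where

  private
    small : ∀ {k} → k ≤ 6 → k ≤ M
    small k≤ = ≤-trans k≤ (≤-trans (s≤s (s≤s (s≤s (s≤s (s≤s (s≤s z≤n)))))) fit)

    size-sub-atom : ∀ {σ C} → size C ≤ 1 → AllAtoms (Replaces σ b C) A → size (subᵖ σ A) ≤ size A
    size-sub-atom C≤1 r = ≤-trans (size-sub ≤-refl (mapAtoms (λ
      { (inj₁ (_ , e)) → ≤-trans (≤-reflexive (cong size e)) C≤1
      ; (inj₂ e) → ≤-reflexive (cong size e) }) r)) (≤-reflexive (*-identityʳ _))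

    fit′ : ∀ {σ C h} → size C ≤ 1 → AllAtoms (Replaces σ b C) A → h ≤ 2 →
           suc (h + suc (size (subᵖ σ A) + size (subᵖ atom A))) ≤ M
    fit′ C≤1 r h≤2 = ≤-trans (s≤s (+-mono-≤ h≤2 (s≤s (+-mono-≤ (size-sub-atom C≤1 r)
      (≤-reflexive (cong size (sub-atom A))))))) (≤-trans (m≤n+m _ 4) fit)

    equivalent : ∀ {σ C H} → size C ≤ 1 → size H ≤ 2 → AllAtoms (Replaces σ b C) A →
      Prf M 1 (H ⇒ (C ⇔ atom b)) →
                 Prf M (size A * 2) (H ⇒ (subᵖ σ A ⇔ A))
    equivalent {σ} {C} {H} C≤1 H≤2 r p = ≡.subst (λ B → Prf M (size A * 2) (H ⇒ (subᵖ σ A ⇔ B)))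
      (sub-atom A)
      (sub-congʰ (mapAtoms (λ
        { (inj₁ (refl , e)) → ≡.subst (λ B → Prf M 1 (H ⇒ (B ⇔ atom b))) (sym e) p
        ; {a} (inj₂ e) → ≡.subst (λ B → Prf M 1 (H ⇒ (B ⇔ atom a))) (sym e)
                     (⇔-reflʰ (≤-trans (s≤s (+-monoˡ-≤ 3 H≤2)) (small ≤-refl))) }) r)
        (fit′ C≤1 r H≤2))

  -- Under `¬ b` the formula `A` is equivalent to its instance with `⊥` for `b`, and under `b` to
  -- the one with `⊤`; both equivalences come from `sub-congʰ`. The longest line, an implication
  -- from `¬ b` to such an equivalence, has at most `4 + 2 |A|` symbols.
  caseDistinction : Prf M n (subᵖ σ₀ A ∧ subᵖ σ₁ A) → Prf M (suc (n + (size A * 2 + size A * 2))) A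
  caseDistinction p = by (# 34) (subᵖ σ₀ A ∷ subᵖ σ₁ A ∷ atom b ∷ A ∷ ⊤ ∷ [])
    (p ∷ (equivalent (s≤s z≤n) ≤-refl r₀ (by (# 35) (atom b ∷ ⊤ ∷ ⊤ ∷ ⊤ ∷ ⊤ ∷ []) [] (small ≤-refl))
     ∷ ⟪ equivalent (s≤s z≤n) (s≤s z≤n) r₁ (by (# 36) (atom b ∷ ⊤ ∷ ⊤ ∷ ⊤ ∷ ⊤ ∷ []) []
       (small (s≤s (s≤s (s≤s (s≤s (s≤s z≤n))))))) ⟫))
    (≤-trans (≤-trans (m≤m+n (size A) (size A)) (m≤n+m _ 8)) fit)

-- Proofs of translations

-- One power bounds both the number of inferences and the formula size, so that `TIND` can run
-- `HalvingInduction` on a single number.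
Provable : Formula n → Set
Provable A = Σ[ d ∈ ℕ ] ∀ ms → Prf (N ms ^ d) (N ms ^ d) (⟦ A ⟧ ms)

provable : ∀ {A : Formula n} {f g : Vec ℕ n → ℕ} → PolyBounded f → PolyBounded g →
           (∀ ms → Prf (f ms) (g ms) (⟦ A ⟧ ms)) → Provable A
provable (d , f≤) (e , g≤) p = d + e , λ ms →
  resize (≤-trans (f≤ ms) (^-monoʳ-≤ (N ms) (m≤m+n d e))) (≤-trans (g≤ ms) (^-monoʳ-≤ (N ms) (m≤n+m e d)))
    (p ms)

provable-axiom : ∀ {A : Formula n} → (∀ ms → Prf (size (⟦ A ⟧ ms)) 1 (⟦ A ⟧ ms)) → Provable A
provable-axiom {A = A} = provable {A = A} (⟦⟧-size A) (const-PB 1)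

module _ {n} {t u : Term n} {ms : Vec ℕ n} where

  ⟦≐⟧-≡ : lenᵗ t ms ≡ lenᵗ u ms → ⟦ t ≐ u ⟧ ms ≡ ⋀ (applyUpTo (bitwise t u ms) (lenᵗ t ms))
  ⟦≐⟧-≡ e = ⟦≐⟧-elim {t = t} {u} (_≡ ⋀ (applyUpTo (bitwise t u ms) (lenᵗ t ms))) (λ _ → refl)
    (λ ≢ → contradiction e ≢)

  ⟦≐⟧-≢ : lenᵗ t ms ≢ lenᵗ u ms → ⟦ t ≐ u ⟧ ms ≡ ⊥
  ⟦≐⟧-≢ ≢ = ⟦≐⟧-elim {t = t} {u} (_≡ ⊥) (λ e → contradiction e ≢) (λ _ → refl)

  module _ {M : ℕ} {H : Form (Atom n)} where

    ≐-elimʰ : lenᵗ t ms ≡ lenᵗ u ms → Prf M k (H ⇒ ⟦ t ≐ u ⟧ ms) → ∀ i → 1 ≤ i → i ≤ lenᵗ t ms →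
              Prf M (k + i) (H ⇒ (bitᵗ t ms i ⇔ bitᵗ u ms i))
    ≐-elimʰ {k = k} e p (suc i) _ i< = relax (≤-reflexive (sym (+-suc k i)))
      (⋀-elimʰ _ (lenᵗ t ms) i i< (≡.subst (λ A → Prf M _ (H ⇒ A)) (⟦≐⟧-≡ e) p))

    ≐-introʰ : lenᵗ t ms ≡ lenᵗ u ms → size (H ⇒ ⟦ t ≐ u ⟧ ms) ≤ M →
               (∀ i → 1 ≤ i → i ≤ lenᵗ t ms → Prf M c (H ⇒ (bitᵗ t ms i ⇔ bitᵗ u ms i))) →
               Prf M (suc (lenᵗ t ms * suc c)) (H ⇒ ⟦ t ≐ u ⟧ ms)
    ≐-introʰ e fit p rewrite ⟦≐⟧-≡ e = ⋀-introʰ _ (lenᵗ t ms) fit (λ i i< → p (suc i) (s≤s z≤n) i<)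

    ≢-elimʰ : lenᵗ t ms ≢ lenᵗ u ms → Prf M k (H ⇒ ⟦ t ≐ u ⟧ ms) → size (H ⇒ P) ≤ M → Prf M (suc k) (H ⇒ P)
    ≢-elimʰ ≢ p fit = ⊥-elimʰ (≡.subst (λ A → Prf M _ (H ⇒ A)) (⟦≐⟧-≢ ≢) p) fit

  size-bitwise : lenᵗ t ms ≡ lenᵗ u ms → ∀ i → 1 ≤ i → i ≤ lenᵗ t ms →
                 size (bitᵗ t ms i ⇔ bitᵗ u ms i) ≤ size (⟦ t ≐ u ⟧ ms)
  size-bitwise e (suc i) _ i< = ≤-trans (size-∈⋀ (bitwise t u ms) (lenᵗ t ms) i i<)
    (≤-reflexive (cong size (sym (⟦≐⟧-≡ e))))

-- Bits of equal strings are syntactically equal, up to the simplification of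
-- conditionals.
data BitEq {V : Set} : Form V → Form V → Set where
  same  : ∀ {A B} → A ≡ B → BitEq A B
  cond= : ∀ {A B C} → C ≡ ((¬ B ∧ A) ∨ (B ∧ A)) → BitEq A C
  cond₀ : ∀ {A B C} → C ≡ ((¬ ⊥ ∧ A) ∨ (⊥ ∧ B)) → BitEq C A
  cond₁ : ∀ {A B C} → C ≡ ((¬ ⊤ ∧ A) ∨ (⊤ ∧ B)) → BitEq C B

bitEq-prf : BitEq P Q → size (Γ ⇒ (P ⇔ Q)) ≤ M → Prf M 1 (Γ ⇒ (P ⇔ Q))
bitEq-prf         (same refl)          fit = ⇔-reflʰ fit
bitEq-prf {Γ = Γ} (cond= {A} {B} refl) fit = by (# 37) (A ∷ B ∷ ⊤ ∷ ⊤ ∷ Γ ∷ []) [] fit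
bitEq-prf {Γ = Γ} (cond₀ {A} {B} refl) fit = by (# 38) (A ∷ B ∷ ⊤ ∷ ⊤ ∷ Γ ∷ []) [] fit
bitEq-prf {Γ = Γ} (cond₁ {A} {B} refl) fit = by (# 39) (A ∷ B ∷ ⊤ ∷ ⊤ ∷ Γ ∷ []) [] fit

record EqualAt {n} (t u : Term n) (ms : Vec ℕ n) : Set where
  constructor _,_
  field
    len≡ : lenᵗ t ms ≡ lenᵗ u ms
    bit≡ : ∀ i → 1 ≤ i → i ≤ lenᵗ t ms → BitEq (bitᵗ t ms i) (bitᵗ u ms i)

open EqualAt

equation : ∀ {t u : Term n} → (∀ ms → EqualAt t u ms) → Provable (t ≐ u)
equation {n} {t} {u} e = provable {A = t ≐ u} {f = λ ms → 2 + size (⟦ t ≐ u ⟧ ms)}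
  (const-PB 2 +-PB ⟦⟧-size (t ≐ u)) (const-PB 2 +-PB lenᵗ-PB t *-PB const-PB 2) λ ms →
  -- The rules for equations carry a hypothesis. Here it is `⊤`, which accounts for the two
  -- additional symbols.
  ⊤⇒-elim (≐-introʰ {t = t} {u} (len≡ (e ms)) ≤-refl λ i 1≤i i≤ →
    bitEq-prf (bit≡ (e ms) i 1≤i i≤) (+-monoʳ-≤ 2 (size-bitwise {t = t} {u} (len≡ (e ms)) i 1≤i i≤)))

-- Propositional axioms and axioms on strings

prop-provable : ∀ {A : Formula n} → PropAxiom A → Provable A
prop-provable {A = F} ax = provable-axiom {A = F} (λ ms → go ms ax)
  where
  go : ∀ ms {F} → PropAxiom F → Prf (size (⟦ F ⟧ ms)) 1 (⟦ F ⟧ ms)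
  go ms (⇒-K A B)   = by (# 1) (⟦ A ⟧ ms ∷ ⟦ B ⟧ ms ∷ ⊤ ∷ ⊤ ∷ ⊤ ∷ []) [] ≤-refl
  go ms (⇒-S A B C) = by (# 2) (⟦ A ⟧ ms ∷ ⟦ B ⟧ ms ∷ ⟦ C ⟧ ms ∷ ⊤ ∷ ⊤ ∷ []) [] ≤-refl
  go ms (∧-I A B)   = by (# 3) (⟦ A ⟧ ms ∷ ⟦ B ⟧ ms ∷ ⊤ ∷ ⊤ ∷ ⊤ ∷ []) [] ≤-refl
  go ms (∧-E₁ A B)  = by (# 4) (⟦ A ⟧ ms ∷ ⟦ B ⟧ ms ∷ ⊤ ∷ ⊤ ∷ ⊤ ∷ []) [] ≤-refl
  go ms (∧-E₂ A B)  = by (# 5) (⟦ A ⟧ ms ∷ ⟦ B ⟧ ms ∷ ⊤ ∷ ⊤ ∷ ⊤ ∷ []) [] ≤-refl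
  go ms (∨-I₁ A B)  = by (# 6) (⟦ A ⟧ ms ∷ ⟦ B ⟧ ms ∷ ⊤ ∷ ⊤ ∷ ⊤ ∷ []) [] ≤-refl
  go ms (∨-I₂ A B)  = by (# 7) (⟦ A ⟧ ms ∷ ⟦ B ⟧ ms ∷ ⊤ ∷ ⊤ ∷ ⊤ ∷ []) [] ≤-refl
  go ms (∨-E A B C) = by (# 8) (⟦ A ⟧ ms ∷ ⟦ B ⟧ ms ∷ ⟦ C ⟧ ms ∷ ⊤ ∷ ⊤ ∷ []) [] ≤-refl
  go ms (¬-I A B)   = by (# 9) (⟦ A ⟧ ms ∷ ⟦ B ⟧ ms ∷ ⊤ ∷ ⊤ ∷ ⊤ ∷ []) [] ≤-refl
  go ms (¬¬-E A)    = by (# 10) (⟦ A ⟧ ms ∷ ⊤ ∷ ⊤ ∷ ⊤ ∷ ⊤ ∷ []) [] ≤-refl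
  go ms (⇔-I A B)   = by (# 11) (⟦ A ⟧ ms ∷ ⟦ B ⟧ ms ∷ ⊤ ∷ ⊤ ∷ ⊤ ∷ []) [] ≤-refl
  go ms (⇔-E₁ A B)  = by (# 12) (⟦ A ⟧ ms ∷ ⟦ B ⟧ ms ∷ ⊤ ∷ ⊤ ∷ ⊤ ∷ []) [] ≤-refl
  go ms (⇔-E₂ A B)  = by (# 13) (⟦ A ⟧ ms ∷ ⟦ B ⟧ ms ∷ ⊤ ∷ ⊤ ∷ ⊤ ∷ []) [] ≤-refl

module _ {n} (t u : Term n) (ms : Vec ℕ n) where

  bit-· : ∀ i → bitᵗ (t · u) ms i ≡ catBits (lenᵗ t ms) (bitᵗ t ms) (bitᵗ u ms) i
  bit-· i = sub-catBits _ (lenᵗ t ms) (varBits zero) (varBits (suc zero)) i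

  bit-·ˡ : ∀ {i} → i ≤ lenᵗ t ms → bitᵗ (t · u) ms i ≡ bitᵗ t ms i
  bit-·ˡ {i} i≤ = trans (bit-· i) (catBits-≤ {b = bitᵗ t ms} {bitᵗ u ms} i≤)

  bit-·ʳ : ∀ {i} → lenᵗ t ms < i → bitᵗ (t · u) ms i ≡ bitᵗ u ms (i ∸ lenᵗ t ms)
  bit-·ʳ {i} i> = trans (bit-· i) (catBits-> {b = bitᵗ t ms} {bitᵗ u ms} i>)

len-bit : ∀ b (ms : Vec ℕ n) → lenᵗ (bit b) ms ≡ 1
len-bit false ms = refl
len-bit true  ms = refl

bit-bit : ∀ b (ms : Vec ℕ n) i j → bitᵗ (bit b) ms i ≡ bitᵗ (bit b) ms j
bit-bit false ms i j = refl
bit-bit true  ms i j = refl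

module _ {n} (w x y z : Term n) (ms : Vec ℕ n) {k} (e : lenᵗ w ms ≡ suc k) where

  len-cond : lenᵗ (cond w x y z) ms ≡ lenᵗ y ms ⊔ lenᵗ z ms
  len-cond rewrite e = refl

  bit-cond : ∀ i → let ly = lenᵗ y ms ; lz = lenᵗ z ms in
             bitᵗ (cond w x y z) ms i ≡ ((¬ bitᵗ w ms (suc k) ∧ catBits (lz ∸ ly) ⊥s (bitᵗ y ms) i)
                                          ∨ (bitᵗ w ms (suc k) ∧ catBits (ly ∸ lz) ⊥s (bitᵗ z ms) i))
  bit-cond i rewrite e = cong₂ (λ A B → (¬ bitᵗ w ms (suc k) ∧ A) ∨ (bitᵗ w ms (suc k) ∧ B))
    (sub-catBits _ (lenᵗ z ms ∸ lenᵗ y ms) ⊥s (varBits (suc (suc zero))) i)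
    (sub-catBits _ (lenᵗ y ms ∸ lenᵗ z ms) ⊥s (varBits (suc (suc (suc zero)))) i)

module _ {n} (w x y : Term n) (ms : Vec ℕ n) {k} (e : lenᵗ w ms ≡ suc k) where

  len-cond= : lenᵗ (cond w x y y) ms ≡ lenᵗ y ms
  len-cond= = trans (len-cond w x y y ms e) (⊔-idem (lenᵗ y ms))

  bit-cond= : ∀ i → 1 ≤ i → bitᵗ (cond w x y y) ms i ≡
              ((¬ bitᵗ w ms (suc k) ∧ bitᵗ y ms i) ∨ (bitᵗ w ms (suc k) ∧ bitᵗ y ms i))
  bit-cond= i 1≤i = trans (bit-cond w x y y ms e i)
    (cong (λ A → (¬ bitᵗ w ms (suc k) ∧ A) ∨ (bitᵗ w ms (suc k) ∧ A)) all)
    where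
    all : catBits (lenᵗ y ms ∸ lenᵗ y ms) ⊥s (bitᵗ y ms) i ≡ bitᵗ y ms i
    -- Branches of equal length receive no padding.
    all rewrite n∸n≡0 (lenᵗ y ms) = catBits-> {b = ⊥s} {bitᵗ y ms} 1≤i

vacuous : ∀ {t u : Term n} {ms} → lenᵗ t ms ≡ 0 → lenᵗ u ms ≡ 0 → EqualAt t u ms
vacuous e e′ = trans e (sym e′) , λ i 1≤i i≤ → contradiction (≤-trans 1≤i (≤-trans i≤ (≤-reflexive e))) λ ()

exactly : ∀ {t u : Term n} {ms} → lenᵗ t ms ≡ lenᵗ u ms →
          (∀ i → 1 ≤ i → i ≤ lenᵗ t ms → bitᵗ t ms i ≡ bitᵗ u ms i) → EqualAt t u ms
exactly e b = e , λ i 1≤i i≤ → same (b i 1≤i i≤)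

⌈/2⌉-parity : ∀ m → ⌈ m /2⌉ ≡ ⌊ m /2⌋ ⊎ ⌈ m /2⌉ ≡ suc ⌊ m /2⌋
⌈/2⌉-parity 0 = inj₁ refl
⌈/2⌉-parity 1 = inj₂ refl
⌈/2⌉-parity (suc (suc m)) with ⌈/2⌉-parity m
... | inj₁ e = inj₁ (cong suc e)
... | inj₂ e = inj₂ (cong suc e)

-- E(x;y,z) is y for even |x| and z for odd |x|.
module _ {n} {t : Term n} (x y z : Term n) (ms : Vec ℕ n) where

  private
    h = ⌊ lenᵗ x ms /2⌋
    h′ = ⌈ lenᵗ x ms /2⌉

  -- For even |x| the guard `lh x ▷ rh x` is empty and `cond` computes to `y`. For odd |x| the guard
  -- has one bit and both branches are `z`, which yields `(¬ B ∧ A) ∨ (B ∧ A)`. As `BitEq` allows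
  -- one simplification only, the bits must agree with those of `z` syntactically in that case.
  E-equal : (h′ ≡ h → EqualAt t y ms) → (h′ ≡ suc h → EqualAt t z ms) →
            (∀ i → 1 ≤ i → h′ ≡ suc h → i ≤ lenᵗ t ms → bitᵗ t ms i ≡ bitᵗ z ms i) → EqualAt t (E x y z) ms
  E-equal even odd odd≡ with ⌈/2⌉-parity (lenᵗ x ms)
  ... | inj₁ e = trans (len≡ (even e)) (sym len≡y) ,
                 λ i 1≤i i≤ → ≡.subst (BitEq (bitᵗ t ms i)) (sym (bit≡y i)) (bit≡ (even e) i 1≤i i≤)
    where
    h′∸h≡0 : h′ ∸ h ≡ 0
    h′∸h≡0 = trans (cong (_∸ h) e) (n∸n≡0 h)
    len≡y : lenᵗ (E x y z) ms ≡ lenᵗ y ms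
    len≡y rewrite h′∸h≡0 = refl
    bit≡y : ∀ i → bitᵗ (E x y z) ms i ≡ bitᵗ y ms i
    bit≡y i rewrite h′∸h≡0 = refl
  ... | inj₂ e = trans (len≡ (odd e)) (sym (len-cond= (lh x ▷ rh x) y z ms h′∸h≡1)) ,
                 λ i 1≤i i≤ → cond= (trans (bit-cond= (lh x ▷ rh x) y z ms h′∸h≡1 i 1≤i)
                   (cong (λ A → (¬ bitᵗ (lh x ▷ rh x) ms 1 ∧ A) ∨ (bitᵗ (lh x ▷ rh x) ms 1 ∧ A))
                     (sym (odd≡ i 1≤i e i≤))))
    where
    h′∸h≡1 : h′ ∸ h ≡ 1
    h′∸h≡1 = trans (cong (_∸ h) e) (m+n∸n≡m 1 h)

E-exactly : ∀ {t : Term n} x y z ms → let h = ⌊ lenᵗ x ms /2⌋ ; h′ = ⌈ lenᵗ x ms /2⌉ in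
            (h′ ≡ h → lenᵗ t ms ≡ lenᵗ y ms × (∀ i → 1 ≤ i → i ≤ lenᵗ t ms → bitᵗ t ms i ≡ bitᵗ y ms i)) →
            (h′ ≡ suc h → lenᵗ t ms ≡ lenᵗ z ms × (∀ i → 1 ≤ i → i ≤ lenᵗ t ms → bitᵗ t ms i ≡ bitᵗ z ms
              i)) →
            EqualAt t (E x y z) ms
E-exactly {t = t} x y z ms even odd = E-equal {t = t} x y z ms
  (λ e → exactly {t = t} {y} (proj₁ (even e)) (proj₂ (even e)))
  (λ e → exactly {t = t} {z} (proj₁ (odd e)) (proj₂ (odd e)))
  (λ i 1≤i e i≤ → proj₂ (odd e) i 1≤i i≤)

private
  x : ∀ {n} → Term (1 + n)
  x = var zero

  y : ∀ {n} → Term (2 + n)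
  y = var (suc zero)

  z : ∀ {n} → Term (3 + n)
  z = var (suc (suc zero))

  w : ∀ {n} → Term (4 + n)
  w = var (suc (suc (suc zero)))

·-assoc-equal : ∀ (t u v : Term n) ms → EqualAt (t · (u · v)) ((t · u) · v) ms
·-assoc-equal t u v ms = exactly {t = t · (u · v)} {(t · u) · v}
  (sym (+-assoc (lenᵗ t ms) (lenᵗ u ms) (lenᵗ v ms))) λ i _ _ → bits i
  where
  open ≡-Reasoning
  lt = lenᵗ t ms
  lu = lenᵗ u ms
  bits : ∀ i → bitᵗ (t · (u · v)) ms i ≡ bitᵗ ((t · u) · v) ms i
  bits i with i ≤? lt
  ... | yes i≤ = trans (bit-·ˡ t (u · v) ms i≤)
                   (sym (trans (bit-·ˡ (t · u) v ms (≤-trans i≤ (m≤m+n lt lu))) (bit-·ˡ t u ms i≤)))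
  ... | no i≰ with i ≤? lt + lu
  ...   | yes i≤ = begin
    bitᵗ (t · (u · v)) ms i  ≡⟨ bit-·ʳ t (u · v) ms (≰⇒> i≰) ⟩
    bitᵗ (u · v) ms (i ∸ lt) ≡⟨ bit-·ˡ u v ms (m≤n+o⇒m∸n≤o i lt i≤) ⟩
    bitᵗ u ms (i ∸ lt)       ≡⟨ bit-·ʳ t u ms (≰⇒> i≰) ⟨
    bitᵗ (t · u) ms i        ≡⟨ bit-·ˡ (t · u) v ms i≤ ⟨
    bitᵗ ((t · u) · v) ms i  ∎
  ...   | no i≰′ = begin
    bitᵗ (t · (u · v)) ms i  ≡⟨ bit-·ʳ t (u · v) ms (≰⇒> i≰) ⟩
    bitᵗ (u · v) ms (i ∸ lt) ≡⟨ bit-·ʳ u v ms (m+n<o⇒n<o∸m lt (≰⇒> i≰′)) ⟩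
    bitᵗ v ms (i ∸ lt ∸ lu)  ≡⟨ cong (bitᵗ v ms) (∸-+-assoc i lt lu) ⟩
    bitᵗ v ms (i ∸ (lt + lu)) ≡⟨ bit-·ʳ (t · u) v ms (≰⇒> i≰′) ⟨
    bitᵗ ((t · u) · v) ms i  ∎
    where
    m+n<o⇒n<o∸m : ∀ m {n o} → m + n < o → n < o ∸ m
    m+n<o⇒n<o∸m m {n} m+n<o = m+n≤o⇒m≤o∸n (suc n) (≤-trans (≤-reflexive (cong suc (+-comm n m))) m+n<o)

-- The left half of `x · bit b` has length ⌈m/2⌉: for even m it is unchanged, and for odd m it takes
-- over the first bit of `rh x`, which is then nonempty.
lh-·bit-equal : ∀ b (ms : Vec ℕ 1) → EqualAt (lh (x · bit b)) (E x (lh x) (lh x · ((rh x · bit b) ◁ rh x)))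
  ms
lh-·bit-equal b ms@(m ∷ []) = E-exactly {t = t} x (lh x) (lh x · ((rh x · bit b) ◁ rh x)) ms
  (λ e → trans len e , λ i _ i≤ → bit-·ˡ x (bit b) ms (≤m i i≤))
  (λ e → trans len (trans e (sym
    (trans (cong (h +_) (trans (cong (λ l → h′ + l ∸ h′) (len-bit b ms)) (m+n∸m≡n h′ 1))) (+-comm h 1)))) ,
         λ i _ i≤ → trans (bit-·ˡ x (bit b) ms (≤m i i≤)) (sym (odd i e (≤-trans i≤ (≤-reflexive len)))))
  where
  open ≡-Reasoning
  h = ⌊ m /2⌋
  h′ = ⌈ m /2⌉
  t : Term 1
  t = lh (x · bit b)
  len : lenᵗ t ms ≡ h′
  len = trans (cong (λ l → ⌊ m + l /2⌋) (len-bit b ms)) (cong ⌊_/2⌋ (+-comm m 1))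
  ≤m : ∀ i → i ≤ lenᵗ t ms → i ≤ m
  ≤m i i≤ = ≤-trans (≤-trans i≤ (≤-reflexive len)) (⌈n/2⌉≤n m)
  odd : ∀ i → h′ ≡ suc h → i ≤ h′ → bitᵗ (lh x · ((rh x · bit b) ◁ rh x)) ms i ≡ varBits zero i
  odd i e i≤ with i ≤? h
  ... | yes i≤h = bit-·ˡ (lh x) ((rh x · bit b) ◁ rh x) ms i≤h
  ... | no  i≰h = begin
    bitᵗ (lh x · ((rh x · bit b) ◁ rh x)) ms i ≡⟨ bit-·ʳ (lh x) ((rh x · bit b) ◁ rh x) ms (≰⇒> i≰h) ⟩
    bitᵗ (rh x · bit b) ms (i ∸ h)             ≡⟨ bit-·ˡ (rh x) (bit b) ms (≤-trans (m∸n≤m i h) i≤) ⟩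
    varBits zero (i ∸ h + h)                   ≡⟨ cong (varBits zero) (m∸n+n≡m (<⇒≤ (≰⇒> i≰h))) ⟩
    varBits zero i                             ∎

rh-·bit-equal : ∀ b (ms : Vec ℕ 1) → EqualAt (rh (x · bit b)) (E x (rh x · bit b) (𝟏 ▷ (rh x · bit b))) ms
rh-·bit-equal b ms@(m ∷ []) = E-exactly {t = t} x (rh x · bit b) (𝟏 ▷ (rh x · bit b)) ms
  (λ e → trans len (sym (trans len-rh· (cong suc e))) , λ i 1≤i i≤ → even i e)
  (λ e → trans len (sym (trans (cong (_∸ 1) len-rh·) e)) , λ i 1≤i i≤ → odd i e)
  where
  h = ⌊ m /2⌋
  h′ = ⌈ m /2⌉
  t : Term 1
  t = rh (x · bit b)
  m+1 : m + lenᵗ (bit b) ms ≡ suc m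
  m+1 = trans (cong (m +_) (len-bit b ms)) (+-comm m 1)
  len : lenᵗ t ms ≡ suc h
  len = cong ⌈_/2⌉ m+1
  len-rh· : lenᵗ (rh x · bit b) ms ≡ suc h′
  len-rh· = trans (cong (h′ +_) (len-bit b ms)) (+-comm h′ 1)
  h+h′ : h + h′ ≡ m
  h+h′ = ⌊n/2⌋+⌈n/2⌉≡n m
  lhs : ∀ i → bitᵗ t ms i ≡ bitᵗ (x · bit b) ms (i + h′)
  lhs i = cong (λ l → bitᵗ (x · bit b) ms (i + ⌊ l /2⌋)) m+1
  lhsˡ : ∀ i → i ≤ h → bitᵗ t ms i ≡ varBits zero (i + h′)
  lhsˡ i i≤h = trans (lhs i) (bit-·ˡ x (bit b) ms (≤-trans (+-monoˡ-≤ h′ i≤h) (≤-reflexive h+h′)))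
  lhsʳ : ∀ i → h < i → bitᵗ t ms i ≡ bitᵗ (bit b) ms 0
  lhsʳ i h<i = trans (lhs i)
    (trans (bit-·ʳ x (bit b) ms (≤-trans (≤-reflexive (cong suc (sym h+h′))) (+-monoˡ-≤ h′ h<i)))
    (bit-bit b ms _ 0))
  even : ∀ i → h′ ≡ h → bitᵗ t ms i ≡ bitᵗ (rh x · bit b) ms i
  even i e with i ≤? h
  ... | yes i≤h = trans (lhsˡ i i≤h) (trans (cong (λ k → varBits zero (i + k)) e)
                    (sym (bit-·ˡ (rh x) (bit b) ms (≤-trans i≤h (≤-reflexive (sym e))))))
  ... | no  i≰h = trans (lhsʳ i (≰⇒> i≰h)) (sym (trans
                    (bit-·ʳ (rh x) (bit b) ms (≤-trans (≤-reflexive (cong suc e)) (≰⇒> i≰h)))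
                      (bit-bit b ms _ 0)))
  odd : ∀ i → h′ ≡ suc h → bitᵗ t ms i ≡ bitᵗ (rh x · bit b) ms (i + 1)
  odd i e with i ≤? h
  ... | yes i≤h = trans (lhsˡ i i≤h)
      (trans (cong (varBits zero) (trans (cong (i +_) e) (sym (+-assoc i 1 h))))
                    (sym (bit-·ˡ (rh x) (bit b) ms
                      (≤-trans (+-monoˡ-≤ 1 i≤h) (≤-reflexive (trans (+-comm h 1) (sym e)))))))
  ... | no  i≰h = trans (lhsʳ i (≰⇒> i≰h)) (sym (trans
                    (bit-·ʳ (rh x) (bit b) ms (≤-trans (s≤s (≤-trans (≤-reflexive e) (≰⇒> i≰h)))
                      (≤-reflexive (+-comm 1 i)))) (bit-bit b ms _ 0)))

lh-bit·-equal : ∀ b (ms : Vec ℕ 1) → EqualAt (lh (bit b · x)) (E x ((bit b · lh x) ◁ 𝟏) (bit b · lh x)) ms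
lh-bit·-equal b ms@(m ∷ []) = E-exactly {t = t} x ((bit b · lh x) ◁ 𝟏) (bit b · lh x) ms
  (λ e → trans len (trans e (sym (cong (λ l → l + h ∸ 1) (len-bit b ms)))) , bits)
  (λ e → trans len (trans e (sym (cong (_+ h) (len-bit b ms)))) , bits)
  where
  h = ⌊ m /2⌋
  h′ = ⌈ m /2⌉
  t : Term 1
  t = lh (bit b · x)
  len : lenᵗ t ms ≡ h′
  len = cong (λ l → ⌊ l + m /2⌋) (len-bit b ms)
  bits : ∀ i → 1 ≤ i → i ≤ lenᵗ t ms → bitᵗ t ms i ≡ bitᵗ (bit b · lh x) ms i
  bits i _ _ = trans (bit-· (bit b) x ms i) (sym (bit-· (bit b) (lh x) ms i))

-- For even |x| the right half takes over the last bit of `bit b · lh x`, isolated by dropping |lh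
-- x| bits on the left. If x is empty, this is the new bit itself.
rh-bit·-equal : ∀ b (ms : Vec ℕ 1) → EqualAt (rh (bit b · x)) (E x ((lh x ▷ (bit b · lh x)) · rh x) (rh x))
  ms
rh-bit·-equal b ms@(m ∷ []) = E-exactly {t = t} x ((lh x ▷ (bit b · lh x)) · rh x) (rh x) ms
  (λ e → trans len (trans (cong suc (sym e)) (sym (cong (_+ h′) len-▷))) , λ i 1≤i _ → even i e)
  (λ e → trans len (sym e) , λ i 1≤i _ → trans
    (lhsʳ i (+-mono-≤ 1≤i (≤-trans (s≤s z≤n) (≤-reflexive (sym e)))))
                               (cong (varBits zero) (trans (cong (λ k → i + k ∸ 1) e)
                                 (cong (_∸ 1) (+-suc i h)))))
  where
  h = ⌊ m /2⌋
  h′ = ⌈ m /2⌉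
  t : Term 1
  t = rh (bit b · x)
  1+m : lenᵗ (bit b) ms + m ≡ suc m
  1+m = cong (_+ m) (len-bit b ms)
  len : lenᵗ t ms ≡ suc h
  len = cong ⌈_/2⌉ 1+m
  len-▷ : lenᵗ (lh x ▷ (bit b · lh x)) ms ≡ 1
  len-▷ = trans (cong (λ l → l + h ∸ h) (len-bit b ms)) (m+n∸n≡m 1 h)
  lhs : ∀ i → bitᵗ t ms i ≡ bitᵗ (bit b · x) ms (i + h′)
  lhs i = cong (λ l → bitᵗ (bit b · x) ms (i + ⌊ l /2⌋)) 1+m
  lhsʳ : ∀ i → 1 < i + h′ → bitᵗ t ms i ≡ varBits zero (i + h′ ∸ 1)
  lhsʳ i 1<i+h′ = trans (lhs i)
    (trans (bit-·ʳ (bit b) x ms (≤-trans (s≤s (≤-reflexive (len-bit b ms))) 1<i+h′))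
    (cong (λ l → varBits zero (i + h′ ∸ l)) (len-bit b ms)))
  even : ∀ i → h′ ≡ h → bitᵗ t ms i ≡ bitᵗ ((lh x ▷ (bit b · lh x)) · rh x) ms i
  even i e with i ≤? 1
  ... | yes i≤1 = trans (lhs i) (trans (bit-· (bit b) x ms (i + h′))
      (trans (sym (bit-· (bit b) (lh x) ms (i + h′)))
    (trans (cong (λ k → bitᵗ (bit b · lh x) ms (i + k)) e)
      (sym (bit-·ˡ (lh x ▷ (bit b · lh x)) (rh x) ms (≤-trans i≤1 (≤-reflexive (sym len-▷))))))))
  ... | no  i≰1 = trans (lhsʳ i (≤-trans (≰⇒> i≰1) (m≤m+n i h′))) (trans
    (cong (varBits zero) (trans (+-∸-comm h′ (<⇒≤ (≰⇒> i≰1))) (cong (i ∸ 1 +_) e)))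
    (sym (trans (bit-·ʳ (lh x ▷ (bit b · lh x)) (rh x) ms (≤-trans (s≤s (≤-reflexive len-▷)) (≰⇒> i≰1)))
                (cong (λ l → varBits zero (i ∸ l + h)) len-▷))))

∸+≡⊔ : ∀ m n → n ⊔ m ≡ (m ∸ n) + n
∸+≡⊔ m       zero    = sym (+-identityʳ m)
∸+≡⊔ zero    (suc n) = refl
∸+≡⊔ (suc m) (suc n) = trans (cong suc (∸+≡⊔ m n)) (sym (+-suc (m ∸ n) n))

-- The last bit of the guard is `⊥` syntactically, which singles out the first disjunct. The padding
-- in the term formula of `cond` coincides with the bits of `zeros (z ◁ y)`.
cond-0-equal : ∀ ms → EqualAt {4} (cond (w · 𝟎) x y z) (zeros (z ◁ y) · y) ms
cond-0-equal ms@(m ∷ n ∷ p ∷ q ∷ []) =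
  trans (len-cond (w · 𝟎) x y z ms len-w) (∸+≡⊔ p n) ,
  λ i _ _ → cond₀ (trans (bit-cond (w · 𝟎) x y z ms len-w i)
    (cong₂ (λ A B → (¬ A ∧ B) ∨ (A ∧ catBits (n ∸ p) ⊥s (varBits (suc (suc zero))) i))
       (bit-·ʳ w 𝟎 ms {suc q} ≤-refl) (sym (bit-· (zeros (z ◁ y)) y ms i))))
  where
  len-w : q + 1 ≡ suc q
  len-w = +-comm q 1

cond-1-equal : ∀ ms → EqualAt {4} (cond (w · 𝟏) x y z) (zeros (y ◁ z) · z) ms
cond-1-equal ms@(m ∷ n ∷ p ∷ q ∷ []) =
  trans (len-cond (w · 𝟏) x y z ms len-w) (trans (⊔-comm n p) (∸+≡⊔ n p)) ,
  λ i _ _ → cond₁ (trans (bit-cond (w · 𝟏) x y z ms len-w i)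
    (cong₂ (λ A B → (¬ A ∧ catBits (p ∸ n) ⊥s (varBits (suc zero)) i) ∨ (A ∧ B))
       (bit-·ʳ w 𝟏 ms {suc q} ≤-refl) (sym (bit-· (zeros (y ◁ z)) z ms i))))
  where
  len-w : q + 1 ≡ suc q
  len-w = +-comm q 1

·≐ε-formula : Formula 2
·≐ε-formula = x · y ≐ ε ⇒ x ≐ ε ∧ y ≐ ε

·≐ε-prf : ∀ ms → Prf (size (⟦ ·≐ε-formula ⟧ ms)) 3 (⟦ ·≐ε-formula ⟧ ms)
·≐ε-prf (0 ∷ 0 ∷ [])     = ∧-introʰ (⊤-introʰ (m≤m+n 3 2)) (⊤-introʰ (m≤m+n 3 2)) ≤-refl
·≐ε-prf (0 ∷ suc n ∷ []) = relax (s≤s z≤n) (by (# 46) (_ ∷ ⊤ ∷ ⊤ ∷ ⊤ ∷ ⊤ ∷ []) [] ≤-refl)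
·≐ε-prf (suc m ∷ n ∷ []) = relax (s≤s z≤n) (by (# 46) (_ ∷ ⊤ ∷ ⊤ ∷ ⊤ ∷ ⊤ ∷ []) [] ≤-refl)

·≐bit-formula : Bool → Formula 2
·≐bit-formula b = x · y ≐ bit b ⇒ (x ≐ ε ∧ y ≐ bit b) ∨ (x ≐ bit b ∧ y ≐ ε)

-- The antecedent translates to `⊥` unless the lengths add up to 1. Then one disjunct repeats the
-- antecedent beside a `⊤`, and the other consists of two equations of wrong length, hence of `⊥`s.
·≐bit-prf : ∀ b ms → Prf (size (⟦ ·≐bit-formula b ⟧ ms)) 1 (⟦ ·≐bit-formula b ⟧ ms)
·≐bit-prf false (0 ∷ 0 ∷ [])           = by (# 46) (_ ∷ ⊤ ∷ ⊤ ∷ ⊤ ∷ ⊤ ∷ []) [] ≤-refl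
·≐bit-prf false (0 ∷ 1 ∷ [])           = by (# 42) (_ ∷ ⊤ ∷ ⊤ ∷ ⊤ ∷ ⊤ ∷ []) [] ≤-refl
·≐bit-prf false (0 ∷ suc (suc n) ∷ []) = by (# 46) (_ ∷ ⊤ ∷ ⊤ ∷ ⊤ ∷ ⊤ ∷ []) [] ≤-refl
·≐bit-prf false (1 ∷ 0 ∷ [])           = by (# 43) (_ ∷ ⊤ ∷ ⊤ ∷ ⊤ ∷ ⊤ ∷ []) [] ≤-refl
·≐bit-prf false (1 ∷ suc n ∷ [])       = by (# 46) (_ ∷ ⊤ ∷ ⊤ ∷ ⊤ ∷ ⊤ ∷ []) [] ≤-refl
·≐bit-prf false (suc (suc m) ∷ n ∷ []) = by (# 46) (_ ∷ ⊤ ∷ ⊤ ∷ ⊤ ∷ ⊤ ∷ []) [] ≤-refl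
·≐bit-prf true  (0 ∷ 0 ∷ [])           = by (# 46) (_ ∷ ⊤ ∷ ⊤ ∷ ⊤ ∷ ⊤ ∷ []) [] ≤-refl
·≐bit-prf true  (0 ∷ 1 ∷ [])           = by (# 42) (_ ∷ ⊤ ∷ ⊤ ∷ ⊤ ∷ ⊤ ∷ []) [] ≤-refl
·≐bit-prf true  (0 ∷ suc (suc n) ∷ []) = by (# 46) (_ ∷ ⊤ ∷ ⊤ ∷ ⊤ ∷ ⊤ ∷ []) [] ≤-refl
·≐bit-prf true  (1 ∷ 0 ∷ [])           = by (# 43) (_ ∷ ⊤ ∷ ⊤ ∷ ⊤ ∷ ⊤ ∷ []) [] ≤-refl
·≐bit-prf true  (1 ∷ suc n ∷ [])       = by (# 46) (_ ∷ ⊤ ∷ ⊤ ∷ ⊤ ∷ ⊤ ∷ []) [] ≤-refl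
·≐bit-prf true  (suc (suc m) ∷ n ∷ []) = by (# 46) (_ ∷ ⊤ ∷ ⊤ ∷ ⊤ ∷ ⊤ ∷ []) [] ≤-refl

⟦≐ε⟧-⊤ : ∀ {t : Term n} {ms} → lenᵗ t ms ≡ 0 → ⟦ t ≐ ε ⟧ ms ≡ ⊤
⟦≐ε⟧-⊤ {t = t} {ms} e = trans (⟦≐⟧-≡ {t = t} {ε} e) (cong (λ l → ⋀ (applyUpTo (bitwise t ε ms) l)) e)

≐ε⇔≠ε-prf : ∀ (t u : Term n) ms → (lenᵗ t ms ≡ 0 × lenᵗ u ms ≢ 0) ⊎ (lenᵗ t ms ≢ 0 × lenᵗ u ms ≡ 0) →
            Prf (size (⟦ t ≐ ε ⇔ u ≠ ε ⟧ ms)) 1 (⟦ t ≐ ε ⇔ u ≠ ε ⟧ ms)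
≐ε⇔≠ε-prf t u ms (inj₁ (e , ≢)) rewrite ⟦≐ε⟧-⊤ {t = t} e | ⟦≐⟧-≢ {t = u} {ε} {ms} ≢ =
  by (# 44) (⊤ ∷ ⊤ ∷ ⊤ ∷ ⊤ ∷ ⊤ ∷ []) [] ≤-refl
≐ε⇔≠ε-prf t u ms (inj₂ (≢ , e)) rewrite ⟦≐ε⟧-⊤ {t = u} e | ⟦≐⟧-≢ {t = t} {ε} {ms} ≢ =
  by (# 45) (⊤ ∷ ⊤ ∷ ⊤ ∷ ⊤ ∷ ⊤ ∷ []) [] ≤-refl

-- The two axioms comparing lengths, for `▷` and for `◁`, both reduce to the alternative `m ≤ n` or
-- `n < m`.
∸-dichotomy : ∀ m n {o} → o ≡ suc n → (m ∸ n ≡ 0 × o ∸ m ≢ 0) ⊎ (m ∸ n ≢ 0 × o ∸ m ≡ 0)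
∸-dichotomy m n refl with m ≤? n
... | yes m≤n = inj₁ (m≤n⇒m∸n≡0 m≤n , λ e → <⇒≱ (s≤s m≤n) (m∸n≡0⇒m≤n e))
... | no  m≰n = inj₂ ((λ e → m≰n (m∸n≡0⇒m≤n e)) , m≤n⇒m∸n≡0 (≰⇒> m≰n))

string-provable : ∀ {A : Formula n} → StringAxiom A → Provable A
string-provable ε≠0 = provable-axiom {A = ε ≠ 𝟎} λ ms → by (# 40) (⊤ ∷ ⊤ ∷ ⊤ ∷ ⊤ ∷ ⊤ ∷ []) [] ≤-refl
string-provable 0≠1 = provable-axiom {A = 𝟎 ≠ 𝟏} λ ms → by (# 41) (⊤ ∷ ⊤ ∷ ⊤ ∷ ⊤ ∷ ⊤ ∷ []) [] ≤-refl
string-provable 1≠ε = provable-axiom {A = 𝟏 ≠ ε} λ ms → by (# 40) (⊤ ∷ ⊤ ∷ ⊤ ∷ ⊤ ∷ ⊤ ∷ []) [] ≤-refl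
string-provable ·-ε = equation {t = x · ε} {x} λ { ms@(m ∷ []) → exactly {t = x · ε} {x} (+-identityʳ m)
  λ i _ i≤ → bit-·ˡ x ε ms (≤-trans i≤ (≤-reflexive (+-identityʳ m))) }
string-provable (·-bit b) = equation {t = x · (y · bit b)} {(x · y) · bit b} (·-assoc-equal x y (bit b))
string-provable ·≐ε = provable {A = ·≐ε-formula} (⟦⟧-size ·≐ε-formula) (const-PB 3) ·≐ε-prf
string-provable (·≐bit b) = provable-axiom {A = ·≐bit-formula b} (·≐bit-prf b)
string-provable ε-▷ = equation {t = ε ▷ x} {x} λ { (m ∷ []) → exactly {t = ε ▷ x} {x} refl
  λ i _ _ → cong (varBits zero) (+-identityʳ i) }
string-provable (bit·-▷ b) = equation {t = (bit b · y) ▷ x} {bit b ▷ (y ▷ x)} λ { ms@(m ∷ n ∷ []) →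
  let l = lenᵗ (bit b) ms in
  exactly {t = (bit b · y) ▷ x} {bit b ▷ (y ▷ x)} (trans (cong (m ∸_) (+-comm l n)) (sym (∸-+-assoc m n l)))
    λ i _ _ → cong (varBits zero) (sym (+-assoc i l n)) }
string-provable (bit-▷-ε b) = equation {t = bit b ▷ ε} {ε} λ ms →
  vacuous {t = bit b ▷ ε} {ε} (0∸n≡0 (lenᵗ (bit b) ms)) refl
string-provable (bit-▷ b c) = equation {t = bit b ▷ (bit c · x)} {x} λ { ms@(m ∷ []) →
  exactly {t = bit b ▷ (bit c · x)} {x} (cong₂ (λ k l → k + m ∸ l) (len-bit c ms) (len-bit b ms))
    λ i 1≤i _ → begin
      bitᵗ (bit c · x) ms (i + lenᵗ (bit b) ms) ≡⟨ cong (λ l → bitᵗ (bit c · x) ms (i + l)) (len-bit b ms) ⟩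
      bitᵗ (bit c · x) ms (i + 1)               ≡⟨ bit-·ʳ (bit c) x ms
        (≤-trans (s≤s (≤-reflexive (len-bit c ms))) (+-monoˡ-≤ 1 1≤i)) ⟩
      varBits zero (i + 1 ∸ lenᵗ (bit c) ms)    ≡⟨ cong (λ l → varBits zero (i + 1 ∸ l)) (len-bit c ms) ⟩
      varBits zero (i + 1 ∸ 1)                  ≡⟨ cong (varBits zero) (m+n∸n≡m i 1) ⟩
      varBits zero i                            ∎ }
  where open ≡-Reasoning
string-provable (▷≐ε b) = provable-axiom {A = y ▷ x ≐ ε ⇔ x ▷ (y · bit b) ≠ ε} λ { ms@(m ∷ n ∷ []) →
  ≐ε⇔≠ε-prf (y ▷ x) (x ▷ (y · bit b)) ms
    (∸-dichotomy m n (trans (cong (n +_) (len-bit b ms)) (+-comm n 1))) }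
string-provable ◁-ε = equation {t = x ◁ ε} {x} λ { (m ∷ []) → exactly {t = x ◁ ε} {x} refl λ _ _ _ → refl }
string-provable (◁-·bit b) = equation {t = x ◁ (y · bit b)} {(x ◁ y) ◁ bit b} λ { ms@(m ∷ n ∷ []) →
  exactly {t = x ◁ (y · bit b)} {(x ◁ y) ◁ bit b} (sym (∸-+-assoc m n (lenᵗ (bit b) ms))) λ _ _ _ → refl }
string-provable (ε-◁-bit b) = equation {t = ε ◁ bit b} {ε} λ ms →
  vacuous {t = ε ◁ bit b} {ε} (0∸n≡0 (lenᵗ (bit b) ms)) refl
string-provable (◁-bit b c) = equation {t = (x · bit c) ◁ bit b} {x} λ { ms@(m ∷ []) →
  let len = trans (cong₂ (λ k l → m + k ∸ l) (len-bit c ms) (len-bit b ms)) (m+n∸n≡m m 1) in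
  exactly {t = (x · bit c) ◁ bit b} {x} len λ i _ i≤ → bit-·ˡ x (bit c) ms (≤-trans i≤ (≤-reflexive len)) }
string-provable (◁≐ε b) = provable-axiom {A = x ◁ y ≐ ε ⇔ (bit b · y) ◁ x ≠ ε} λ { ms@(m ∷ n ∷ []) →
  ≐ε⇔≠ε-prf (x ◁ y) ((bit b · y) ◁ x) ms (∸-dichotomy m n (cong (_+ n) (len-bit b ms))) }
string-provable zeros-ε = equation {t = zeros ε} {ε} λ ms → vacuous {t = zeros ε} {ε} refl refl
string-provable (zeros-· b) = equation {t = zeros (x · bit b)} {zeros x · 𝟎} λ { ms@(m ∷ []) →
  exactly {t = zeros (x · bit b)} {zeros x · 𝟎} (cong (m +_) (len-bit b ms))
    λ i _ _ → sym (trans (bit-· (zeros x) 𝟎 ms i) (catBits-elim (_≡ ⊥) m ⊥s ⊥s i (λ _ → refl)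
      (λ _ → refl))) }
string-provable ones-ε = equation {t = ones ε} {ε} λ ms → vacuous {t = ones ε} {ε} refl refl
string-provable (ones-· b) = equation {t = ones (x · bit b)} {ones x · 𝟏} λ { ms@(m ∷ []) →
  exactly {t = ones (x · bit b)} {ones x · 𝟏} (cong (m +_) (len-bit b ms))
    λ i _ _ → sym (trans (bit-· (ones x) 𝟏 ms i) (catBits-elim (_≡ ⊤) m (λ _ → ⊤) (λ _ → ⊤) i (λ _ → refl)
      (λ _ → refl))) }
string-provable cond-ε = equation {t = cond ε x y z} {x} λ { (m ∷ _ ∷ _ ∷ []) →
  exactly {t = cond ε x y z} {x} refl λ _ _ _ → refl }
string-provable cond-0 = equation {t = cond (w · 𝟎) x y z} {zeros (z ◁ y) · y} cond-0-equal
string-provable cond-1 = equation {t = cond (w · 𝟏) x y z} {zeros (y ◁ z) · z} cond-1-equal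
string-provable lh·rh = equation {t = lh x · rh x} {x} λ { ms@(m ∷ []) →
  exactly {t = lh x · rh x} {x} (⌊n/2⌋+⌈n/2⌉≡n m) λ i _ _ → bits ms i }
  where
  bits : ∀ ms i → bitᵗ (lh x · rh x) ms i ≡ varBits zero i
  bits ms@(m ∷ []) i with i ≤? ⌊ m /2⌋
  ... | yes i≤ = bit-·ˡ (lh x) (rh x) ms i≤
  ... | no  i≰ = trans (bit-·ʳ (lh x) (rh x) ms (≰⇒> i≰)) (cong (varBits zero) (m∸n+n≡m (<⇒≤ (≰⇒> i≰))))
string-provable lh◁rh = equation {t = lh x ◁ rh x} {ε} λ { (m ∷ []) →
  vacuous {t = lh x ◁ rh x} {ε} (m≤n⇒m∸n≡0 (⌊n/2⌋≤⌈n/2⌉ m)) refl }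
string-provable 1▷lh▷rh = equation {t = 𝟏 ▷ (lh x ▷ rh x)} {ε} λ { (m ∷ []) →
  vacuous {t = 𝟏 ▷ (lh x ▷ rh x)} {ε} (len m) refl }
  where
  len : ∀ m → ⌈ m /2⌉ ∸ ⌊ m /2⌋ ∸ 1 ≡ 0
  len m with ⌈/2⌉-parity m
  ... | inj₁ e = cong (_∸ 1) (trans (cong (_∸ ⌊ m /2⌋) e) (n∸n≡0 ⌊ m /2⌋))
  ... | inj₂ e = cong (_∸ 1) (trans (cong (_∸ ⌊ m /2⌋) e) (m+n∸n≡m 1 ⌊ m /2⌋))
string-provable (lh-·bit b) = equation {t = lh (x · bit b)} {E x (lh x) (lh x · ((rh x · bit b) ◁ rh x))}
  (lh-·bit-equal b)
string-provable (rh-·bit b) = equation {t = rh (x · bit b)} {E x (rh x · bit b) (𝟏 ▷ (rh x · bit b))}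
  (rh-·bit-equal b)
string-provable (lh-bit· b) = equation {t = lh (bit b · x)} {E x ((bit b · lh x) ◁ 𝟏) (bit b · lh x)}
  (lh-bit·-equal b)
string-provable (rh-bit· b) = equation {t = rh (bit b · x)} {E x ((lh x ▷ (bit b · lh x)) · rh x) (rh x)}
  (rh-bit·-equal b)

-- Defining axioms

lenᵗˢ-tabulate : ∀ (f : Fin k → Fin n) ms → lenᵗˢ (tabulate (λ j → var (f j))) ms ≡ tabulate
  (λ j → lookup ms (f j))
lenᵗˢ-tabulate {zero}  f ms = refl
lenᵗˢ-tabulate {suc k} f ms = cong (lookup ms (f zero) ∷_) (lenᵗˢ-tabulate (f ∘ suc) ms)

bitᵗˢ-tabulate : ∀ (f : Fin k → Fin n) ms → bitᵗˢ (tabulate (λ j → var (f j))) ms ≡ tabulate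
  (λ j → varBits (f j))
bitᵗˢ-tabulate {zero}  f ms = refl
bitᵗˢ-tabulate {suc k} f ms = cong (varBits (f zero) ∷_) (bitᵗˢ-tabulate (f ∘ suc) ms)

lookup-++ʳ : ∀ (ks : Vec ℕ k) (ns : Vec ℕ n) j → lookup (ks ++ ns) (k ↑ʳ j) ≡ lookup ns j
lookup-++ʳ []       ns j = refl
lookup-++ʳ (_ ∷ ks) ns j = lookup-++ʳ ks ns j

lenᵗˢ-vars : ∀ (ks : Vec ℕ k) (ns : Vec ℕ n) → lenᵗˢ (vars k) (ks ++ ns) ≡ ns
lenᵗˢ-vars {k} ks ns = trans (lenᵗˢ-tabulate (k ↑ʳ_) (ks ++ ns))
  (trans (tabulate-cong (lookup-++ʳ ks ns)) (tabulate∘lookup ns))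

bitᵗˢ-vars : ∀ k (ms : Vec ℕ (k + n)) → bitᵗˢ (vars k) ms ≡ varsBits k
bitᵗˢ-vars k ms = bitᵗˢ-tabulate (k ↑ʳ_) ms

lookup-varsBits : ∀ k (j : Fin n) → lookup (varsBits k) j ≡ varBits (k ↑ʳ j)
lookup-varsBits k j = lookup∘tabulate (λ j → varBits (k ↑ʳ j)) j

[varsBits] : (A : Form (Atom n)) → A [ varsBits 0 ]ᵖ ≡ A
[varsBits] A = trans (sub-ext′ (λ (j , i) → cong (λ b → b i) (lookup-varsBits 0 j)) A) (sub-atom A)

lenᵗˢ-++ : ∀ (ts : Vec (Term n) k) (us : Vec (Term n) l) ms → lenᵗˢ (ts ++ us) ms ≡ lenᵗˢ ts ms ++ lenᵗˢ us
  ms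
lenᵗˢ-++ []       us ms = refl
lenᵗˢ-++ (t ∷ ts) us ms = cong (lenᵗ t ms ∷_) (lenᵗˢ-++ ts us ms)

bitᵗˢ-++ : ∀ (ts : Vec (Term n) k) (us : Vec (Term n) l) ms → bitᵗˢ (ts ++ us) ms ≡ bitᵗˢ ts ms ++ bitᵗˢ us
  ms
bitᵗˢ-++ []       us ms = refl
bitᵗˢ-++ (t ∷ ts) us ms = cong (bitᵗ t ms ∷_) (bitᵗˢ-++ ts us ms)

lam-β-equal : ∀ (t : Term n) ms → EqualAt (lam t ⟨ vars 0 ⟩) t ms
lam-β-equal t ms = exactly {t = lam t ⟨ vars 0 ⟩} {t} (cong (lenᵗ t) (lenᵗˢ-vars [] ms))
  λ i _ _ → trans (cong₂ (λ ls bs → bitᵗ t ls i [ bs ]ᵖ) (lenᵗˢ-vars [] ms) (bitᵗˢ-vars 0 ms))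
    ([varsBits] (bitᵗ t ms i))

module _ {n} (h : Symbol (suc n)) (s : Term (suc n)) (m : ℕ) (ns : Vec ℕ n) where

  private
    ms : Vec ℕ (suc n)
    ms = m ∷ ns

  len-h : lenᵗ (h ⟨ s ∷ vars 1 ⟩) ms ≡ lenˢ h (lenᵗ s ms ∷ ns)
  len-h = cong (λ ls → lenˢ h (lenᵗ s ms ∷ ls)) (lenᵗˢ-vars (m ∷ []) ns)

  bit-h : ∀ i → bitᵗ (h ⟨ s ∷ vars 1 ⟩) ms i ≡ bitˢ h (lenᵗ s ms ∷ ns) i [ bitᵗ s ms ∷ varsBits 1 ]ᵖ
  bit-h i = cong₂ (λ ls bs → bitˢ h (lenᵗ s ms ∷ ls) i [ bitᵗ s ms ∷ bs ]ᵖ) (lenᵗˢ-vars (m ∷ []) ns)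
    (bitᵗˢ-vars 1 ms)

  bit-ℓCRN : ∀ i → let ms′ = (lenᵗ s ms ∸ i + 1) ∷ ns in
    bitᵗ (ℓCRN h ⟨ s ∷ vars 1 ⟩) ms i
      ≡ catBits (lenˢ h ms′) (bitˢ h ms′) ⊥s 1 [ (λ j → bitᵗ s ms (j + i ∸ 1)) ∷ varsBits 1 ]ᵖ
  bit-ℓCRN i = begin
    bitᵗ (ℓCRN h ⟨ s ∷ vars 1 ⟩) ms i
      ≡⟨ cong₂ (λ ls bs → bitˢ (ℓCRN h) (lenᵗ s ms ∷ ls) i [ bitᵗ s ms ∷ bs ]ᵖ) (lenᵗˢ-vars (m ∷ []) ns)
        (bitᵗˢ-vars 1 ms) ⟩
    A [ (λ j → varBits zero (j + i ∸ 1)) ∷ varsBits 1 ]ᵖ [ bitᵗ s ms ∷ varsBits 1 ]ᵖ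
      ≡⟨ sub-sub _ _ A ⟩
    subᵖ (λ (j , i′) → lookup ((λ j → varBits zero (j + i ∸ 1)) ∷ varsBits 1) j i′
      [ bitᵗ s ms ∷ varsBits 1 ]ᵖ) A
      ≡⟨ sub-ext′ (λ { (zero , _) → refl
                     ; (suc j , i′) → cong (λ b → b i′ [ bitᵗ s ms ∷ varsBits 1 ]ᵖ) (lookup-varsBits 1 j)
                       }) A ⟩
    A [ (λ j → bitᵗ s ms (j + i ∸ 1)) ∷ varsBits 1 ]ᵖ ∎
    where
    open ≡-Reasoning
    ms′ = (lenᵗ s ms ∸ i + 1) ∷ ns
    A : Form (Atom (suc n))
    A = catBits (lenˢ h ms′) (bitˢ h ms′) ⊥s 1

  bit-rCRN : ∀ i → let ms′ = i ∷ ns in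
    bitᵗ (rCRN h ⟨ s ∷ vars 1 ⟩) ms i
      ≡ catBits 1 ⊥s (bitˢ h ms′) (suc (lenˢ h ms′)) [ bitᵗ s ms ∷ varsBits 1 ]ᵖ
  bit-rCRN i = cong₂ (λ ls bs → bitˢ (rCRN h) (lenᵗ s ms ∷ ls) i [ bitᵗ s ms ∷ bs ]ᵖ)
                 (lenᵗˢ-vars (m ∷ []) ns) (bitᵗˢ-vars 1 ms)

-- Each bit of `ℓCRN` depends only on the suffix of x starting there. So a bit put in front of x
-- moves the old bits of the value by one place and adds a single new one.
ℓCRN-bit·-equal : ∀ (h : Symbol (suc n)) b ms → let hix = h ⟨ (bit b · x) ∷ vars 1 ⟩ in
  EqualAt (ℓCRN h ⟨ (bit b · x) ∷ vars 1 ⟩) (((hix · 𝟎) ◁ hix) · ℓCRN h ⟨ x ∷ vars 1 ⟩) ms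
ℓCRN-bit·-equal {n} h b ms@(m ∷ ns) = exactly {t = ℓCRN h ⟨ bx ∷ vars 1 ⟩} {first · rest}
  (cong (_+ m) (trans (len-bit b ms) (sym len-first))) λ i 1≤i _ → bits i 1≤i
  where
  open ≡-Reasoning
  bx hix first rest : Term (suc n)
  bx = bit b · x
  hix = h ⟨ bx ∷ vars 1 ⟩
  first = (hix · 𝟎) ◁ hix
  rest = ℓCRN h ⟨ x ∷ vars 1 ⟩
  len-first : lenᵗ first ms ≡ 1
  len-first = m+n∸m≡n (lenᵗ hix ms) 1
  len-bx : lenᵗ bx ms ≡ suc m
  len-bx = cong (_+ m) (len-bit b ms)
  A : ℕ → Form (Atom (suc n))
  A l = catBits (lenˢ h (l ∷ ns)) (bitˢ h (l ∷ ns)) ⊥s 1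
  bits : ∀ i → 1 ≤ i → bitᵗ (ℓCRN h ⟨ bx ∷ vars 1 ⟩) ms i ≡ bitᵗ (first · rest) ms i
  bits 1 _ = begin
    bitᵗ (ℓCRN h ⟨ bx ∷ vars 1 ⟩) ms 1
      ≡⟨ bit-ℓCRN h bx m ns 1 ⟩
    A (lenᵗ bx ms ∸ 1 + 1) [ (λ j → bitᵗ bx ms (j + 1 ∸ 1)) ∷ varsBits 1 ]ᵖ
      ≡⟨ cong (λ l → A l [ (λ j → bitᵗ bx ms (j + 1 ∸ 1)) ∷ varsBits 1 ]ᵖ)
           (trans (cong (λ l → l ∸ 1 + 1) len-bx) (trans (+-comm m 1) (sym len-bx))) ⟩
    A (lenᵗ bx ms) [ (λ j → bitᵗ bx ms (j + 1 ∸ 1)) ∷ varsBits 1 ]ᵖ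
      ≡⟨ sub-ext′ (λ { (zero , j) → cong (bitᵗ bx ms) (m+n∸n≡m j 1) ; (suc j , _) → refl })
        (A (lenᵗ bx ms)) ⟩
    A (lenᵗ bx ms) [ bitᵗ bx ms ∷ varsBits 1 ]ᵖ
      ≡⟨ sub-catBits _ (lenˢ h (lenᵗ bx ms ∷ ns)) (bitˢ h (lenᵗ bx ms ∷ ns)) ⊥s 1 ⟩
    catBits (lenˢ h (lenᵗ bx ms ∷ ns)) (λ i → bitˢ h (lenᵗ bx ms ∷ ns) i [ bitᵗ bx ms ∷ varsBits 1 ]ᵖ) ⊥s 1
      ≡⟨ cong₂ (λ l A → Bool.if 1 ≤ᵇ l then A else ⊥) (len-h h bx m ns) (bit-h h bx m ns 1) ⟨
    catBits (lenᵗ hix ms) (bitᵗ hix ms) ⊥s 1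
      ≡⟨ bit-· hix 𝟎 ms 1 ⟨
    bitᵗ first ms 1
      ≡⟨ bit-·ˡ first rest ms (≤-reflexive (sym len-first)) ⟨
    bitᵗ (first · rest) ms 1 ∎
  bits (suc (suc i)) _ = begin
    bitᵗ (ℓCRN h ⟨ bx ∷ vars 1 ⟩) ms (2 + i)
      ≡⟨ bit-ℓCRN h bx m ns (2 + i) ⟩
    A (lenᵗ bx ms ∸ (2 + i) + 1) [ (λ j → bitᵗ bx ms (j + (2 + i) ∸ 1)) ∷ varsBits 1 ]ᵖ
      ≡⟨ cong (λ l → A (l ∸ (2 + i) + 1) [ (λ j → bitᵗ bx ms (j + (2 + i) ∸ 1)) ∷ varsBits 1 ]ᵖ) len-bx ⟩
    A (m ∸ suc i + 1) [ (λ j → bitᵗ bx ms (j + (2 + i) ∸ 1)) ∷ varsBits 1 ]ᵖ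
      -- The two index shifts agree only for `j ≥ 1`, hence the appeal to scopes.
      ≡⟨ []-ext {ms = (m ∸ suc i + 1) ∷ ns} {(λ j → bitᵗ bx ms (j + (2 + i) ∸ 1)) ∷ varsBits 1}
        (firstBit-scoped h ((m ∸ suc i + 1) ∷ ns))
           {(λ j → bitᵗ x ms (j + suc i ∸ 1)) ∷ varsBits 1}
             (λ { zero j 1≤j _ → shift j 1≤j ; (suc j) _ _ _ → refl }) ⟩
    A (m ∸ suc i + 1) [ (λ j → bitᵗ x ms (j + suc i ∸ 1)) ∷ varsBits 1 ]ᵖ
      ≡⟨ bit-ℓCRN h x m ns (suc i) ⟨
    bitᵗ rest ms (suc i)
      ≡⟨ cong (λ l → bitᵗ rest ms (2 + i ∸ l)) len-first ⟨
    bitᵗ rest ms (2 + i ∸ lenᵗ first ms)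
      ≡⟨ bit-·ʳ first rest ms (≤-trans (s≤s (≤-reflexive len-first)) (s≤s (s≤s z≤n))) ⟨
    bitᵗ (first · rest) ms (2 + i) ∎
    where
    shift : ∀ j → 1 ≤ j → bitᵗ bx ms (j + (2 + i) ∸ 1) ≡ varBits zero (j + suc i ∸ 1)
    shift j 1≤j = begin
      bitᵗ bx ms (j + (2 + i) ∸ 1)            ≡⟨ cong (λ k → bitᵗ bx ms (k ∸ 1)) (+-suc j (suc i)) ⟩
      bitᵗ bx ms (j + suc i)                  ≡⟨ bit-·ʳ (bit b) x ms
        (≤-trans (s≤s (≤-reflexive (len-bit b ms))) (+-mono-≤ 1≤j (s≤s z≤n))) ⟩
      varBits zero (j + suc i ∸ lenᵗ (bit b) ms) ≡⟨ cong (λ l → varBits zero (j + suc i ∸ l))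
        (len-bit b ms) ⟩
      varBits zero (j + suc i ∸ 1)            ∎

-- Each bit of `rCRN` depends only on the prefix of x ending there, so the old bits stay the same
-- when a bit is appended; only bit `suc m` is new.
rCRN-·bit-equal : ∀ (h : Symbol (suc n)) b ms → let hxi = h ⟨ (x · bit b) ∷ vars 1 ⟩ in
  EqualAt (rCRN h ⟨ (x · bit b) ∷ vars 1 ⟩) (rCRN h ⟨ x ∷ vars 1 ⟩ · (hxi ▷ (𝟎 · hxi))) ms
rCRN-·bit-equal {n} h b ms@(m ∷ ns) = exactly {t = rCRN h ⟨ xb ∷ vars 1 ⟩} {rest · last}
  (cong (m +_) (trans (len-bit b ms) (sym len-last))) λ i _ i≤ → bits i (≤-trans i≤ (≤-reflexive len-xb))
  where
  open ≡-Reasoning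
  xb hxi last rest : Term (suc n)
  xb = x · bit b
  hxi = h ⟨ xb ∷ vars 1 ⟩
  last = hxi ▷ (𝟎 · hxi)
  rest = rCRN h ⟨ x ∷ vars 1 ⟩
  len-last : lenᵗ last ms ≡ 1
  len-last = m+n∸n≡m 1 (lenᵗ hxi ms)
  len-xb : lenᵗ xb ms ≡ suc m
  len-xb = trans (cong (m +_) (len-bit b ms)) (+-comm m 1)
  A : ℕ → Form (Atom (suc n))
  A l = catBits 1 ⊥s (bitˢ h (l ∷ ns)) (suc (lenˢ h (l ∷ ns)))
  bits : ∀ i → i ≤ suc m → bitᵗ (rCRN h ⟨ xb ∷ vars 1 ⟩) ms i ≡ bitᵗ (rest · last) ms i
  bits i i≤ with i ≤? m
  ... | yes i≤m = begin
    bitᵗ (rCRN h ⟨ xb ∷ vars 1 ⟩) ms i     ≡⟨ bit-rCRN h xb m ns i ⟩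
    A i [ bitᵗ xb ms ∷ varsBits 1 ]ᵖ
      ≡⟨ []-ext {ms = i ∷ ns} {bitᵗ xb ms ∷ varsBits 1} (lastBit-scoped h (i ∷ ns)) {bitᵗ x ms ∷ varsBits 1}
           (λ { zero j _ j≤ → bit-·ˡ x (bit b) ms (≤-trans j≤ i≤m) ; (suc j) _ _ _ → refl }) ⟩
    A i [ bitᵗ x ms ∷ varsBits 1 ]ᵖ        ≡⟨ bit-rCRN h x m ns i ⟨
    bitᵗ rest ms i                         ≡⟨ bit-·ˡ rest last ms i≤m ⟨
    bitᵗ (rest · last) ms i                ∎
  ... | no i≰m with ≤-antisym i≤ (≰⇒> i≰m)
  ...   | refl = begin
    bitᵗ (rCRN h ⟨ xb ∷ vars 1 ⟩) ms (suc m) ≡⟨ bit-rCRN h xb m ns (suc m) ⟩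
    A (suc m) [ bitᵗ xb ms ∷ varsBits 1 ]ᵖ
      ≡⟨ cong (λ l → A l [ bitᵗ xb ms ∷ varsBits 1 ]ᵖ) len-xb ⟨
    A (lenᵗ xb ms) [ bitᵗ xb ms ∷ varsBits 1 ]ᵖ
      ≡⟨ sub-catBits _ 1 ⊥s (bitˢ h (lenᵗ xb ms ∷ ns)) (suc (lenˢ h (lenᵗ xb ms ∷ ns))) ⟩
    catBits 1 ⊥s (λ i → bitˢ h (lenᵗ xb ms ∷ ns) i [ bitᵗ xb ms ∷ varsBits 1 ]ᵖ)
      (suc (lenˢ h (lenᵗ xb ms ∷ ns)))
      ≡⟨ cong₂ (λ l A → Bool.if suc l ≤ᵇ 1 then ⊥ else A) (len-h h xb m ns)
           (trans (bit-h h xb m ns (lenᵗ hxi ms))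
             (cong (λ i → bitˢ h (lenᵗ xb ms ∷ ns) i [ bitᵗ xb ms ∷ varsBits 1 ]ᵖ) (len-h h xb m ns))) ⟨
    catBits 1 ⊥s (bitᵗ hxi ms) (suc (lenᵗ hxi ms))
      ≡⟨ bit-· 𝟎 hxi ms (suc (lenᵗ hxi ms)) ⟨
    bitᵗ last ms 1
      ≡⟨ cong (bitᵗ last ms) (m+n∸n≡m 1 m) ⟨
    bitᵗ last ms (suc m ∸ m)
      ≡⟨ bit-·ʳ rest last ms ≤-refl ⟨
    bitᵗ (rest · last) ms (suc m) ∎

module _ {n} (g : Symbol (2 + n)) (h : Symbol (2 + (n + 2))) (hℓ hr : Symbol 1)
         (e : rank h ≡ 0) (eℓ : rank hℓ ≡ 0) (er : rank hr ≡ 0) where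

  private
    f = TRN g h hℓ hr e eℓ er
    z′ : Term (2 + n)
    z′ = var (suc zero)
    fx fℓ fr t : Term (2 + n)
    fx = f ⟨ x ∷ z′ ∷ vars 2 ⟩
    fℓ = f ⟨ lh x ∷ hℓ ⟨ z′ ∷ [] ⟩ ∷ vars 2 ⟩
    fr = f ⟨ rh x ∷ hr ⟨ z′ ∷ [] ⟩ ∷ vars 2 ⟩
    t  = h ⟨ x ∷ z′ ∷ vars 2 ++ fℓ ∷ fr ∷ [] ⟩

  TRN-len : ∀ k p ns → lenᵗ fx (2 + k ∷ p ∷ ns) ≡ lenᵗ t (2 + k ∷ p ∷ ns)
  TRN-len k p ns = trans (lenˢ-TRN-step g h hℓ hr {e} {eℓ} {er} k p (lenᵗˢ (vars 2) ms))
    (cong (λ ls → lenˢ h (2 + k ∷ p ∷ ls)) (sym (lenᵗˢ-++ (vars 2) (fℓ ∷ fr ∷ []) ms)))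
    where
    ms = 2 + k ∷ p ∷ ns

  TRN-bit : ∀ k p ns i → bitᵗ fx (2 + k ∷ p ∷ ns) i ≡ bitᵗ t (2 + k ∷ p ∷ ns) i
  TRN-bit k p ns i = begin
    bitᵗ fx ms i
      ≡⟨ cong (λ bs → bitˢ f (2 + k ∷ p ∷ L) i [ varBits zero ∷ varBits (suc zero) ∷ bs ]ᵖ)
        (bitᵗˢ-vars 2 ms) ⟩
    bitˢ f (2 + k ∷ p ∷ L) i [ varsBits 0 ]ᵖ
      ≡⟨ [varsBits] (bitˢ f (2 + k ∷ p ∷ L) i) ⟩
    bitˢ f (2 + k ∷ p ∷ L) i
      ≡⟨ []-ext′ {bs = bx ∷ bz ∷ varsBits 2 ++ Fℓ ∷ Fr ∷ []} {bx ∷ bz ∷ varsBits 2 ++ bitᵗ fℓ ms ∷ bitᵗ fr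
        ms ∷ []}
           ((λ _ → refl) ∷ (λ _ → refl) ∷ ++⁺ (Pointwise.refl (λ _ → refl)) (ℓ-bits ∷ r-bits ∷ []))
           (bitˢ h (2 + k ∷ p ∷ L ++ lenᵗ fℓ ms ∷ lenᵗ fr ms ∷ []) i) ⟩
    bitˢ h (2 + k ∷ p ∷ L ++ lenᵗ fℓ ms ∷ lenᵗ fr ms ∷ []) i [ bx ∷ bz ∷ varsBits 2 ++ bitᵗ fℓ ms ∷ bitᵗ fr
      ms ∷ [] ]ᵖ
      ≡⟨ cong (λ bs → bitˢ h (2 + k ∷ p ∷ L ++ lenᵗ fℓ ms ∷ lenᵗ fr ms ∷ []) i [ bx ∷ bz ∷ bs ++ bitᵗ fℓ ms
        ∷ bitᵗ fr ms ∷ [] ]ᵖ)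
           (bitᵗˢ-vars 2 ms) ⟨
    bitˢ h (2 + k ∷ p ∷ L ++ lenᵗ fℓ ms ∷ lenᵗ fr ms ∷ []) i [ bx ∷ bz ∷ bitᵗˢ (vars 2) ms ++ bitᵗ fℓ ms ∷
      bitᵗ fr ms ∷ [] ]ᵖ
      ≡⟨ cong₂ (λ ls bs → bitˢ h (2 + k ∷ p ∷ ls) i [ bx ∷ bz ∷ bs ]ᵖ)
           (lenᵗˢ-++ (vars 2) (fℓ ∷ fr ∷ []) ms) (bitᵗˢ-++ (vars 2) (fℓ ∷ fr ∷ []) ms) ⟨
    bitᵗ t ms i ∎
    where
    open ≡-Reasoning
    ms = 2 + k ∷ p ∷ ns
    L = lenᵗˢ (vars 2) ms
    bx bz Fℓ Fr : Bits (Atom (2 + n))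
    bx = varBits zero
    bz = varBits (suc zero)
    bits : (m p : ℕ) → Acc _<_ m → Bits (Atom (2 + n))
    bits m p = bitsTRN (lenˢ hℓ) (lenˢ hr) (lenˢ f) (bitˢ g) (bitˢ h) (bitˢ hℓ) (bitˢ hr) m p L
    rs : ∀ {m} → m < 2 + k → Acc _<_ m
    rs = acc-inverse (<-wellFounded (2 + k))
    Fℓ i′ = bits ⌊ 2 + k /2⌋ (lenˢ hℓ (p ∷ [])) (rs (⌊n/2⌋<n (suc k))) i′
              [ bx ∷ (λ j → bitˢ hℓ (p ∷ []) j [ bz ∷ [] ]ᵖ) ∷ varsBits 2 ]ᵖ
    Fr i′ = bits ⌈ 2 + k /2⌉ (lenˢ hr (p ∷ [])) (rs (⌈n/2⌉<n k)) i′
              [ (λ j → bx (j + ⌊ 2 + k /2⌋)) ∷ (λ j → bitˢ hr (p ∷ []) j [ bz ∷ [] ]ᵖ) ∷ varsBits 2 ]ᵖ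
    ℓ-bits : Fℓ ≗ᵇ bitᵗ fℓ ms
    ℓ-bits i′ = cong₂ (λ A bs → A [ bx ∷ (λ j → bitˢ hℓ (p ∷ []) j [ bz ∷ [] ]ᵖ) ∷ bs ]ᵖ)
      (bitsTRN-irrelevant _ _ _ _ _ _ _ ⌊ 2 + k /2⌋ (lenˢ hℓ (p ∷ [])) L _ _ i′) (sym (bitᵗˢ-vars 2 ms))
    r-bits : Fr ≗ᵇ bitᵗ fr ms
    r-bits i′ = cong₂ (λ A bs → A [ (λ j → bx (j + ⌊ 2 + k /2⌋)) ∷ (λ j → bitˢ hr (p ∷ []) j [ bz ∷ [] ]ᵖ)
      ∷ bs ]ᵖ)
      (bitsTRN-irrelevant _ _ _ _ _ _ _ ⌈ 2 + k /2⌉ (lenˢ hr (p ∷ [])) L _ _ i′) (sym (bitᵗˢ-vars 2 ms))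

  -- For |x| at most 1 the guard `x ◁ 𝟏` is empty and both sides compute to `g`. Otherwise it is
  -- nonempty, and the `cond` has equal branches, whose bits `TRN-bit` identifies with those of `f`.
  TRN-equal : ∀ ms → EqualAt fx (cond (x ◁ 𝟏) (g ⟨ x ∷ z′ ∷ vars 2 ⟩) t t) ms
  TRN-equal (0 ∷ p ∷ ns) = refl , λ _ _ _ → same refl
  TRN-equal (1 ∷ p ∷ ns) = refl , λ _ _ _ → same refl
  TRN-equal ms@(suc (suc k) ∷ p ∷ ns) =
    trans (TRN-len k p ns) (sym (len-cond= (x ◁ 𝟏) (g ⟨ x ∷ z′ ∷ vars 2 ⟩) t ms refl)) ,
    λ i 1≤i _ → ≡.subst (λ A → BitEq A (bitᵗ (cond (x ◁ 𝟏) (g ⟨ x ∷ z′ ∷ vars 2 ⟩) t t) ms i))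
      (sym (TRN-bit k p ns i))
      (cond= (bit-cond= (x ◁ 𝟏) (g ⟨ x ∷ z′ ∷ vars 2 ⟩) t ms refl i 1≤i))

def-provable : ∀ {A : Formula n} → DefAxiom A → Provable A
def-provable (lam-β t) = equation {t = lam t ⟨ vars 0 ⟩} {t} (lam-β-equal t)
def-provable (ℓCRN-ε h) = equation {t = ℓCRN h ⟨ ε ∷ vars 0 ⟩} {ε} λ ms →
  vacuous {t = ℓCRN h ⟨ ε ∷ vars 0 ⟩} {ε} refl refl
def-provable (ℓCRN-bit· h b) = let hix = h ⟨ (bit b · x) ∷ vars 1 ⟩ in
  equation {t = ℓCRN h ⟨ (bit b · x) ∷ vars 1 ⟩} {((hix · 𝟎) ◁ hix) · ℓCRN h ⟨ x ∷ vars 1 ⟩}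
    (ℓCRN-bit·-equal h b)
def-provable (rCRN-ε h) = equation {t = rCRN h ⟨ ε ∷ vars 0 ⟩} {ε} λ ms →
  vacuous {t = rCRN h ⟨ ε ∷ vars 0 ⟩} {ε} refl refl
def-provable (rCRN-·bit h b) = let hxi = h ⟨ (x · bit b) ∷ vars 1 ⟩ in
  equation {t = rCRN h ⟨ (x · bit b) ∷ vars 1 ⟩} {rCRN h ⟨ x ∷ vars 1 ⟩ · (hxi ▷ (𝟎 · hxi))}
    (rCRN-·bit-equal h b)
def-provable (TRN-def g h hℓ hr e eℓ er) = equation (TRN-equal g h hℓ hr e eℓ er)

-- Axioms of equality

≐-sym-formula : Term n → Term n → Formula n
≐-sym-formula t u = t ≐ u ⇒ u ≐ t

-- An equation between strings of different lengths is `⊥`, so as a hypothesis it proves everything.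
-- With equal lengths the equivalences are extracted, reversed and reassembled bit by bit.
≐-sym-prf : ∀ (t u : Term n) ms → let s = size (⟦ ≐-sym-formula t u ⟧ ms) ; l = lenᵗ u ms in
            Prf (suc (s + s)) (2 + l * (3 + l)) (⟦ ≐-sym-formula t u ⟧ ms)
≐-sym-prf t u ms with lenᵗ t ms ≟ lenᵗ u ms
... | no ne = relax (m≤m+n 2 _) (≢-elimʰ {t = t} {u} {ms} ne (assume (⇒-fits X X H≤ H≤)) (⇒-fits X Y H≤ A≤))
  where
  X = ⟦ t ≐ u ⟧ ms
  Y = ⟦ u ≐ t ⟧ ms
  H≤ = fitsˡ (size (⟦ t ≐ u ⟧ ms)) (size (⟦ u ≐ t ⟧ ms)) ≤-refl
  A≤ = fitsʳ (size (⟦ t ≐ u ⟧ ms)) (size (⟦ u ≐ t ⟧ ms)) ≤-refl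
... | yes e = relax (n≤1+n _) (≐-introʰ {t = u} {t} (sym e) (⇒-fits X Y H≤ A≤)
  λ i 1≤i i≤ → ⇔-symʰ (relax (s≤s i≤) (≐-elimʰ {t = t} {u} e (assume (⇒-fits X X H≤ H≤)) i 1≤i
    (≤-trans i≤ (≤-reflexive (sym e))))))
  where
  X = ⟦ t ≐ u ⟧ ms
  Y = ⟦ u ≐ t ⟧ ms
  H≤ = fitsˡ (size (⟦ t ≐ u ⟧ ms)) (size (⟦ u ≐ t ⟧ ms)) ≤-refl
  A≤ = fitsʳ (size (⟦ t ≐ u ⟧ ms)) (size (⟦ u ≐ t ⟧ ms)) ≤-refl

≐-trans-formula : Term n → Term n → Term n → Formula n
≐-trans-formula t u v = t ≐ u ⇒ u ≐ v ⇒ t ≐ v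

≐-trans-prf : ∀ (t u v : Term n) ms → let s = size (⟦ ≐-trans-formula t u v ⟧ ms) ; l = lenᵗ t ms in
              Prf (suc (s + s)) (5 + l * (6 + (l + l))) (⟦ ≐-trans-formula t u v ⟧ ms)
≐-trans-prf t u v ms = curryʰ conclusion
  where
  X = ⟦ t ≐ u ⟧ ms
  Y = ⟦ u ≐ v ⟧ ms
  Z = ⟦ t ≐ v ⟧ ms
  s′ = size (X ⇒ Y ⇒ Z)
  M′ = suc (s′ + s′)
  G≤ : size (X ∧ Y) ≤ s′
  G≤ = s≤s (+-monoʳ-≤ (size X) (fitsˡ (size Y) (size Z) ≤-refl))
  Z≤ : size Z ≤ s′
  Z≤ = fitsʳ (size X) _ (s≤s (+-monoʳ-≤ (size X) (fitsʳ (size Y) (size Z) ≤-refl)))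
  p : Prf M′ 2 (X ∧ Y ⇒ X)
  p = ∧-elimˡʰ (assume (⇒-fits (X ∧ Y) (X ∧ Y) G≤ G≤))
  q : Prf M′ 2 (X ∧ Y ⇒ Y)
  q = ∧-elimʳʰ (assume (⇒-fits (X ∧ Y) (X ∧ Y) G≤ G≤))
  l′ = lenᵗ t ms
  conclusion : Prf M′ (4 + l′ * (6 + (l′ + l′))) (X ∧ Y ⇒ Z)
  conclusion with lenᵗ t ms ≟ lenᵗ u ms | lenᵗ u ms ≟ lenᵗ v ms
  ... | no ne  | _      = relax (m≤m+n 3 _) (≢-elimʰ {t = t} {u} {ms} ne p (⇒-fits (X ∧ Y) Z G≤ Z≤))
  ... | yes _ | no ne   = relax (m≤m+n 3 _) (≢-elimʰ {t = u} {v} {ms} ne q (⇒-fits (X ∧ Y) Z G≤ Z≤))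
  ... | yes e | yes e′ = relax (≤-trans (n≤1+n _) (≤-trans (n≤1+n _) (n≤1+n _)))
      (≐-introʰ {t = t} {v} (trans e e′) (⇒-fits (X ∧ Y) Z G≤ Z≤) λ i 1≤i i≤ →
    relax (s≤s (≤-trans (+-mono-≤ (+-monoʳ-≤ 2 i≤) (+-monoʳ-≤ 2 i≤))
      (≤-reflexive (cong (2 +_) (trans (+-suc l′ (suc l′)) (cong suc (+-suc l′ l′)))))))
      (⇔-transʰ (≐-elimʰ {t = t} {u} e p i 1≤i i≤) (≐-elimʰ {t = u} {v} e′ q i 1≤i
        (≤-trans i≤ (≤-reflexive e)))
        (⇒-fits (X ∧ Y) (bitᵗ t ms i ⇔ bitᵗ v ms i) G≤
          (≤-trans (size-bitwise {t = t} {v} (trans e e′) i 1≤i i≤) Z≤))))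

conj : Vec (Formula n) l → Vec ℕ n → Form (Atom n)
conj []       ms = ⊤
conj (E ∷ Es) ms = ⟦ E ⟧ ms ∧ conj Es ms

implies : Vec (Formula n) l → Formula n → Formula n
implies Es F = Vec.foldr′ _⇒_ F Es

module _ {n} {ms : Vec ℕ n} where

  -- The congruence axiom nests one implication per argument, while its proof is easier from the
  -- conjunction of all premises. `regroup` and `curryʰ` move the premises one at a time without
  -- changing the number of symbols, so `M` is kept; the `⊤` ending the conjunction is discharged
  -- last.
  curryAll : ∀ (Es : Vec (Formula n) l) F → Prf M c (Γ ⇒ conj Es ms ⇒ ⟦ F ⟧ ms) →
             Prf M (c + suc (l + l)) (Γ ⇒ ⟦ implies Es F ⟧ ms)
  curryAll {c = c} [] F p = relax (≤-reflexive (+-comm 1 c)) (discharge-⊤ p)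
  curryAll {l = suc l} {c = c} (E ∷ Es) F p = relax (≤-reflexive steps) (curryʰ (curryAll Es F (regroup p)))
    where
    steps : suc (suc c + suc (l + l)) ≡ c + suc (suc l + suc l)
    steps = trans (cong suc (sym (+-suc c (suc (l + l)))))
      (trans (sym (+-suc c _)) (cong (λ k → c + suc (suc k)) (sym (+-suc l l))))

  conj-elimʰ : ∀ (Es : Vec (Formula n) l) j → Prf M c (Γ ⇒ conj Es ms) →
    Prf M (c + l) (Γ ⇒ ⟦ lookup Es j ⟧ ms)
  conj-elimʰ {l = suc l} {c = c} (E ∷ Es) zero    p =
    relax (≤-trans (s≤s (m≤m+n c l)) (≤-reflexive (sym (+-suc c l)))) (∧-elimˡʰ p)
  conj-elimʰ {l = suc l} {c = c} (E ∷ Es) (suc j) p = relax (≤-reflexive (sym (+-suc c l)))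
    (conj-elimʰ Es j (∧-elimʳʰ p))

  size-conj : ∀ (Es : Vec (Formula n) l) F → size (conj Es ms) ≤ size (⟦ implies Es F ⟧ ms)
  size-conj []       F = 1≤size (⟦ F ⟧ ms)
  size-conj (E ∷ Es) F = s≤s (+-monoʳ-≤ (size (⟦ E ⟧ ms)) (size-conj Es F))

  size-conclusion : ∀ (Es : Vec (Formula n) l) F → size (⟦ F ⟧ ms) ≤ size (⟦ implies Es F ⟧ ms)
  size-conclusion []       F = ≤-refl
  size-conclusion (E ∷ Es) F = ≤-trans (size-conclusion Es F) (fitsʳ (size (⟦ E ⟧ ms)) _ ≤-refl)

compareLengths : ∀ (ts us : Vec (Term n) l) ms →
                 (Σ[ j ∈ Fin l ] lenᵗ (lookup ts j) ms ≢ lenᵗ (lookup us j) ms) ⊎ lenᵗˢ ts ms ≡ lenᵗˢ us ms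
compareLengths []       []       ms = inj₂ refl
compareLengths (t ∷ ts) (u ∷ us) ms with lenᵗ t ms ≟ lenᵗ u ms | compareLengths ts us ms
... | no ne  | _            = inj₁ (zero , ne)
... | yes _ | inj₁ (j , ne) = inj₁ (suc j , ne)
... | yes e | inj₂ es      = inj₂ (cong₂ _∷_ e es)

cong-formula : Symbol l → Vec (Term n) l → Vec (Term n) l → Formula n
cong-formula f ts us = implies (zipWith _≐_ ts us) (f ⟨ ts ⟩ ≐ f ⟨ us ⟩)

module _ (f : Symbol l) (ts us : Vec (Term n) l) (ms : Vec ℕ n) {d : ℕ}
         (bit-f : ∀ ms → Sized (N ms ^ d) (lenˢ f ms) (bitˢ f ms)) where

  private
    Es = zipWith _≐_ ts us
    F = f ⟨ ts ⟩ ≐ f ⟨ us ⟩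
    W′ = conj Es ms
    s′ = size (⟦ cong-formula f ts us ⟧ ms)
    M′ a′ b′ : ℕ
    -- The hypothesis `⊤ ∧ W′` exceeds `s′` by at most 2, and so may count both sides of an
    -- implication.
    M′ = suc (2 + s′ + (2 + s′))
    ls = lenᵗˢ ts ms
    -- `2 + l` inferences reach the equation of one argument and the rest reaches its bit.
    -- Replacement inside a bit of `f`, of size at most `N ls ^ d`, then costs `b′`.
    a′ = 2 + (l + Vec.sum ls)
    b′ = N ls ^ d * suc a′

    W≤ : size (⊤ ∧ W′) ≤ 2 + s′
    W≤ = s≤s (s≤s (size-conj Es F))

    F≤ : size (⟦ F ⟧ ms) ≤ 2 + s′
    F≤ = ≤-trans (size-conclusion Es F) (m≤n+m _ 2)

    hypothesis : ∀ j → Prf M′ (2 + l) (⊤ ∧ W′ ⇒ ⟦ lookup ts j ≐ lookup us j ⟧ ms)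
    hypothesis j = ≡.subst (λ E → Prf M′ (2 + l) (⊤ ∧ W′ ⇒ ⟦ E ⟧ ms)) (lookup-zipWith _≐_ j ts us)
      (conj-elimʰ Es j (∧-elimʳʰ (assume (⇒-fits (⊤ ∧ W′) (⊤ ∧ W′) W≤ W≤))))

    bits : lenᵗˢ ts ms ≡ lenᵗˢ us ms → ∀ i → 1 ≤ i → i ≤ lenˢ f ls →
           Prf M′ b′ (⊤ ∧ W′ ⇒ (bitᵗ (f ⟨ ts ⟩) ms i ⇔ bitᵗ (f ⟨ us ⟩) ms i))
    -- With equal argument lengths both sides are the same formula of `f` under two substitutions.
    bits e i 1≤i i≤ = ≡.subst (λ ls′ → Prf M′ b′
      (⊤ ∧ W′ ⇒ (bitᵗ (f ⟨ ts ⟩) ms i ⇔ bitˢ f ls′ i [ bitᵗˢ us ms ]ᵖ))) e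
      (relax (*-monoˡ-≤ (suc a′) (bit-f ls i 1≤i i≤))
        (sub-congʰ (mapAtoms (λ {a} → atoms (proj₁ a) (proj₂ a)) (bitˢ-scoped f ls i 1≤i i≤))
          (⇒-fits (⊤ ∧ W′) (bitᵗ (f ⟨ ts ⟩) ms i ⇔ bitˢ f ls i [ bitᵗˢ us ms ]ᵖ) W≤
            (≤-trans (≡.subst (λ ls′ → size (bitᵗ (f ⟨ ts ⟩) ms i ⇔ bitˢ f ls′ i [ bitᵗˢ us ms ]ᵖ) ≤ size
            (⟦ F ⟧ ms)) (sym e)
            (size-bitwise {t = f ⟨ ts ⟩} {f ⟨ us ⟩} (cong (lenˢ f) e) i 1≤i i≤)) F≤))))
      where
      atoms : ∀ j i → InRange ls (j , i) →
        Prf M′ a′ (⊤ ∧ W′ ⇒ (lookup (bitᵗˢ ts ms) j i ⇔ lookup (bitᵗˢ us ms) j i))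
      atoms j i (1≤i , i≤) rewrite lookup-bitᵗˢ ts ms j | lookup-bitᵗˢ us ms j =
        relax (+-monoʳ-≤ 2 (+-monoʳ-≤ l (≤-trans i≤ (lookup≤sum ls j))))
          (≐-elimʰ {t = lookup ts j} {lookup us j}
            (trans (sym (lookup-lenᵗˢ ts ms j)) (trans (cong (λ ls → lookup ls j) e)
              (lookup-lenᵗˢ us ms j)))
            (hypothesis j) i 1≤i (≤-trans i≤ (≤-reflexive (lookup-lenᵗˢ ts ms j))))

    conclusion : Prf M′ (4 + l + lenˢ f ls * suc b′) (⊤ ∧ W′ ⇒ ⟦ F ⟧ ms)
    conclusion with compareLengths ts us ms
    ... | inj₁ (j , ne) = relax (≤-trans (n≤1+n (3 + l)) (m≤m+n _ _))
      (≢-elimʰ {t = lookup ts j} {lookup us j} {ms} ne (hypothesis j) (⇒-fits (⊤ ∧ W′) (⟦ F ⟧ ms) W≤ F≤))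
    ... | inj₂ e = relax (s≤s (m≤n+m _ (3 + l)))
      (≐-introʰ {t = f ⟨ ts ⟩} {f ⟨ us ⟩} (cong (lenˢ f) e) (⇒-fits (⊤ ∧ W′) (⟦ F ⟧ ms) W≤ F≤) (bits e))

  cong-prf : Prf M′ (suc (suc (4 + l + lenˢ f ls * suc b′) + suc (l + l))) (⟦ cong-formula f ts us ⟧ ms)
  cong-prf = ⊤⇒-elim (curryAll Es F (curryʰ conclusion))

eq-provable : ∀ {A : Formula n} → EqAxiom A → Provable A
eq-provable ≐-refl = equation {t = x} {x} λ ms → exactly {t = x} {x} refl λ _ _ _ → refl
eq-provable ≐-sym = provable {A = A} (const-PB 1 +-PB (⟦⟧-size A +-PB ⟦⟧-size A))
  (const-PB 2 +-PB lenᵗ-PB y *-PB (const-PB 3 +-PB lenᵗ-PB y)) (≐-sym-prf x y)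
  where
  A : Formula 2
  A = ≐-sym-formula x y
eq-provable ≐-trans = provable {A = A} (const-PB 1 +-PB (⟦⟧-size A +-PB ⟦⟧-size A))
  (const-PB 5 +-PB lenᵗ-PB x *-PB (const-PB 6 +-PB (lenᵗ-PB x +-PB lenᵗ-PB x))) (≐-trans-prf x y z)
  where
  A : Formula 3
  A = ≐-trans-formula x y z
eq-provable (≐-cong {k} f) with bitˢ-size f
... | d , bit-f = provable {A = A}
  (const-PB 1 +-PB (const-PB 2 +-PB ⟦⟧-size A +-PB (const-PB 2 +-PB ⟦⟧-size A)))
  (const-PB 1 +-PB (const-PB 1 +-PB (const-PB (4 + k) +-PB ∘-PB (lenˢ-PB f) (lenᵗˢ-PB ts) *-PB
    (const-PB 1 +-PB
    (∘-PB {g = lenᵗˢ ts} (N^-PB d) (lenᵗˢ-PB ts) *-PB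
      (const-PB 1 +-PB (const-PB 2 +-PB (const-PB k +-PB lenᵗˢ-PB ts)))))) +-PB const-PB (suc (k + k))))
  (λ ms → cong-prf f ts us ms {d} bit-f)
  where
  ts us : Vec (Term (k + k)) k
  ts = tabulate (λ j → var (j ↑ˡ k))
  us = vars k
  A : Formula (k + k)
  A = cong-formula f ts us

-- Substitution and modus ponens

-- The proof for the lengths of `σ` is instantiated with the bits of `σ`. The number of inferences
-- is kept and the formula size is multiplied by the largest of these bits; both bounds compose
-- polynomially.
subst-provable : ∀ {A : Formula n} (σ : Vec (Term k) n) → Provable A → Provable (subst A σ)
subst-provable {A = A} σ (d , p) with bitᵗˢ-size σ
... | d′ , bit-σ = provable {A = subst A σ}
  (∘-PB {g = lenᵗˢ σ} (N^-PB d) (lenᵗˢ-PB σ) *-PB N^-PB d′) (∘-PB {g = lenᵗˢ σ} (N^-PB d) (lenᵗˢ-PB σ))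
    λ ms →
  ≡.subst (Prf _ _) (sym (⟦subst⟧ σ ms A))
    (Prf-sub (1≤N^ ms d′) (atoms-sized (⟦⟧-scoped A (lenᵗˢ σ ms)) (bit-σ ms)) (p (lenᵗˢ σ ms)))

mp-provable : ∀ {A B : Formula n} → Provable (A ⇒ B) → Provable A → Provable B
mp-provable {B = B} (d , p) (e , q) = provable {A = B} (N^-PB d +-PB N^-PB e)
  (const-PB 1 +-PB (N^-PB d +-PB N^-PB e)) λ ms →
  mpᵖ (enlarge (m≤m+n _ _) (p ms)) (enlarge (m≤n+m _ (N ms ^ d)) (q ms))

-- Induction on notation

⟦[]⟧ : ∀ (A : Formula (1 + n)) t m ns →
       ⟦ A [ t ] ⟧ (m ∷ ns) ≡ ⟦ A ⟧ (lenᵗ t (m ∷ ns) ∷ ns) [ bitᵗ t (m ∷ ns) ∷ varsBits 1 ]ᵖ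
⟦[]⟧ A t m ns = trans (⟦subst⟧ (t ∷ vars 1) (m ∷ ns) A)
  (cong₂ (λ ls bs → ⟦ A ⟧ (lenᵗ t (m ∷ ns) ∷ ls) [ bitᵗ t (m ∷ ns) ∷ bs ]ᵖ) (lenᵗˢ-vars (m ∷ []) ns)
    (bitᵗˢ-vars 1 (m ∷ ns)))

⟦[]₂⟧ : ∀ (A : Formula (2 + n)) t u m p ns → let ms = m ∷ p ∷ ns in
        ⟦ A [ t , u ]₂ ⟧ ms ≡ ⟦ A ⟧ (lenᵗ t ms ∷ lenᵗ u ms ∷ ns) [ bitᵗ t ms ∷ bitᵗ u ms ∷ varsBits 2 ]ᵖ
⟦[]₂⟧ A t u m p ns = trans (⟦subst⟧ (t ∷ u ∷ vars 2) ms A)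
  (cong₂ (λ ls bs → ⟦ A ⟧ (lenᵗ t ms ∷ lenᵗ u ms ∷ ls) [ bitᵗ t ms ∷ bitᵗ u ms ∷ bs ]ᵖ)
    (lenᵗˢ-vars (m ∷ p ∷ []) ns) (bitᵗˢ-vars 2 ms))
  where ms = m ∷ p ∷ ns

constant : Bool → Form V
constant false = ⊥
constant true  = ⊤

Inserted : Atom (1 + n) → Bool → ℕ → Form (Atom (1 + n)) → Set
Inserted a b i B = (a ≡ (zero , i) × B ≡ constant b) ⊎ B ≡ atom (zero , i)

-- The string grow b of length m + 1 is b inserted at the position new m of x;
-- the renaming shift m makes room for it.
record Growth (n : ℕ) : Set where
  field
    grow       : Bool → Term (1 + n)
    shift      : ℕ → Atom (1 + n) → Atom (1 + n)
    new        : ℕ → Atom (1 + n)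
    len-grow   : ∀ b m ns → lenᵗ (grow b) (m ∷ ns) ≡ suc m
    bit-grow   : ∀ b m ns i → 1 ≤ i → i ≤ suc m →
                 Inserted (new m) b i (subᵖ (atom ∘ shift m) (bitᵗ (grow b) (m ∷ ns) i))
    shift-suc  : ∀ m j i → shift m (suc j , i) ≡ (suc j , i)

module _ {n} (𝓖 : Growth n) (A : Formula (1 + n)) where

  open Growth 𝓖

  module _ (m : ℕ) (ns : Vec ℕ n) where

    private
      C : Form (Atom (1 + n))
      C = ⟦ A ⟧ (suc m ∷ ns)

    instance-of : Bool → Atom (1 + n) → Form (Atom (1 + n))
    instance-of b (j , i) = subᵖ (atom ∘ shift m) (lookup (bitᵗ (grow b) (m ∷ ns) ∷ varsBits 1) j i)

    shifted : ∀ b → subᵖ (atom ∘ shift m) (⟦ A [ grow b ] ⟧ (m ∷ ns)) ≡ subᵖ (instance-of b) C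
    shifted b = trans (cong (subᵖ (atom ∘ shift m)) (⟦[]⟧ A (grow b) m ns))
      (trans (sub-sub _ _ (⟦ A ⟧ (lenᵗ (grow b) (m ∷ ns) ∷ ns)))
        (cong (λ l → subᵖ (instance-of b) (⟦ A ⟧ (l ∷ ns))) (len-grow b m ns)))

    replaces : ∀ b → AllAtoms (Replaces (instance-of b) (new m) (constant b)) C
    replaces b = mapAtoms (λ {a} → atoms a) (⟦⟧-scoped A (suc m ∷ ns))
      where
      atoms : ∀ a → InRange (suc m ∷ ns) a → Replaces (instance-of b) (new m) (constant b) a
      atoms (zero , i) (1≤i , i≤) with bit-grow b m ns i 1≤i i≤
      ... | inj₁ (e , e′) = inj₁ (sym e , e′)
      ... | inj₂ e′       = inj₂ e′
      atoms (suc j , i) _ = inj₂ (trans (cong (λ b → subᵖ (atom ∘ shift m) (b i)) (lookup-varsBits 1 j))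
        (cong atom (shift-suc m j i)))

    -- Renaming the atoms of the proof for length m frees the position of the new bit. The two
    -- induction premises, renamed as well, give `C` with `⊥` and with `⊤` at that position. A
    -- renaming has factor 1, so repeating the step does not inflate the formulas.
    inductionStep : ∀ {M₀ M n₀ n₁ n₂} → M₀ ≤ M → 8 + (size C + size C) ≤ M → suc (M₀ + M₀) ≤ M →
                    Prf M₀ n₀ (⟦ A ⇒ A [ grow false ] ⟧ (m ∷ ns)) →
                      Prf M₀ n₁ (⟦ A ⇒ A [ grow true ] ⟧ (m ∷ ns)) →
                    Prf M n₂ (⟦ A ⟧ (m ∷ ns)) →
                    Prf M (2 + (n₀ + (n₁ + n₂)) + (size C * 2 + size C * 2)) C
    inductionStep {M₀} M₀≤M fit fit₀ p₀ p₁ q = caseDistinction (replaces false) (replaces true) fit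
      (mp² (enlarge M₀≤M (renamed false p₀)) (enlarge M₀≤M (renamed true p₁)) (rename q)
        (≤-trans (s≤s (+-mono-≤ (instance≤ false p₀) (instance≤ true p₁))) fit₀))
      where
      rename : ∀ {M n B} → Prf M n B → Prf M n (subᵖ (atom ∘ shift m) B)
      rename {M} {n} {B} p = ≡.subst (λ M → Prf M n (subᵖ (atom ∘ shift m) B)) (*-identityʳ M)
        (Prf-sub {σ = atom ∘ shift m} ≤-refl (allAtoms (λ _ → ≤-refl) B) p)
      renamed : ∀ b {k} → Prf M₀ k (⟦ A ⇒ A [ grow b ] ⟧ (m ∷ ns)) →
                Prf M₀ k (subᵖ (atom ∘ shift m) (⟦ A ⟧ (m ∷ ns)) ⇒ subᵖ (instance-of b) C)
      renamed b p = ≡.subst (λ B → Prf M₀ _ (subᵖ (atom ∘ shift m) (⟦ A ⟧ (m ∷ ns)) ⇒ B)) (shifted b)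
        (rename p)
      instance≤ : ∀ b {k} → Prf M₀ k (⟦ A ⇒ A [ grow b ] ⟧ (m ∷ ns)) → size (subᵖ (instance-of b) C) ≤ M₀
      instance≤ b p = fitsʳ (size (subᵖ (atom ∘ shift m) (⟦ A ⟧ (m ∷ ns)))) _ (fits (renamed b p))

  -- A variable of length 0 has no atoms in range, so whatever bits replace it do not show in the
  -- formula.
  NIND-base : ∀ ns → ⟦ A [ ε ] ⟧ (0 ∷ ns) ≡ ⟦ A ⟧ (0 ∷ ns)
  NIND-base ns = trans (⟦[]⟧ A ε 0 ns) (trans
    ([]-ext {ms = 0 ∷ ns} {bitᵗ ε (0 ∷ ns) ∷ varsBits 1} (⟦⟧-scoped A (0 ∷ ns)) {varsBits 0}
      λ { zero _ 1≤i i≤ → contradiction (≤-trans 1≤i i≤) λ () ; (suc _) _ _ _ → refl })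
    ([varsBits] (⟦ A ⟧ (0 ∷ ns))))

  NIND-provable : Provable (A [ ε ]) → Provable (A ⇒ A [ grow false ]) → Provable (A ⇒ A [ grow true ]) →
    Provable A
  NIND-provable (d , p) (d₀ , p₀) (d₁ , p₁) with ⟦⟧-size A
  ... | dA , A≤ = provable {A = A} F-PB G-PB λ { (m ∷ ns) → prf m ns }
    where
    module _ (m : ℕ) (ns : Vec ℕ n) where
      -- All bounds are taken at the final length, so every stage shares the formula bound `F′` and
      -- adds at most `G′` inferences: the total is linear in the number of stages.
      B₀ D F′ G′ : ℕ
      B₀ = N (suc m ∷ ns) ^ d + (N (suc m ∷ ns) ^ d₀ + N (suc m ∷ ns) ^ d₁)
      D = N (suc m ∷ ns) ^ dA
      F′ = 8 + (B₀ + B₀) + (D + D)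
      G′ = 2 + (B₀ + B₀) + (D * 2 + D * 2)

      go : ∀ m′ → m′ ≤ m → Prf F′ (B₀ + m′ * G′) (⟦ A ⟧ (m′ ∷ ns))
      go zero _ = ≡.subst (Prf F′ (B₀ + 0)) (NIND-base ns) (resize
        (≤-trans d≤ (≤-trans (m≤m+n B₀ B₀) (≤-trans (m≤n+m _ 8) (m≤m+n _ _)))) (≤-trans d≤ (m≤m+n B₀ 0))
          (p (0 ∷ ns)))
        where
        d≤ : N (0 ∷ ns) ^ d ≤ B₀
        d≤ = ≤-trans (^-monoˡ-≤ d (N-mono ns z≤n)) (m≤m+n _ _)
      go (suc m′) m′<m = relax steps (inductionStep m′ ns B₀≤
          (≤-trans (+-mono-≤ (m≤m+n 8 (B₀ + B₀)) (+-mono-≤ C≤ C≤)) ≤-refl)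
          (≤-trans (+-monoˡ-≤ (B₀ + B₀) {1} {8} (s≤s z≤n)) (m≤m+n _ _))
          (enlarge d₀≤ (p₀ (m′ ∷ ns))) (enlarge d₁≤ (p₁ (m′ ∷ ns))) (go m′ (<⇒≤ m′<m)))
        where
        open ≤-Reasoning
        N≤ : ∀ e → N (m′ ∷ ns) ^ e ≤ N (suc m ∷ ns) ^ e
        N≤ e = ^-monoˡ-≤ e (N-mono ns (≤-trans (<⇒≤ m′<m) (n≤1+n m)))
        d₀≤ : N (m′ ∷ ns) ^ d₀ ≤ B₀
        d₀≤ = ≤-trans (N≤ d₀) (≤-trans (m≤m+n _ _) (m≤n+m _ (N (suc m ∷ ns) ^ d)))
        d₁≤ : N (m′ ∷ ns) ^ d₁ ≤ B₀
        d₁≤ = ≤-trans (N≤ d₁) (≤-trans (m≤n+m _ (N (suc m ∷ ns) ^ d₀)) (m≤n+m _ (N (suc m ∷ ns) ^ d)))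
        B₀≤ : B₀ ≤ F′
        B₀≤ = ≤-trans (m≤m+n B₀ B₀) (≤-trans (m≤n+m _ 8) (m≤m+n _ _))
        C≤ : size (⟦ A ⟧ (suc m′ ∷ ns)) ≤ D
        C≤ = ≤-trans (A≤ (suc m′ ∷ ns)) (^-monoˡ-≤ dA (N-mono ns (≤-trans m′<m (n≤1+n m))))
        C : ℕ
        C = size (⟦ A ⟧ (suc m′ ∷ ns))
        steps : 2 + (N (m′ ∷ ns) ^ d₀ + (N (m′ ∷ ns) ^ d₁ + (B₀ + m′ * G′))) + (C * 2 + C * 2) ≤ B₀ + suc
          m′ * G′
        steps = begin
          2 + (N (m′ ∷ ns) ^ d₀ + (N (m′ ∷ ns) ^ d₁ + (B₀ + m′ * G′))) + (C * 2 + C * 2)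
            ≤⟨ +-mono-≤ (+-monoʳ-≤ 2 (+-mono-≤ d₀≤ (+-monoˡ-≤ _ d₁≤)))
              (+-mono-≤ (*-monoˡ-≤ 2 C≤) (*-monoˡ-≤ 2 C≤)) ⟩
          2 + (B₀ + (B₀ + (B₀ + m′ * G′))) + (D * 2 + D * 2)
            ≡⟨ rearrange B₀ (m′ * G′) (D * 2 + D * 2) ⟩
          B₀ + suc m′ * G′ ∎
          where
          rearrange : (a b c : ℕ) → 2 + (a + (a + (a + b))) + c ≡ a + (2 + (a + a) + c + b)
          rearrange = solve-∀

      prf : Prf F′ (B₀ + m * G′) (⟦ A ⟧ (m ∷ ns))
      prf = go m ≤-refl

    N⁺ B₀⁺ F⁺ G⁺ : Vec ℕ (1 + n) → ℕ
    N⁺ (m ∷ ns) = N (suc m ∷ ns)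
    B₀⁺ ms = N⁺ ms ^ d + (N⁺ ms ^ d₀ + N⁺ ms ^ d₁)
    F⁺ (m ∷ ns) = F′ m ns
    G⁺ (m ∷ ns) = B₀ m ns + m * G′ m ns

    N⁺-PB : PolyBounded N⁺
    N⁺-PB = mono-PB (λ { (m ∷ ns) → ≤-refl }) (const-PB 3 +-PB sum-PB)

    B₀-PB : PolyBounded B₀⁺
    B₀-PB = ^-PB d N⁺-PB +-PB (^-PB d₀ N⁺-PB +-PB ^-PB d₁ N⁺-PB)

    F-PB : PolyBounded F⁺
    F-PB = mono-PB (λ { (m ∷ ns) → ≤-refl })
      (const-PB 8 +-PB (B₀-PB +-PB B₀-PB) +-PB (^-PB dA N⁺-PB +-PB ^-PB dA N⁺-PB))

    G-PB : PolyBounded G⁺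
    G-PB = mono-PB (λ { (m ∷ ns) → +-monoʳ-≤ (B₀ m ns) (*-monoˡ-≤ (G′ m ns) (m≤m+n m (Vec.sum ns))) })
      (B₀-PB +-PB sum-PB *-PB (const-PB 2 +-PB (B₀-PB +-PB B₀-PB) +-PB
        (^-PB dA N⁺-PB *-PB const-PB 2 +-PB ^-PB dA N⁺-PB *-PB const-PB 2)))

bit-constant : ∀ b (ms : Vec ℕ n) i → bitᵗ (bit b) ms i ≡ constant b
bit-constant false ms i = refl
bit-constant true  ms i = refl

sub-constant : ∀ (σ : V → Form W) b → subᵖ σ (constant b) ≡ constant b
sub-constant σ false = refl
sub-constant σ true  = refl

shiftℓ : ℕ → Atom (1 + n) → Atom (1 + n)
shiftℓ _ (zero  , i) = zero , suc i
shiftℓ _ (suc j , i) = suc j , i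

growthℓ : Growth n
growthℓ {n} = record
  { grow      = λ b → bit b · x
  ; shift     = shiftℓ
  ; new       = λ _ → zero , 1
  ; len-grow  = λ b m ns → cong (_+ m) (len-bit b (m ∷ ns))
  ; bit-grow  = bits
  ; shift-suc = λ _ _ _ → refl
  }
  where
  bits : ∀ b m ns i → 1 ≤ i → i ≤ suc m →
         Inserted {n} (zero , 1) b i (subᵖ (atom ∘ shiftℓ m) (bitᵗ (bit b · x) (m ∷ ns) i))
  bits b m ns 1 _ _ = inj₁ (refl , trans
    (cong (subᵖ (atom ∘ shiftℓ m))
      (trans (bit-·ˡ (bit b) x (m ∷ ns) (≤-reflexive (sym (len-bit b (m ∷ ns)))))
      (bit-constant b (m ∷ ns) 1)))
    (sub-constant (atom ∘ shiftℓ m) b))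
  bits b m ns (suc (suc i)) _ _ = inj₂ (cong (subᵖ (atom ∘ shiftℓ m))
    (trans (bit-·ʳ (bit b) x (m ∷ ns) (≤-trans (s≤s (≤-reflexive (len-bit b (m ∷ ns)))) (s≤s (s≤s z≤n))))
           (cong (λ l → varBits zero (2 + i ∸ l)) (len-bit b (m ∷ ns)))))

growthr : Growth n
growthr {n} = record
  { grow      = λ b → x · bit b
  ; shift     = λ _ a → a
  ; new       = λ m → zero , suc m
  ; len-grow  = λ b m ns → trans (cong (m +_) (len-bit b (m ∷ ns))) (+-comm m 1)
  ; bit-grow  = λ b m ns i 1≤i i≤ → ≡.subst (Inserted (zero , suc m) b i)
    (sym (sub-atom (bitᵗ (x · bit b) (m ∷ ns) i))) (bits b m ns i i≤)
  ; shift-suc = λ _ _ _ → refl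
  }
  where
  bits : ∀ b m ns i → i ≤ suc m → Inserted {n} (zero , suc m) b i (bitᵗ (x · bit b) (m ∷ ns) i)
  bits b m ns i i≤ with i ≤? m
  ... | yes i≤m = inj₂ (bit-·ˡ x (bit b) (m ∷ ns) i≤m)
  ... | no  i≰m = inj₁ (cong (zero ,_) (≤-antisym (≰⇒> i≰m) i≤) ,
                        trans (bit-·ʳ x (bit b) (m ∷ ns) (≰⇒> i≰m)) (bit-constant b (m ∷ ns) (i ∸ m)))

-- Tree induction

module _ {n} (A : Formula (2 + n)) (hℓ hr : Symbol 1) where

  private
    zᵗ tℓ tr : Term (2 + n)
    zᵗ = var (suc zero)
    tℓ = hℓ ⟨ zᵗ ∷ [] ⟩
    tr = hr ⟨ zᵗ ∷ [] ⟩

  TIND-base₀ : ∀ p ns → ⟦ A [ ε , zᵗ ]₂ ⟧ (0 ∷ p ∷ ns) ≡ ⟦ A ⟧ (0 ∷ p ∷ ns)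
  TIND-base₀ p ns = trans (⟦[]₂⟧ A ε zᵗ 0 p ns) (trans
    ([]-ext {ms = 0 ∷ p ∷ ns} {bitᵗ ε (0 ∷ p ∷ ns) ∷ bitᵗ zᵗ (0 ∷ p ∷ ns) ∷ varsBits 2}
      (⟦⟧-scoped A (0 ∷ p ∷ ns)) {varsBits 0}
      λ { zero _ 1≤i i≤ → contradiction (≤-trans 1≤i i≤) λ () ; (suc zero) _ _ _ → refl ; (suc (suc _)) _ _
        _ → refl })
    ([varsBits] (⟦ A ⟧ (0 ∷ p ∷ ns))))

  -- A string of length 1 is a single atom, so the two premises for `𝟎` and `𝟏` are the two cases of
  -- that atom.
  TIND-base₁ : ∀ {M₀ M₁ n₀ n₁} p ns → let ms = 1 ∷ p ∷ ns ; C = size (⟦ A ⟧ ms) in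
               Prf M₀ n₀ (⟦ A [ 𝟎 , zᵗ ]₂ ⟧ ms) → Prf M₁ n₁ (⟦ A [ 𝟏 , zᵗ ]₂ ⟧ ms) →
               Prf (8 + (M₀ + M₁) + (C + C)) (2 + (n₀ + n₁) + (C * 2 + C * 2)) (⟦ A ⟧ ms)
  TIND-base₁ {M₀} {M₁} p ns p₀ p₁ =
    caseDistinction (replacesᵇ false) (replacesᵇ true) (+-monoˡ-≤ (C + C) (m≤m+n 8 (M₀ + M₁)))
      (∧-introᵖ (enlarge (≤-trans (m≤m+n M₀ M₁) (≤-trans (m≤n+m _ 8) (m≤m+n _ (C + C)))) (inst₀ p₀))
                (enlarge (≤-trans (m≤n+m M₁ M₀) (≤-trans (m≤n+m _ 8) (m≤m+n _ (C + C)))) (inst₁ p₁))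
        (≤-trans (s≤s (+-mono-≤ (fits (inst₀ p₀)) (fits (inst₁ p₁))))
          (≤-trans (+-monoˡ-≤ (M₀ + M₁) {1} {8} (s≤s z≤n)) (m≤m+n _ (C + C)))))
    where
    ms : Vec ℕ (2 + n)
    ms = 1 ∷ p ∷ ns
    C : ℕ
    C = size (⟦ A ⟧ ms)
    σ : Bool → Atom (2 + n) → Form (Atom (2 + n))
    σ b (j , i) = lookup (bitᵗ (bit b) ms ∷ bitᵗ zᵗ ms ∷ varsBits 2) j i
    inst₀ : ∀ {M n} → Prf M n (⟦ A [ 𝟎 , zᵗ ]₂ ⟧ ms) → Prf M n (subᵖ (σ false) (⟦ A ⟧ ms))
    inst₀ = ≡.subst (Prf _ _) (⟦[]₂⟧ A 𝟎 zᵗ 1 p ns)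
    inst₁ : ∀ {M n} → Prf M n (⟦ A [ 𝟏 , zᵗ ]₂ ⟧ ms) → Prf M n (subᵖ (σ true) (⟦ A ⟧ ms))
    inst₁ = ≡.subst (Prf _ _) (⟦[]₂⟧ A 𝟏 zᵗ 1 p ns)
    replacesᵇ : ∀ b → AllAtoms (Replaces (σ b) (zero , 1) (constant b)) (⟦ A ⟧ ms)
    replacesᵇ b = mapAtoms (λ {a} → atoms a) (⟦⟧-scoped A ms)
      where
      atoms : ∀ a → InRange ms a → Replaces (σ b) (zero , 1) (constant b) a
      atoms (zero , i) (1≤i , i≤1) = inj₁ (cong (zero ,_) (≤-antisym i≤1 1≤i) , bit-constant b ms i)
      atoms (suc zero , i) _ = inj₂ refl
      atoms (suc (suc j) , i) _ = inj₂ (cong (λ b → b i) (lookup-varsBits 2 j))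

  -- The bits of the halves are atoms, and those of `hℓ` and `hr` have bounded size. Hence
  -- instantiating the proofs for the halves multiplies formula sizes by at most `suc bℓ` and
  -- `suc br` and keeps the numbers of inferences. The step premise is absorbed by `t`, and `M` has
  -- the shape that `HalvingInduction` asks for.
  TIND-step : ∀ {bℓ br} → (∀ ms i → size (bitˢ hℓ ms i) ≤ bℓ) → (∀ ms i → size (bitˢ hr ms i) ≤ br) →
    ∀ k p ns {b₁ b₂ b t u} → let ms = 2 + k ∷ p ∷ ns ; M = t + (suc bℓ + suc br) * (b₁ + b₂) in b ≤ t → 2 + u ≤ t →
    Prf b₁ b₁ (⟦ A ⟧ (⌊ 2 + k /2⌋ ∷ lenˢ hℓ (p ∷ []) ∷ ns)) →
      Prf b₂ b₂ (⟦ A ⟧ (⌈ 2 + k /2⌉ ∷ lenˢ hr (p ∷ []) ∷ ns)) →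
    Prf b u (⟦ A [ lh x , tℓ ]₂ ∧ A [ rh x , tr ]₂ ⇒ A ⟧ ms) → Prf M M (⟦ A ⟧ ms)
  TIND-step {bℓ} {br} bit-hℓ bit-hr k p ns {b₁} {b₂} {b} {t} {u} b≤t 2+u≤t q₁ q₂ q = relax steps
    (mpᵖ (enlarge (≤-trans b≤t (m≤m+n t _)) q)
      (∧-introᵖ (enlarge (≤-trans (≤-trans (≤-reflexive (*-comm b₁ (suc bℓ)))
        (*-mono-≤ (m≤m+n (suc bℓ) (suc br)) (m≤m+n b₁ b₂))) (m≤n+m _ t)) qℓ)
                (enlarge (≤-trans (≤-trans (≤-reflexive (*-comm b₂ (suc br)))
                  (*-mono-≤ (m≤n+m (suc br) (suc bℓ)) (m≤n+m b₂ b₁))) (m≤n+m _ t)) qr)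
        (≤-trans (fitsˡ (size (⟦ A [ lh x , tℓ ]₂ ∧ A [ rh x , tr ]₂ ⟧ ms)) (size (⟦ A ⟧ ms)) (fits q))
          (≤-trans b≤t (m≤m+n t _)))))
    where
    open ≤-Reasoning
    ms : Vec ℕ (2 + n)
    ms = 2 + k ∷ p ∷ ns
    sizes : ∀ {h : Symbol 1} {c} (bx : Bits (Atom (2 + n))) → (∀ i → size (bx i) ≤ 1) →
      (∀ ms i → size (bitˢ h ms i) ≤ c) →
            ∀ (a : Atom (2 + n)) → size (lookup (bx ∷ bitᵗ (h ⟨ zᵗ ∷ [] ⟩) ms ∷ varsBits 2) (proj₁ a)
              (proj₂ a)) ≤ suc c
    sizes bx bx≤ bit-h (zero , i) = ≤-trans (bx≤ i) (s≤s z≤n)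
    sizes {h} bx bx≤ bit-h (suc zero , i) =
      ≤-trans (size-sub ≤-refl (allAtoms (λ { (zero , _) → ≤-refl }) (bitˢ h (p ∷ []) i)))
        (≤-trans (≤-reflexive (*-identityʳ _)) (≤-trans (bit-h _ i) (n≤1+n _)))
    sizes bx bx≤ bit-h (suc (suc j) , i) = ≤-trans (varsBits-size 2 j i) (s≤s z≤n)
    qℓ : Prf (b₁ * suc bℓ) b₁ (⟦ A [ lh x , tℓ ]₂ ⟧ ms)
    qℓ = ≡.subst (Prf _ _) (sym (⟦[]₂⟧ A (lh x) tℓ (2 + k) p ns))
      (Prf-sub (s≤s z≤n) (allAtoms (sizes {hℓ} (bitᵗ (lh x) ms) (λ _ → ≤-refl) bit-hℓ) _) q₁)
    qr : Prf (b₂ * suc br) b₂ (⟦ A [ rh x , tr ]₂ ⟧ ms)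
    qr = ≡.subst (Prf _ _) (sym (⟦[]₂⟧ A (rh x) tr (2 + k) p ns))
      (Prf-sub (s≤s z≤n) (allAtoms (sizes {hr} (bitᵗ (rh x) ms) (λ _ → ≤-refl) bit-hr) _) q₂)
    steps : suc (u + suc (b₁ + b₂)) ≤ t + (suc bℓ + suc br) * (b₁ + b₂)
    steps = begin
      suc (u + suc (b₁ + b₂))                ≡⟨ cong suc (+-suc u (b₁ + b₂)) ⟩
      2 + u + (b₁ + b₂)                      ≤⟨ +-mono-≤ 2+u≤t (m≤m+n (b₁ + b₂) _) ⟩
      t + (suc bℓ + suc br) * (b₁ + b₂)      ∎

  module _ {cℓ cr bℓ br d d₀ d₁ d′ dB D : ℕ}
    (len-hℓ : ∀ ms → lenˢ hℓ ms ≤ cℓ * suc (Vec.sum ms)) (len-hr : ∀ ms → lenˢ hr ms ≤ cr * suc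
      (Vec.sum ms))
    (bit-hℓ : ∀ ms i → size (bitˢ hℓ ms i) ≤ bℓ) (bit-hr : ∀ ms i → size (bitˢ hr ms i) ≤ br)
    (p  : ∀ ms → Prf (N ms ^ d) (N ms ^ d) (⟦ A [ ε , zᵗ ]₂ ⟧ ms))
    (p₀ : ∀ ms → Prf (N ms ^ d₀) (N ms ^ d₀) (⟦ A [ 𝟎 , zᵗ ]₂ ⟧ ms))
    (p₁ : ∀ ms → Prf (N ms ^ d₁) (N ms ^ d₁) (⟦ A [ 𝟏 , zᵗ ]₂ ⟧ ms))
    (p′ : ∀ ms → Prf (N ms ^ d′) (N ms ^ d′) (⟦ A [ lh x , tℓ ]₂ ∧ A [ rh x , tr ]₂ ⇒ A ⟧ ms))
    (base≤ : ∀ ms → 8 + (N ms ^ d₀ + N ms ^ d₁) + (size (⟦ A ⟧ ms) * 2 + size (⟦ A ⟧ ms) * 2) ≤ N ms ^ dB)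
    (induction : HalvingInduction (cℓ + cr) (suc bℓ + suc br) (d + dB + suc (2 + d′)) D) where

    private
      -- The exponents `d` and `dB` serve the lengths 0 and 1, and `suc (2 + d′)` the induction
      -- premise together with the two inferences that use it.
      E′ : ℕ
      E′ = d + dB + suc (2 + d′)

    TIND-prf : ∀ m p ns → Prf (N (m ∷ p ∷ ns) ^ D) (N (m ∷ p ∷ ns) ^ D) (⟦ A ⟧ (m ∷ p ∷ ns))
    TIND-prf m₀ p₀′ ns = induction (Vec.sum ns) (λ m p b → Prf b b (⟦ A ⟧ (m ∷ p ∷ ns)))
      (λ p → lenˢ hℓ (p ∷ [])) (λ p → lenˢ hr (p ∷ [])) (λ b≤ → resize b≤ b≤)
      (linear₁ len-hℓ (m≤m+n cℓ cr)) (linear₁ len-hr (m≤n+m cr cℓ))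
      (λ { 0 p _ → base₀ p ; 1 p _ → base₁ p ; (suc (suc _)) p (s≤s ()) })
      (λ k p b₁ b₂ q₁ q₂ → TIND-step bit-hℓ bit-hr k p ns (d′≤ (2 + k ∷ p ∷ ns)) (2+d′≤ (2 + k ∷ p ∷ ns))
        q₁ q₂ (p′ (2 + k ∷ p ∷ ns)))
      m₀ p₀′
      where
      E≥ : ∀ {e} ms → e ≤ E′ → N ms ^ e ≤ N ms ^ E′
      E≥ ms = ^-monoʳ-≤ (N ms)
      2+d′≤ : ∀ ms → 2 + N ms ^ d′ ≤ N ms ^ E′
      2+d′≤ ms = ≤-trans (+-≤-base^ {d = 2} {d′} (2≤N ms) (≤-base^ (2≤N ms) 2) ≤-refl)
        (E≥ ms (m≤n+m _ (d + dB)))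
      d′≤ : ∀ ms → N ms ^ d′ ≤ N ms ^ E′
      d′≤ ms = ≤-trans (m≤n+m _ 2) (2+d′≤ ms)
      base₀ : ∀ p → Prf (N (0 ∷ p ∷ ns) ^ E′) (N (0 ∷ p ∷ ns) ^ E′) (⟦ A ⟧ (0 ∷ p ∷ ns))
      base₀ q = ≡.subst (Prf _ _) (TIND-base₀ q ns) (resize d≤ d≤ (p (0 ∷ q ∷ ns)))
        where
        d≤ : N (0 ∷ q ∷ ns) ^ d ≤ N (0 ∷ q ∷ ns) ^ E′
        d≤ = E≥ (0 ∷ q ∷ ns) (≤-trans (m≤m+n d dB) (m≤m+n _ _))
      base₁ : ∀ p → Prf (N (1 ∷ p ∷ ns) ^ E′) (N (1 ∷ p ∷ ns) ^ E′) (⟦ A ⟧ (1 ∷ p ∷ ns))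
      base₁ q = resize
        (≤-trans (+-monoʳ-≤ (8 + (N ms ^ d₀ + N ms ^ d₁)) (+-mono-≤ (m≤m*n C 2) (m≤m*n C 2))) dB≤)
        (≤-trans (+-monoˡ-≤ (C * 2 + C * 2) (+-monoˡ-≤ (N ms ^ d₀ + N ms ^ d₁) {2} {8} (s≤s (s≤s z≤n))))
          dB≤)
        (TIND-base₁ q ns (p₀ ms) (p₁ ms))
        where
        ms : Vec ℕ (2 + n)
        ms = 1 ∷ q ∷ ns
        C : ℕ
        C = size (⟦ A ⟧ ms)
        dB≤ : 8 + (N ms ^ d₀ + N ms ^ d₁) + (C * 2 + C * 2) ≤ N ms ^ E′
        dB≤ = ≤-trans (base≤ ms) (E≥ ms (≤-trans (m≤n+m dB d) (m≤m+n _ _)))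

  TIND-provable : rank hℓ ≡ 0 → rank hr ≡ 0 →
                  Provable (A [ ε , zᵗ ]₂) → Provable (A [ 𝟎 , zᵗ ]₂) → Provable (A [ 𝟏 , zᵗ ]₂) →
                  Provable (A [ lh x , tℓ ]₂ ∧ A [ rh x , tr ]₂ ⇒ A) → Provable A
  TIND-provable eℓ er (d , p) (d₀ , p₀) (d₁ , p₁) (d′ , p′) = proj₁ induction , λ { (m ∷ p′′ ∷ ns) →
    TIND-prf {cℓ = proj₁ len-hℓ} {proj₁ len-hr} {d = d} {d₀} {d₁} {d′} {proj₁ base-PB} {proj₁ induction}
      (proj₂ len-hℓ) (proj₂ len-hr) (proj₂ bit-hℓ) (proj₂ bit-hr) p p₀ p₁ p′ (proj₂ base-PB)
      (proj₂ induction) m p′′ ns }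
    where
    len-hℓ = lenˢ-linear hℓ eℓ
    len-hr = lenˢ-linear hr er
    bit-hℓ = bitˢ-bounded hℓ eℓ
    bit-hr = bitˢ-bounded hr er
    base-PB : PolyBounded {2 + n} (λ ms → 8 + (N ms ^ d₀ + N ms ^ d₁) +
      (size (⟦ A ⟧ ms) * 2 + size (⟦ A ⟧ ms) * 2))
    base-PB = const-PB 8 +-PB (N^-PB d₀ +-PB N^-PB d₁) +-PB (⟦⟧-size A *-PB const-PB 2 +-PB ⟦⟧-size A *-PB
      const-PB 2)
    induction = halvingInduction (proj₁ len-hℓ + proj₁ len-hr) (suc (proj₁ bit-hℓ) + suc (proj₁ bit-hr))
      (d + proj₁ base-PB + suc (2 + d′))

-- Recursion on `T₁`-proofs, and the resulting polynomial

soundness : ∀ {A : Formula n} → T₁⊢ A → Provable A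
soundness (prop ax)   = prop-provable ax
soundness (eq ax)     = eq-provable ax
soundness (string ax) = string-provable ax
soundness (def ax)    = def-provable ax
soundness (mp {A = A} {B} p q) = mp-provable {A = A} {B} (soundness p) (soundness q)
soundness (sub {A = A} σ p) = subst-provable {A = A} σ (soundness p)
soundness (NINDℓ A p p₀ p₁) = NIND-provable growthℓ A (soundness p) (soundness p₀) (soundness p₁)
soundness (NINDr A p p₀ p₁) = NIND-provable growthr A (soundness p) (soundness p₀) (soundness p₁)
soundness (TIND A hℓ hr eℓ er p p₀ p₁ p′) =
  TIND-provable A hℓ hr eℓ er (soundness p) (soundness p₀) (soundness p₁) (soundness p′)

theorem4p4p1 : (𝓕 : FregeSystem) →
    Σ[ F ∈ (∀ n (A : Formula n) → T₁⊢ A → (ms : Vec ℕ n) → FregeProof 𝓕 (⟦ A ⟧ ms)) ]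
    (∀ n (A : Formula n) (π : T₁⊢ A) →
    Σ[ p ∈ Poly n ] (∀ ms → proofSize {𝓕} (F n A π ms) ≤ evalPoly p ms))
theorem4p4p1 𝓕 = (λ n A π ms → proj₁ (toFrege (proj₂ (soundness π) ms))) , λ n A π →
  let d = proj₁ (soundness π) in
  -- The number of inferences times the size `K` of the schema derivations times the largest
  -- formula.
  powᵖ Nᵖ d ⊗ (con K ⊗ powᵖ Nᵖ d) , λ ms →
    ≤-trans (proj₂ (toFrege (proj₂ (soundness π) ms)))
      (≤-reflexive (cong (λ b → b * (K * b))
        (sym (trans (evalPoly-pow Nᵖ d ms) (cong (_^ d) (evalPoly-N ms))))))
  where open Simulation 𝓕
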